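{- There are infinitely many cyclic cubic number fields $K$ such that in each of them there exist infinitely many non-constant arithmetic progressions of four squares over $K$.
   Context: A non-constant arithmetic progression of four squares over a field $K$ is a quadruple $a^2,b^2,c^2,d^2$ with $a,b,c,d\in K$ such that $b^2-a^2=c^2-b^2=d^2-c^2\neq 0$; progressions are counted up to scaling, i.e. as points $[a:b:c:d]\in\mathbb{P}^3(K)$. A cyclic cubic number field is a Galois extension of $\mathbb{Q}$ of degree $3$. -}

module Defs where

open import Algebra.Apartness.Bundles using (HeytingField; HeytingCommutativeRing)
open import Algebra.Bundles using (CommutativeRing)
open import Algebra.Bundles.Raw using (RawRing)
open import Algebra.Definitions.RawMonoid using (sum)
open import Algebra.Morphism.Structures using (module RingMorphisms)
open import Data.Fin.Patterns using (0F; 1F; 2F; 3F)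
open import Data.Nat.Base using (ℕ)
open import Data.Product.Base using (Σ; ∃; _×_; _,_)
open import Data.Rational.Base using (ℚ; 0ℚ)
import Data.Rational.Properties as ℚ
open import Data.Vec.Functional using (Vector)
open import Function.Definitions using (Injective)
open import Level using (0ℓ; _⊔_)
open import Relation.Binary.Core using (Rel)
open import Relation.Binary.PropositionalEquality.Core using (_≡_)
open import Relation.Nullary.Negation.Core using (¬_)

-- The constructive reading of "infinitely many, up to _≈_": an explicit sequence
-- without repetitions.
InfinitelyMany : ∀ {a ℓ p} {A : Set a} → Rel A ℓ → (A → Set p) → Set (a ⊔ ℓ ⊔ p)
InfinitelyMany {A = A} _≈_ P =
  ∃ λ (f : ℕ → A) → Injective _≡_ _≈_ f × (∀ n → P (f n))

-- Level 0 is enough, number fields being countable.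
Field : Set₁
Field = HeytingField 0ℓ 0ℓ 0ℓ

rawRing : Field → RawRing 0ℓ 0ℓ
rawRing K = CommutativeRing.rawRing
  (HeytingCommutativeRing.commutativeRing (HeytingField.heytingCommutativeRing K))

IsFieldHomomorphism : (K L : Field) →
                      (HeytingField.Carrier K → HeytingField.Carrier L) → Set
IsFieldHomomorphism K L = RingMorphisms.IsRingHomomorphism (rawRing K) (rawRing L)

IsFieldIsomorphism : (K L : Field) →
                     (HeytingField.Carrier K → HeytingField.Carrier L) → Set
IsFieldIsomorphism K L = RingMorphisms.IsRingIsomorphism (rawRing K) (rawRing L)

record Extensionℚ : Set₁ where
  field
    K               : Field
  open HeytingField K public
  field
    ι               : ℚ → Carrier
    isHomomorphism  : IsFieldHomomorphism ℚ.heytingField K ι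

  linearCombination : ∀ {n} → Vector ℚ n → Vector Carrier n → Carrier
  linearCombination q e = sum (RawRing.+-rawMonoid (rawRing K)) (λ i → ι (q i) * e i)

  LinearlyIndependent : ∀ {n} → Vector Carrier n → Set
  LinearlyIndependent e = ∀ q → linearCombination q e ≈ 0# → ∀ i → q i ≡ 0ℚ

  Spanning : ∀ {n} → Vector Carrier n → Set
  Spanning e = ∀ x → ∃ λ q → linearCombination q e ≈ x

  HasDegree : ℕ → Set
  HasDegree n = ∃ λ (e : Vector Carrier n) → LinearlyIndependent e × Spanning e

  IsAutomorphismOverℚ : (Carrier → Carrier) → Set
  IsAutomorphismOverℚ σ = IsFieldIsomorphism K K σ × (∀ q → σ (ι q) ≈ ι q)

  -- The fixed field of Aut(K/ℚ) is ℚ; this is meant for algebraic K.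
  IsGalois : Set
  IsGalois = ∀ x → (∀ σ → IsAutomorphismOverℚ σ → σ x ≈ x) → ∃ λ q → ι q ≈ x

record CyclicCubicField : Set₁ where
  field
    extension : Extensionℚ
  open Extensionℚ extension public
  field
    cubic     : HasDegree 3
    galois    : IsGalois

-- Cyclic cubic fields are identified when they are isomorphic as fields.
-- As they are Galois over ℚ, isomorphic ones embed in an algebraic closure
-- of ℚ with the same image, so this agrees with counting subfields.
_≅_ : Rel CyclicCubicField 0ℓ
K ≅ L = ∃ (IsFieldIsomorphism (CyclicCubicField.K K) (CyclicCubicField.K L))

module FourSquares (K : Field) where
  open HeytingField K

  ℙ³ : Set
  ℙ³ = Σ (Vector Carrier 4) λ v → ∃ λ i → ¬ (v i ≈ 0#)

  _∼_ : Rel ℙ³ 0ℓ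
  (v , _) ∼ (w , _) = ∃ λ c → ¬ (c ≈ 0#) × (∀ i → c * v i ≈ w i)

  IsNonConstantAP : ℙ³ → Set
  IsNonConstantAP (v , _) =
      (b * b - a * a ≈ c * c - b * b)
    × (c * c - b * b ≈ d * d - c * c)
    × ¬ (b * b - a * a ≈ 0#)
    where
    a b c d : Carrier
    a = v 0F
    b = v 1F
    c = v 2F
    d = v 3F

HasInfinitelyManyAPs : CyclicCubicField → Set
HasInfinitelyManyAPs K = InfinitelyMany _∼_ IsNonConstantAP
  where open FourSquares (CyclicCubicField.K K)

{-# OPTIONS --safe #-}

-- A rational point of G : n² = a³ - 10 a² e² + 88 a e⁴ - 108 e⁶, in coordinates (a / e² , n / e³),
-- gives the cubic X³ - 3 N X - 2 A with N = a (a + 12 e²) and A = a (a² - 36 a e² + 108 e⁴). As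
-- N³ = A² + 3 C² with C = 6 a e n, its discriminant (18 C)² is a square, so it defines a cyclic cubic
-- field as soon as it is irreducible. The root X gives a point of y² = x (x + 1) (x + 4), the curve
-- that parametrises the progressions of four squares. Doubling this point repeatedly gives progressions
-- whose differences have different 2-adic valuations after scaling, hence infinitely many of them.
--
-- Let a and e be coprime and 114 ∣ e. Then a is not a cube: otherwise Euler's lemma, applied to the
-- cube (A / a)² + 3 (C / a)², would make X an integer, and y² = x (x + 1) (x + 4) would have a
-- rational point that the descent for the concordant forms u² + s² and u² + 4 s² excludes. Hence some
-- prime q divides a to an exponent not divisible by 3; it is totally ramified, which proves the
-- irreducibility. For the next field take a point with e divisible by the primes q found so far,
-- which therefore are not totally ramified in it. Such a point is the difference of two congruent
-- points in a doubling sequence on G; the rank of G is positive, and congruent points exist by the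
-- pigeonhole principle.
module Submission where

open import Defs

-- The cubic comes from lines of slope 1: `y = x + c` meets y² = x (x + 1) (x + 4) at the roots of
-- x³ + 4 x² + (4 - 2 c) x - c², and for c = 8 e² / a the discriminant is a square as soon as (a /
-- e² , n / e³) lies on G. A root in a field puts (x , x + c) on the curve over that field.
--
-- The obstacle is that irreducibility and non-isomorphism are needed for infinitely many fields at
-- once. Both follow from one statement about a ternary cubic form at a totally ramified prime q.
-- With one choice of coefficients it is the norm form of the algebra, and having only the trivial
-- zero makes the algebra a field. With another choice its zeros are the elements of trace 0 and
-- norm 2 A′ up to scaling, where A′ belongs to a second field and q does not divide 2 A′.
--
-- The factor 114 = 2 · 3 · 19 absorbs the primes at which n can share a factor with a or with a +
-- 12 e²; Euler's lemma then meets coprime arguments.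

-- A reflective solver for polynomial identities and their linear consequences

module PolynomialIdentities where

  open import Algebra.Bundles using (CommutativeRing)
  open import Algebra.Morphism.Structures using (module RingMorphisms)
  open import Data.Bool.Base using (Bool; true; false; _∧_)
  open import Data.Fin.Base using (Fin; zero; suc)
  open import Data.Integer.Base as ℤ using (ℤ; 0ℤ; 1ℤ; -1ℤ)
  import Data.Integer.Properties as ℤ
  open import Data.Integer.Divisibility.Signed using (_∣_; divides)
  open import Data.List.Base using (List; []; _∷_)
  open import Data.Nat.Base as ℕ using (ℕ; zero; suc)
  import Data.Nat.Properties as ℕ
  open import Data.Product.Base using (_×_; _,_; proj₁; proj₂)
  open import Data.Vec.Base using (Vec; []; _∷_; lookup; replicate; zipWith; map; tabulate)
  open import Data.Vec.N-ary using (N-ary; _$ⁿ_)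
  open import Function.Base using (id)
  open import Level using (0ℓ)
  open import Relation.Binary.PropositionalEquality.Core as ≡ using (_≡_)
  open import Relation.Nullary.Decidable.Core using (yes; no)
  import Data.Vec.Properties as Vec
  import Algebra.Morphism.Construct.Identity as Identity

  infix  9 :-_
  infixl 8 _:*_
  infixl 7 _:+_ _:-_
  infix  4 _:=_

  data Expr (n : ℕ) : Set where
    con : ℤ → Expr n
    var : Fin n → Expr n
    _:+_ _:*_ : Expr n → Expr n → Expr n
    :-_ : Expr n → Expr n

  # : ∀ {n} → ℕ → Expr n
  # k = con (ℤ.+ k)

  _:-_ : ∀ {n} → Expr n → Expr n → Expr n
  x :- y = x :+ :- y

  _:=_ : ∀ {n} → Expr n → Expr n → Expr n × Expr n
  _:=_ = _,_

  -- The conclusion L = R, and for each hypothesis l = r its multiplier: (c , l , r).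
  Linear₁ Linear₂ Quotient : ℕ → Set
  Linear₁ n  = (Expr n × Expr n) × Expr n × (Expr n × Expr n)
  Linear₂ n  = (Expr n × Expr n) × (Expr n × (Expr n × Expr n)) × Expr n × (Expr n × Expr n)
  Quotient n = Expr n × Expr n × Expr n × Expr n

  vars : ∀ {n} → Vec (Expr n) n
  vars = tabulate var

  private
    -- Sparse polynomials: terms in decreasing lexicographic order of the exponents.
    Monomial : ℕ → Set
    Monomial = Vec ℕ

    Poly : ℕ → Set
    Poly n = List (ℤ × Monomial n)

    data Comparison {n} (l : Monomial n) : Monomial n → Set where
      less greater : ∀ {m} → Comparison l m
      equal        : Comparison l l

    compare : ∀ {n} (l m : Monomial n) → Comparison l m
    compare []      []      = equal
    compare (i ∷ l) (j ∷ m) with i ℕ.≟ j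
    ... | no _ with i ℕ.<ᵇ j
    ...   | true  = less
    ...   | false = greater
    compare (i ∷ l) (i ∷ m) | yes ≡.refl with compare l m
    ... | less    = less
    ... | greater = greater
    ... | equal   = equal

    -- Zero coefficients are dropped, so that a difference that cancels completely becomes `[]`,
    -- which is what `_≡ᵖ_` tests.
    cons : ∀ {n} → ℤ → Monomial n → Poly n → Poly n
    cons c m p with c ℤ.≟ 0ℤ
    ... | yes _ = p
    ... | no  _ = (c , m) ∷ p

    infixl 6 _⊕_
    infixl 7 _⊗_

    _⊕_ : ∀ {n} → Poly n → Poly n → Poly n
    -- The merge with the head of the first list split off, so that each call shrinks one of the two
    -- lists.
    insert : ∀ {n} → ℤ → Monomial n → Poly n → Poly n → Poly n

    []            ⊕ q = q
    ((c , l) ∷ p) ⊕ q = insert c l p q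

    insert c l p []            = (c , l) ∷ p
    insert c l p ((d , m) ∷ q) with compare l m
    ... | less    = (d , m) ∷ insert c l p q
    ... | greater = (c , l) ∷ (p ⊕ ((d , m) ∷ q))
    ... | equal   = cons (c ℤ.+ d) l (p ⊕ q)

    scale : ∀ {n} → ℤ → Monomial n → Poly n → Poly n
    scale c l []            = []
    scale c l ((d , m) ∷ q) = (c ℤ.* d , zipWith ℕ._+_ l m) ∷ scale c l q

    _⊗_ : ∀ {n} → Poly n → Poly n → Poly n
    []            ⊗ q = []
    ((c , l) ∷ p) ⊗ q = scale c l q ⊕ (p ⊗ q)

    unit : ∀ {n} → Fin n → Monomial n
    unit zero    = 1 ∷ replicate _ 0
    unit (suc i) = 0 ∷ unit i

  normalise : ∀ {n} → Expr n → Poly n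
  normalise (con c)  = cons c (replicate _ 0) []
  normalise (var i)  = (1ℤ , unit i) ∷ []
  normalise (e :+ f) = normalise e ⊕ normalise f
  normalise (e :* f) = normalise e ⊗ normalise f
  normalise (:- e)   = scale -1ℤ (replicate _ 0) (normalise e)

  infix 4 _≡ᵖ_

  -- For closed expressions `refl` proves it by evaluation. The coefficients are integers, so one
  -- computation serves every ring that receives a homomorphism from ℤ.
  _≡ᵖ_ : ∀ {n} (e f : Expr n) → Set
  e ≡ᵖ f = normalise (e :- f) ≡ []

  module Solver (R : CommutativeRing 0ℓ 0ℓ)
                (ι : ℤ → CommutativeRing.Carrier R)
                (homomorphism : RingMorphisms.IsRingHomomorphism
                  (CommutativeRing.rawRing ℤ.+-*-commutativeRing) (CommutativeRing.rawRing R) ι)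
    where

    open CommutativeRing R
    open import Algebra.Properties.Ring ring using (-1*x≈-x; +-cancelʳ; x∙y⁻¹≈ε⇒x≈y)
    open import Algebra.Properties.CommutativeSemigroup *-commutativeSemigroup using () renaming (interchange to *-interchange)
    open import Algebra.Properties.CommutativeSemigroup +-commutativeSemigroup using () renaming (interchange to +-interchange; x∙yz≈y∙xz to +-swap)
    open import Algebra.Properties.Semiring.Exp semiring using (_^_; ^-homo-*)
    open import Relation.Binary.Reasoning.Setoid setoid
    private module ι = RingMorphisms.IsRingHomomorphism homomorphism

    ⟦_⟧ : ∀ {n} → Expr n → Vec Carrier n → Carrier
    ⟦ con c ⟧  ρ = ι c
    ⟦ var i ⟧  ρ = lookup ρ i
    ⟦ e :+ f ⟧ ρ = ⟦ e ⟧ ρ + ⟦ f ⟧ ρ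
    ⟦ e :* f ⟧ ρ = ⟦ e ⟧ ρ * ⟦ f ⟧ ρ
    ⟦ :- e ⟧   ρ = - ⟦ e ⟧ ρ

    private
      ⟦_⟧ₘ : ∀ {n} → Monomial n → Vec Carrier n → Carrier
      ⟦ [] ⟧ₘ    []      = 1#
      ⟦ i ∷ m ⟧ₘ (x ∷ ρ) = x ^ i * ⟦ m ⟧ₘ ρ

      ⟦_⟧ₚ : ∀ {n} → Poly n → Vec Carrier n → Carrier
      ⟦ [] ⟧ₚ          ρ = 0#
      ⟦ (c , m) ∷ p ⟧ₚ ρ = ι c * ⟦ m ⟧ₘ ρ + ⟦ p ⟧ₚ ρ

      cons-correct : ∀ {n} c (m : Monomial n) p ρ → ⟦ cons c m p ⟧ₚ ρ ≈ ι c * ⟦ m ⟧ₘ ρ + ⟦ p ⟧ₚ ρ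
      cons-correct c m p ρ with c ℤ.≟ 0ℤ
      ... | no  _      = refl
      ... | yes ≡.refl = sym (trans (+-congʳ (trans (*-congʳ ι.0#-homo) (zeroˡ _))) (+-identityˡ _))

      ⊕-correct : ∀ {n} (p q : Poly n) ρ → ⟦ p ⊕ q ⟧ₚ ρ ≈ ⟦ p ⟧ₚ ρ + ⟦ q ⟧ₚ ρ
      insert-correct : ∀ {n} c (l : Monomial n) p q ρ →
                       ⟦ insert c l p q ⟧ₚ ρ ≈ ι c * ⟦ l ⟧ₘ ρ + ⟦ p ⟧ₚ ρ + ⟦ q ⟧ₚ ρ

      ⊕-correct []            q ρ = sym (+-identityˡ _)
      ⊕-correct ((c , l) ∷ p) q ρ = insert-correct c l p q ρ

      insert-correct c l p []            ρ = sym (+-identityʳ _)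
      insert-correct c l p ((d , m) ∷ q) ρ with compare l m
      ... | less    = trans (+-congˡ (insert-correct c l p q ρ)) (+-swap _ _ _)
      ... | greater = trans (+-congˡ (⊕-correct p ((d , m) ∷ q) ρ)) (sym (+-assoc _ _ _))
      ... | equal   = begin
        ⟦ cons (c ℤ.+ d) l (p ⊕ q) ⟧ₚ ρ                              ≈⟨ cons-correct (c ℤ.+ d) l (p ⊕ q) ρ ⟩
        ι (c ℤ.+ d) * ⟦ l ⟧ₘ ρ + ⟦ p ⊕ q ⟧ₚ ρ                        ≈⟨ +-cong (trans (*-congʳ (ι.+-homo c d)) (distribʳ _ _ _)) (⊕-correct p q ρ) ⟩
        (ι c * ⟦ l ⟧ₘ ρ + ι d * ⟦ l ⟧ₘ ρ) + (⟦ p ⟧ₚ ρ + ⟦ q ⟧ₚ ρ)    ≈⟨ +-interchange _ _ _ _ ⟩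
        ι c * ⟦ l ⟧ₘ ρ + ⟦ p ⟧ₚ ρ + (ι d * ⟦ l ⟧ₘ ρ + ⟦ q ⟧ₚ ρ)      ∎

      zipWith-correct : ∀ {n} (l m : Monomial n) ρ → ⟦ zipWith ℕ._+_ l m ⟧ₘ ρ ≈ ⟦ l ⟧ₘ ρ * ⟦ m ⟧ₘ ρ
      zipWith-correct []      []      []      = sym (*-identityˡ _)
      zipWith-correct (i ∷ l) (j ∷ m) (x ∷ ρ) =
        trans (*-cong (^-homo-* x i j) (zipWith-correct l m ρ)) (*-interchange _ _ _ _)

      scale-correct : ∀ {n} c (l : Monomial n) p ρ → ⟦ scale c l p ⟧ₚ ρ ≈ ι c * ⟦ l ⟧ₘ ρ * ⟦ p ⟧ₚ ρ
      scale-correct c l []            ρ = sym (zeroʳ _)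
      scale-correct c l ((d , m) ∷ p) ρ = trans
        (+-cong (trans (*-cong (ι.*-homo c d) (zipWith-correct l m ρ)) (*-interchange _ _ _ _))
                (scale-correct c l p ρ))
        (sym (distribˡ _ _ _))

      ⊗-correct : ∀ {n} (p q : Poly n) ρ → ⟦ p ⊗ q ⟧ₚ ρ ≈ ⟦ p ⟧ₚ ρ * ⟦ q ⟧ₚ ρ
      ⊗-correct []            q ρ = sym (zeroˡ _)
      ⊗-correct ((c , l) ∷ p) q ρ = trans (⊕-correct (scale c l q) (p ⊗ q) ρ)
        (trans (+-cong (scale-correct c l q ρ) (⊗-correct p q ρ)) (sym (distribʳ _ _ _)))

      one-correct : ∀ {n} (ρ : Vec Carrier n) → ⟦ replicate n 0 ⟧ₘ ρ ≈ 1#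
      one-correct []      = refl
      one-correct (x ∷ ρ) = trans (*-identityˡ _) (one-correct ρ)

      unit-correct : ∀ {n} (i : Fin n) ρ → ⟦ unit i ⟧ₘ ρ ≈ lookup ρ i
      unit-correct zero    (x ∷ ρ) = trans (*-congˡ (one-correct ρ)) (trans (*-identityʳ _) (*-identityʳ x))
      unit-correct (suc i) (x ∷ ρ) = trans (*-identityˡ _) (unit-correct i ρ)

      correct : ∀ {n} (e : Expr n) ρ → ⟦ normalise e ⟧ₚ ρ ≈ ⟦ e ⟧ ρ
      correct (con c)  ρ = trans (cons-correct c (replicate _ 0) [] ρ)
        (trans (+-identityʳ _) (trans (*-congˡ (one-correct ρ)) (*-identityʳ _)))
      correct (var i)  ρ = trans (+-identityʳ _)
        (trans (*-congʳ ι.1#-homo) (trans (*-identityˡ _) (unit-correct i ρ)))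
      correct (e :+ f) ρ = trans (⊕-correct (normalise e) (normalise f) ρ) (+-cong (correct e ρ) (correct f ρ))
      correct (e :* f) ρ = trans (⊗-correct (normalise e) (normalise f) ρ) (*-cong (correct e ρ) (correct f ρ))
      correct (:- e)   ρ = trans (scale-correct -1ℤ (replicate _ 0) (normalise e) ρ)
        (trans (*-cong (trans (*-cong (trans (ι.-‿homo 1ℤ) (-‿cong ι.1#-homo)) (one-correct ρ)) (*-identityʳ _)) (correct e ρ)) (-1*x≈-x _))

    prove : ∀ {n} (e f : Expr n) (ρ : Vec Carrier n) → e ≡ᵖ f → ⟦ e ⟧ ρ ≈ ⟦ f ⟧ ρ
    prove e f ρ eq = x∙y⁻¹≈ε⇒x≈y _ _ (trans (sym (correct (e :- f) ρ)) (reflexive (≡.cong (λ p → ⟦ p ⟧ₚ ρ) eq)))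

    solve : ∀ {n} (ρ : Vec Carrier n) (f : N-ary n (Expr n) (Expr n × Expr n)) →
            (proj₁ (f $ⁿ vars)) ≡ᵖ (proj₂ (f $ⁿ vars)) →
            ⟦ proj₁ (f $ⁿ vars) ⟧ ρ ≈ ⟦ proj₂ (f $ⁿ vars) ⟧ ρ
    solve ρ f eq = prove (proj₁ (f $ⁿ vars)) (proj₂ (f $ⁿ vars)) ρ eq

    -- Derives L ≈ R from hypotheses lᵢ ≈ rᵢ, given L - R = Σ cᵢ (lᵢ - rᵢ) as polynomials.
    solve₁ : ∀ {n} (ρ : Vec Carrier n) (f : N-ary n (Expr n) (Linear₁ n)) →
             let ((L , R) , c , (l , r)) = _$ⁿ_ {B = Linear₁ n} f vars in
             (L :+ c :* r) ≡ᵖ (R :+ c :* l) →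
             ⟦ l ⟧ ρ ≈ ⟦ r ⟧ ρ → ⟦ L ⟧ ρ ≈ ⟦ R ⟧ ρ
    solve₁ {n} ρ f eq l≈r = let ((L , R) , c , (l , r)) = _$ⁿ_ {B = Linear₁ n} f vars in +-cancelʳ _ _ _ (trans (prove (L :+ c :* r) (R :+ c :* l) ρ eq) (+-congˡ (*-congˡ l≈r)))

    solve₂ : ∀ {n} (ρ : Vec Carrier n) (f : N-ary n (Expr n) (Linear₂ n)) →
             let ((L , R) , (c , (l , r)) , c′ , (l′ , r′)) = _$ⁿ_ {B = Linear₂ n} f vars in
             (L :+ (c :* r :+ c′ :* r′)) ≡ᵖ (R :+ (c :* l :+ c′ :* l′)) →
             ⟦ l ⟧ ρ ≈ ⟦ r ⟧ ρ → ⟦ l′ ⟧ ρ ≈ ⟦ r′ ⟧ ρ → ⟦ L ⟧ ρ ≈ ⟦ R ⟧ ρ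
    solve₂ {n} ρ f eq l≈r l′≈r′ = let ((L , R) , (c , (l , r)) , c′ , (l′ , r′)) = _$ⁿ_ {B = Linear₂ n} f vars in +-cancelʳ _ _ _ (trans (prove (L :+ (c :* r :+ c′ :* r′)) (R :+ (c :* l :+ c′ :* l′)) ρ eq)
      (+-congˡ (+-cong (*-congˡ l≈r) (*-congˡ l′≈r′))))

  id-isRingHomomorphism : RingMorphisms.IsRingHomomorphism
    (CommutativeRing.rawRing ℤ.+-*-commutativeRing) (CommutativeRing.rawRing ℤ.+-*-commutativeRing) id
  id-isRingHomomorphism = Identity.isRingHomomorphism (CommutativeRing.rawRing ℤ.+-*-commutativeRing) ≡.refl

  module ℤSolver = Solver ℤ.+-*-commutativeRing id id-isRingHomomorphism

  open ℤSolver public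

  module Evaluation (R : CommutativeRing 0ℓ 0ℓ)
                    (ι : ℤ → CommutativeRing.Carrier R)
                    (homomorphism : RingMorphisms.IsRingHomomorphism
                      (CommutativeRing.rawRing ℤ.+-*-commutativeRing) (CommutativeRing.rawRing R) ι)
    where

    open CommutativeRing R
    private
      module ι = RingMorphisms.IsRingHomomorphism homomorphism
      module R = Solver R ι homomorphism

    -- Carries equations between integers, such as N³ = A² + 3 C², into `R`.
    ⟦⟧-ι : ∀ {n} (e : Expr n) (ρ : Vec ℤ n) → R.⟦ e ⟧ (map ι ρ) ≈ ι (⟦ e ⟧ ρ)
    ⟦⟧-ι (con c)  ρ = refl
    ⟦⟧-ι (var i)  ρ = reflexive (Vec.lookup-map i ι ρ)
    ⟦⟧-ι (e :+ f) ρ = trans (+-cong (⟦⟧-ι e ρ) (⟦⟧-ι f ρ)) (sym (ι.+-homo (⟦ e ⟧ ρ) (⟦ f ⟧ ρ)))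
    ⟦⟧-ι (e :* f) ρ = trans (*-cong (⟦⟧-ι e ρ) (⟦⟧-ι f ρ)) (sym (ι.*-homo (⟦ e ⟧ ρ) (⟦ f ⟧ ρ)))
    ⟦⟧-ι (:- e)   ρ = trans (-‿cong (⟦⟧-ι e ρ)) (sym (ι.-‿homo (⟦ e ⟧ ρ)))

  infixr 9 _:^_

  _:^_ : ∀ {n} → Expr n → ℕ → Expr n
  x :^ zero  = # 1
  x :^ suc k = x :* (x :^ k)

  private
    cancel^ : ∀ t .{{_ : ℤ.NonZero t}} {n} (e : Expr n) ρ → ⟦ e ⟧ ρ ≡ t → ∀ k {x} → ⟦ e :^ k ⟧ ρ ℤ.* x ≡ 0ℤ → x ≡ 0ℤ
    cancel^ t e ρ eq zero    {x} h = ≡.trans (≡.sym (ℤ.*-identityˡ x)) h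
    cancel^ t e ρ ≡.refl (suc k) {x} h = cancel^ t e ρ ≡.refl k
      (ℤ.*-cancelˡ-≡ t _ 0ℤ (≡.trans (≡.sym (ℤ.*-assoc t _ x)) (≡.trans h (≡.sym (ℤ.*-zeroʳ t)))))

  -- Derives t ∣ z from r = 0, given t ^ k (z - c t) = r as polynomials; t is a nonzero integer.
  solve-∣ : ∀ k {n} (ρ : Vec ℤ n) (f : N-ary n (Expr n) (Quotient n)) →
            let (t , z , c , r) = _$ⁿ_ {B = Quotient n} f vars in
            (t :^ k :* (z :- c :* t)) ≡ᵖ r →
            .{{_ : ℤ.NonZero (⟦ t ⟧ ρ)}} →
            ⟦ r ⟧ ρ ≡ 0ℤ → ⟦ t ⟧ ρ ∣ ⟦ z ⟧ ρ
  solve-∣ k {n} ρ f eq h = let (t , z , c , r) = _$ⁿ_ {B = Quotient n} f vars in divides (⟦ c ⟧ ρ) (ℤ.i-j≡0⇒i≡j _ _ (cancel^ (⟦ t ⟧ ρ) t ρ ≡.refl k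
    (≡.trans (prove (t :^ k :* (z :- c :* t)) r ρ eq) h)))

  -- Expressions without negation also have values in ℕ.
  positive : ∀ {n} → Expr n → Bool
  positive (con (ℤ.+ _))     = true
  positive (con ℤ.-[1+ _ ])  = false
  positive (var i)           = true
  positive (e :+ f)          = positive e ∧ positive f
  positive (e :* f)          = positive e ∧ positive f
  positive (:- e)            = false

  ⟦_⟧ⁿ : ∀ {n} → Expr n → Vec ℕ n → ℕ
  ⟦ con c ⟧ⁿ  ρ = ℤ.∣ c ∣
  ⟦ var i ⟧ⁿ  ρ = lookup ρ i
  ⟦ e :+ f ⟧ⁿ ρ = ⟦ e ⟧ⁿ ρ ℕ.+ ⟦ f ⟧ⁿ ρ
  ⟦ e :* f ⟧ⁿ ρ = ⟦ e ⟧ⁿ ρ ℕ.* ⟦ f ⟧ⁿ ρ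
  ⟦ :- e ⟧ⁿ   ρ = 0

  private
    ∧-true : ∀ a b → a ∧ b ≡ true → a ≡ true × b ≡ true
    ∧-true true true _ = ≡.refl , ≡.refl

    ⟦⟧ⁿ-correct : ∀ {n} (e : Expr n) ρ → positive e ≡ true → ℤ.+ ⟦ e ⟧ⁿ ρ ≡ ⟦ e ⟧ (map ℤ.+_ ρ)
    ⟦⟧ⁿ-correct (con (ℤ.+ _)) ρ _ = ≡.refl
    ⟦⟧ⁿ-correct (var i)       ρ _ = ≡.sym (Vec.lookup-map i ℤ.+_ ρ)
    ⟦⟧ⁿ-correct (e :+ f)      ρ h = ≡.cong₂ ℤ._+_ (⟦⟧ⁿ-correct e ρ (proj₁ (∧-true (positive e) (positive f) h))) (⟦⟧ⁿ-correct f ρ (proj₂ (∧-true (positive e) (positive f) h)))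
    ⟦⟧ⁿ-correct (e :* f)      ρ h = ≡.trans (ℤ.pos-* (⟦ e ⟧ⁿ ρ) (⟦ f ⟧ⁿ ρ))
      (≡.cong₂ ℤ._*_ (⟦⟧ⁿ-correct e ρ (proj₁ (∧-true (positive e) (positive f) h))) (⟦⟧ⁿ-correct f ρ (proj₂ (∧-true (positive e) (positive f) h))))

    proveⁿ : ∀ {n} (e f : Expr n) ρ → e ≡ᵖ f → positive e ≡ true → positive f ≡ true → ⟦ e ⟧ⁿ ρ ≡ ⟦ f ⟧ⁿ ρ
    proveⁿ e f ρ eq h h′ = ℤ.+-injective (≡.trans (⟦⟧ⁿ-correct e ρ h)
      (≡.trans (prove e f (map ℤ.+_ ρ) eq) (≡.sym (⟦⟧ⁿ-correct f ρ h′))))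

  solveⁿ : ∀ {n} (ρ : Vec ℕ n) (f : N-ary n (Expr n) (Expr n × Expr n)) →
           let (L , R) = _$ⁿ_ {B = Expr n × Expr n} f vars in
           L ≡ᵖ R → positive L ∧ positive R ≡ true → ⟦ L ⟧ⁿ ρ ≡ ⟦ R ⟧ⁿ ρ
  solveⁿ {n} ρ f eq h = let (L , R) = _$ⁿ_ {B = Expr n × Expr n} f vars in
    proveⁿ L R ρ eq (proj₁ (∧-true (positive L) (positive R) h)) (proj₂ (∧-true (positive L) (positive R) h))

  -- The multiple of the hypothesis is added to both sides instead of being subtracted; all
  -- expressions stay free of negation, and the identity checked over ℤ descends to ℕ.
  solveⁿ₁ : ∀ {n} (ρ : Vec ℕ n) (f : N-ary n (Expr n) (Linear₁ n)) →
            let ((L , R) , c , (l , r)) = _$ⁿ_ {B = Linear₁ n} f vars in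
            (L :+ c :* r) ≡ᵖ (R :+ c :* l) → positive (L :+ c :* r) ∧ positive (R :+ c :* l) ≡ true →
            ⟦ l ⟧ⁿ ρ ≡ ⟦ r ⟧ⁿ ρ → ⟦ L ⟧ⁿ ρ ≡ ⟦ R ⟧ⁿ ρ
  solveⁿ₁ {n} ρ f eq h l≡r = let ((L , R) , c , (l , r)) = _$ⁿ_ {B = Linear₁ n} f vars in
    ℕ.+-cancelʳ-≡ (⟦ c :* l ⟧ⁿ ρ) _ _ (≡.trans (≡.cong (λ x → ⟦ L ⟧ⁿ ρ ℕ.+ ⟦ c ⟧ⁿ ρ ℕ.* x) l≡r)
      (proveⁿ (L :+ c :* r) (R :+ c :* l) ρ eq (proj₁ (∧-true (positive (L :+ c :* r)) (positive (R :+ c :* l)) h)) (proj₂ (∧-true (positive (L :+ c :* r)) (positive (R :+ c :* l)) h))))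

  solveⁿ₂ : ∀ {n} (ρ : Vec ℕ n) (f : N-ary n (Expr n) (Linear₂ n)) →
            let ((L , R) , (c , (l , r)) , c′ , (l′ , r′)) = _$ⁿ_ {B = Linear₂ n} f vars in
            (L :+ (c :* r :+ c′ :* r′)) ≡ᵖ (R :+ (c :* l :+ c′ :* l′)) →
            positive (L :+ (c :* r :+ c′ :* r′)) ∧ positive (R :+ (c :* l :+ c′ :* l′)) ≡ true →
            ⟦ l ⟧ⁿ ρ ≡ ⟦ r ⟧ⁿ ρ → ⟦ l′ ⟧ⁿ ρ ≡ ⟦ r′ ⟧ⁿ ρ → ⟦ L ⟧ⁿ ρ ≡ ⟦ R ⟧ⁿ ρ
  solveⁿ₂ {n} ρ f eq h l≡r l′≡r′ = let ((L , R) , (c , (l , r)) , c′ , (l′ , r′)) = _$ⁿ_ {B = Linear₂ n} f vars in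
    ℕ.+-cancelʳ-≡ (⟦ c :* l :+ c′ :* l′ ⟧ⁿ ρ) _ _
      (≡.trans (≡.cong₂ (λ x y → ⟦ L ⟧ⁿ ρ ℕ.+ (⟦ c ⟧ⁿ ρ ℕ.* x ℕ.+ ⟦ c′ ⟧ⁿ ρ ℕ.* y)) l≡r l′≡r′)
      (proveⁿ (L :+ (c :* r :+ c′ :* r′)) (R :+ (c :* l :+ c′ :* l′)) ρ eq (proj₁ (∧-true (positive (L :+ (c :* r :+ c′ :* r′))) (positive (R :+ (c :* l :+ c′ :* l′))) h)) (proj₂ (∧-true (positive (L :+ (c :* r :+ c′ :* r′))) (positive (R :+ (c :* l :+ c′ :* l′))) h))))

-- Euclid's lemma in ℤ and infinite descent by a prime

module PrimeDivisibility where

  open import Data.Nat.Base as ℕ using (ℕ; zero; suc)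
  import Data.Nat.Properties as ℕ
  import Data.Nat.Divisibility as ℕ
  open import Data.Nat.Primality using (Prime; euclidsLemma; prime⇒nonZero; prime⇒nonTrivial)
  open import Data.Integer.Base hiding (suc)
  open import Data.Integer.Properties
  open import Data.Integer.Divisibility.Signed renaming (_∣_ to _∣ˢ_)
  open import Data.Product.Base using (_×_; _,_)
  open import Data.Sum.Base using (_⊎_; inj₁; inj₂; [_,_]′)
  open import Data.Empty using (⊥-elim)
  open import Relation.Nullary
  open import Function.Base using (_∘_; id)
  open import Relation.Binary.PropositionalEquality

  ≡-from-diff : ∀ {x y} → x - y ≡ 0ℤ → x ≡ y
  ≡-from-diff {x} {y} = i-j≡0⇒i≡j x y

  module _ {p : ℕ} (pp : Prime p) where

    private instance
      _ = prime⇒nonZero pp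

    abstract
      prime-∣* : ∀ {x y} → + p ∣ˢ x * y → + p ∣ˢ x ⊎ + p ∣ˢ y
      prime-∣* {x} {y} d
        with euclidsLemma ∣ x ∣ ∣ y ∣ pp (subst (p ℕ.∣_) (abs-* x y) (∣⇒∣ᵤ d))
      ... | inj₁ e = inj₁ (∣ᵤ⇒∣ e)
      ... | inj₂ e = inj₂ (∣ᵤ⇒∣ e)

      prime-∣*ʳ : ∀ {x y} → ¬ + p ∣ˢ x → + p ∣ˢ x * y → + p ∣ˢ y
      prime-∣*ʳ ¬d d = [ ⊥-elim ∘ ¬d , id ]′ (prime-∣* d)

      prime-∣² : ∀ {x} → + p ∣ˢ x * x → + p ∣ˢ x
      prime-∣² d = [ id , id ]′ (prime-∣* d)

      prime-∣³ : ∀ {x} → + p ∣ˢ x * x * x → + p ∣ˢ x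
      prime-∣³ d = [ prime-∣² , id ]′ (prime-∣* d)

      cancel-prime : ∀ {x y} → + p * x ≡ + p * y → x ≡ y
      cancel-prime {x} {y} = *-cancelˡ-≡ (+ p) x y

    private
      halve′ : ∀ m n → p ℕ.* m ℕ.≤ suc n → m ℕ.≤ n
      halve′ zero    n h = ℕ.z≤n
      halve′ (suc m) n h = ℕ.≤-pred (begin
          suc (suc m)         ≤⟨ ℕ.s≤s (ℕ.m≤n+m (suc m) m) ⟩
          suc m ℕ.+ suc m     ≡⟨ cong (suc m ℕ.+_) (ℕ.+-identityʳ (suc m)) ⟨
          2 ℕ.* suc m         ≤⟨ ℕ.*-monoˡ-≤ (suc m) (ℕ.nonTrivial⇒n>1 p {{prime⇒nonTrivial pp}}) ⟩
          p ℕ.* suc m         ≤⟨ h ⟩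
          suc n               ∎)
        where open ℕ.≤-Reasoning

      halve : ∀ x n → ∣ + p * x ∣ ℕ.≤ suc n → ∣ x ∣ ℕ.≤ n
      halve x n h = halve′ ∣ x ∣ n (subst (ℕ._≤ suc n) (abs-* (+ p) x) h)

    module _ (P : ℤ → ℤ → ℤ → Set)
             (step : ∀ {x y z} → P x y z → + p ∣ˢ x × + p ∣ˢ y × + p ∣ˢ z)
             (divide : ∀ x y z → P (+ p * x) (+ p * y) (+ p * z) → P x y z)
      where

      private
        go : ∀ n x y z → P x y z → ∣ x ∣ ℕ.≤ n → ∣ y ∣ ℕ.≤ n → ∣ z ∣ ℕ.≤ n → x ≡ 0ℤ × y ≡ 0ℤ × z ≡ 0ℤ
        go zero x y z P₀ h i j =
          ∣i∣≡0⇒i≡0 (ℕ.n≤0⇒n≡0 h) , ∣i∣≡0⇒i≡0 (ℕ.n≤0⇒n≡0 i) , ∣i∣≡0⇒i≡0 (ℕ.n≤0⇒n≡0 j)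
        go (suc n) x y z P₀ h i j with step P₀
        ... | divides a ea , divides b eb , divides c ec
          rewrite trans ea (*-comm a (+ p)) | trans eb (*-comm b (+ p)) | trans ec (*-comm c (+ p))
          with go n a b c (divide a b c P₀) (halve a n h) (halve b n i) (halve c n j)
        ... | refl , refl , refl = *-zeroʳ (+ p) , *-zeroʳ (+ p) , *-zeroʳ (+ p)

      -- Each division by `p` lowers a common bound for the three absolute values, until the bound
      -- is 0.
      infinite-descent : ∀ {x y z} → P x y z → x ≡ 0ℤ × y ≡ 0ℤ × z ≡ 0ℤ
      infinite-descent {x} {y} {z} P₀ = go (∣ x ∣ ℕ.+ (∣ y ∣ ℕ.+ ∣ z ∣)) x y z P₀
        (ℕ.m≤m+n _ _) (ℕ.≤-trans (ℕ.m≤m+n ∣ y ∣ _) (ℕ.m≤n+m _ ∣ x ∣))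
        (ℕ.≤-trans (ℕ.m≤n+m ∣ z ∣ _) (ℕ.m≤n+m _ ∣ x ∣))

-- A ternary cubic form without zeros at a totally ramified prime

module RamifiedForm where

  open PrimeDivisibility
  open import Data.Nat.Base as ℕ using (ℕ; suc)
  open import Data.Nat.Primality using (Prime; prime⇒nonZero)
  open import Data.Integer.Base hiding (suc)
  open import Data.Integer.Properties
  open import Data.Integer.Divisibility.Signed renaming (_∣_ to _∣ˢ_)
  open import Data.Product.Base using (_×_; _,_)
  open import Relation.Nullary
  open import Function.Base using (_∘_)
  open import Relation.Binary.PropositionalEquality
  open import Data.Vec.Base using ([]; _∷_)
  open PolynomialIdentities

  -- For X³ = 3 N X + 2 A and Y = X² - 2 N, the element z = x X + y Y satisfies z³ = 3 Q z + 2 F.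
  Qf Ff : ℤ → ℤ → ℤ → ℤ → ℤ
  Qf N A x y = N * (x * x) + + 2 * (A * (x * y)) + N * N * (y * y)
  Ff N A x y = A * (x * x * x) + + 3 * (N * N * (x * x * y)) + + 3 * (N * A * (x * (y * y)))
    + (+ 2 * (A * A) - N * N * N) * (y * y * y)

  -- For M = L = 1 this is the norm of w + x X + y Y. For M = - 2 A′ and L = 0, a zero with w = 1 is
  -- an element x X + y Y of trace 0 and norm 2 A′.
  Rf : ℤ → ℤ → ℤ → ℤ → ℤ → ℤ → ℤ → ℤ
  Rf M L N A x y w = M * (w * w * w) - + 3 * (L * (Qf N A x y * w)) + + 2 * Ff N A x y

  -- A record, so that the form is not unfolded when arguments are compared.
  record Zero (M L N A x y w : ℤ) : Set where
    constructor ⟪_⟫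
    field
      vanishes : Rf M L N A x y w ≡ 0ℤ

  open Zero public

  :Q :F : ∀ {n} (N A x y : Expr n) → Expr n
  :Q N A x y = N :* (x :* x) :+ # 2 :* (A :* (x :* y)) :+ N :* N :* (y :* y)
  :F N A x y = A :* (x :* x :* x) :+ # 3 :* (N :* N :* (x :* x :* y)) :+ # 3 :* (N :* A :* (x :* (y :* y)))
    :+ (# 2 :* (A :* A) :- N :* N :* N) :* (y :* y :* y)

  :R : ∀ {n} (M L N A x y w : Expr n) → Expr n
  :R M L N A x y w = M :* (w :* w :* w) :- # 3 :* (L :* (:Q N A x y :* w)) :+ # 2 :* :F N A x y

  -- the quotients by a power of t of the two forms when N and A are divisible by t
  :Q₁ :F₁ : ∀ {n} (t N A x y : Expr n) → Expr n
  :Q₁ t N A x y = N :* (x :* x) :+ # 2 :* (A :* (x :* y)) :+ t :* N :* N :* (y :* y)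
  :F₁ t N A x y = A :* (x :* x :* x) :+ # 3 :* (t :* N :* N :* (x :* x :* y)) :+ # 3 :* (t :* N :* A :* (x :* (y :* y)))
    :+ (# 2 :* (t :* A :* A) :- t :* t :* N :* N :* N) :* (y :* y :* y)

  module Ramified {q : ℕ} (pq : Prime q) (q≢2 : ¬ + q ∣ˢ + 2) (M L N A : ℤ) (q∤M : ¬ + q ∣ˢ M) (q∤A : ¬ + q ∣ˢ A) where

    private
      instance
        _ = prime⇒nonZero pq

      t : ℤ
      t = + q

      from2 : ∀ {x} → t ∣ˢ + 2 * (A * (x * x * x)) → t ∣ˢ x
      from2 = prime-∣³ pq ∘ prime-∣*ʳ pq q∤A ∘ prime-∣*ʳ pq q≢2

      from4 : ∀ {x} → t ∣ˢ + 2 * (+ 2 * (A * (A * (x * x * x)))) → t ∣ˢ x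
      from4 = prime-∣³ pq ∘ prime-∣*ʳ pq q∤A ∘ prime-∣*ʳ pq q∤A ∘ prime-∣*ʳ pq q≢2 ∘ prime-∣*ʳ pq q≢2

      fromM : ∀ {x} → t ∣ˢ M * (x * x * x) → t ∣ˢ x
      fromM = prime-∣³ pq ∘ prime-∣*ʳ pq q∤M

      homogeneous : ∀ N′ A′ x y w → Zero M L N′ A′ (t * x) (t * y) (t * w) → Zero M L N′ A′ x y w
      homogeneous N′ A′ x y w e = ⟪ cancel0 (cancel0 (cancel0 (trans (solve (t ∷ M ∷ L ∷ N′ ∷ A′ ∷ x ∷ y ∷ w ∷ []) (λ t M L N A x y w →
          t :* (t :* (t :* :R M L N A x y w)) := :R M L N A (t :* x) (t :* y) (t :* w)) refl) (vanishes e)))) ⟫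
        where
        cancel0 : ∀ {z} → t * z ≡ 0ℤ → z ≡ 0ℤ
        cancel0 e = cancel-prime pq (trans e (sym (*-zeroʳ t)))

      abstract
        -- The Newton polygon argument: with one factor `t` in A, the coefficients of w³, x³ and y³
        -- have valuations 0, 1 and 2. These differ modulo 3, so the three terms cannot cancel, and
        -- w, x, y turn out divisible by `t` one after the other. The first argument of `solve-∣` is
        -- the power of `t` that divides the form at that stage.
        ∣w₁ : ∀ x y w → Zero M L (t * N) (t * A) x y w → t ∣ˢ w
        ∣w₁ x y w e = fromM {w} (solve-∣ 0 (t ∷ M ∷ L ∷ N ∷ A ∷ x ∷ y ∷ w ∷ []) (λ t M L N A x y w →
            t , M :* (w :* w :* w) , # 3 :* (L :* (:Q₁ t N A x y :* w)) :- # 2 :* :F₁ t N A x y , :R M L (t :* N) (t :* A) x y w) refl (vanishes e))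

        ∣x₁ : ∀ x y w → Zero M L (t * N) (t * A) x y (w * t) → t ∣ˢ x
        ∣x₁ x y w e = from2 {x} (solve-∣ 1 (t ∷ M ∷ L ∷ N ∷ A ∷ x ∷ y ∷ w ∷ []) (λ t M L N A x y w →
            t , # 2 :* (A :* (x :* x :* x))
              , :- (M :* t :* (w :* w :* w) :- # 3 :* (L :* (:Q₁ t N A x y :* w))
                :+ # 2 :* (# 3 :* (N :* N :* (x :* x :* y)) :+ # 3 :* (N :* A :* (x :* (y :* y)))
                :+ (# 2 :* (A :* A) :- t :* N :* N :* N) :* (y :* y :* y)))
              , :R M L (t :* N) (t :* A) x y (w :* t)) refl (vanishes e))

        ∣y₁ : ∀ x y w → Zero M L (t * N) (t * A) (x * t) y (w * t) → t ∣ˢ y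
        ∣y₁ x y w e = from4 {y} (solve-∣ 2 (t ∷ M ∷ L ∷ N ∷ A ∷ x ∷ y ∷ w ∷ []) (λ t M L N A x y w →
            t , # 2 :* (# 2 :* (A :* (A :* (y :* y :* y))))
              , :- (M :* (w :* w :* w) :- # 3 :* (L :* ((N :* t :* (x :* x) :+ # 2 :* (A :* (x :* y)) :+ N :* N :* (y :* y)) :* w))
                :+ # 2 :* (A :* t :* (x :* x :* x) :+ # 3 :* (t :* N :* N :* (x :* x :* y)) :+ # 3 :* (N :* A :* (x :* (y :* y)))
                :- N :* N :* N :* (y :* y :* y)))
              , :R M L (t :* N) (t :* A) (x :* t) y (w :* t)) refl (vanishes e))

        ∣w₂ : ∀ x y w → Zero M L (t * (t * N)) (t * (t * A)) x y w → t ∣ˢ w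
        ∣w₂ x y w e = fromM {w} (solve-∣ 0 (t ∷ M ∷ L ∷ N ∷ A ∷ x ∷ y ∷ w ∷ []) (λ t M L N A x y w →
            t , M :* (w :* w :* w) , t :* (# 3 :* (L :* (:Q₁ (t :* t) N A x y :* w)) :- # 2 :* :F₁ (t :* t) N A x y)
              , :R M L (t :* (t :* N)) (t :* (t :* A)) x y w) refl (vanishes e))

        ∣x₂ : ∀ x y w → Zero M L (t * (t * N)) (t * (t * A)) x y (w * t) → t ∣ˢ x
        ∣x₂ x y w e = from2 {x} (solve-∣ 2 (t ∷ M ∷ L ∷ N ∷ A ∷ x ∷ y ∷ w ∷ []) (λ t M L N A x y w →
            t , # 2 :* (A :* (x :* x :* x))
              , :- (M :* (w :* w :* w) :- # 3 :* (L :* (:Q₁ (t :* t) N A x y :* w))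
                :+ # 2 :* (# 3 :* (t :* N :* N :* (x :* x :* y)) :+ # 3 :* (t :* N :* A :* (x :* (y :* y)))
                :+ (# 2 :* (t :* A :* A) :- t :* t :* t :* N :* N :* N) :* (y :* y :* y)))
              , :R M L (t :* (t :* N)) (t :* (t :* A)) x y (w :* t)) refl (vanishes e))

        ∣w₂′ : ∀ x y w → Zero M L (t * (t * N)) (t * (t * A)) (x * t) y (w * t) → t ∣ˢ w
        ∣w₂′ x y w e = fromM {w} (solve-∣ 3 (t ∷ M ∷ L ∷ N ∷ A ∷ x ∷ y ∷ w ∷ []) (λ t M L N A x y w →
            t , M :* (w :* w :* w)
              , # 3 :* (L :* (:Q₁ t N A x y :+ (t :- # 1) :* (N :* (x :* x))) :* w)
                :- # 2 :* (A :* t :* (x :* x :* x) :+ # 3 :* (t :* t :* N :* N :* (x :* x :* y)) :+ # 3 :* (t :* N :* A :* (x :* (y :* y)))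
                :+ (# 2 :* (A :* A) :- t :* t :* N :* N :* N) :* (y :* y :* y))
              , :R M L (t :* (t :* N)) (t :* (t :* A)) (x :* t) y (w :* t)) refl (vanishes e))

        ∣y₂ : ∀ x y w → Zero M L (t * (t * N)) (t * (t * A)) (x * t) y (w * t * t) → t ∣ˢ y
        ∣y₂ x y w e = from4 {y} (solve-∣ 4 (t ∷ M ∷ L ∷ N ∷ A ∷ x ∷ y ∷ w ∷ []) (λ t M L N A x y w →
            t , # 2 :* (# 2 :* (A :* (A :* (y :* y :* y))))
              , :- (M :* t :* (w :* w :* w) :- # 3 :* (L :* (:Q₁ t (N) A x y :+ (t :- # 1) :* (N :* (x :* x))) :* w)
                :+ # 2 :* (A :* (x :* x :* x) :+ # 3 :* (t :* N :* N :* (x :* x :* y)) :+ # 3 :* (N :* A :* (x :* (y :* y)))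
                :- t :* N :* N :* N :* (y :* y :* y)))
              , :R M L (t :* (t :* N)) (t :* (t :* A)) (x :* t) y (w :* t :* t)) refl (vanishes e))

      step₁ : ∀ x y w → Zero M L (t * N) (t * A) x y w → (t ∣ˢ x) × (t ∣ˢ y) × (t ∣ˢ w)
      step₁ x y w e with ∣w₁ x y w e
      ... | divides w′ refl with ∣x₁ x y w′ e
      ... | divides x′ refl = divides x′ refl , ∣y₁ x′ y w′ e , divides w′ refl

      -- With two factors `t` the valuations are 0, 2 and 4 at w³, x³ and y³: again distinct modulo
      -- 3, but w has to yield a second factor before y is reached.
      step₂ : ∀ x y w → Zero M L (t * (t * N)) (t * (t * A)) x y w → (t ∣ˢ x) × (t ∣ˢ y) × (t ∣ˢ w)
      step₂ x y w e with ∣w₂ x y w e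
      ... | divides w′ refl with ∣x₂ x y w′ e
      ... | divides x′ refl with ∣w₂′ x′ y w′ e
      ... | divides w″ refl = divides x′ refl , ∣y₂ x′ y w″ e , divides (w″ * t) refl

    anisotropic₁ : ∀ {x y w} → Zero M L (t * N) (t * A) x y w → x ≡ 0ℤ × y ≡ 0ℤ × w ≡ 0ℤ
    anisotropic₁ = infinite-descent pq (λ x y w → Zero M L (t * N) (t * A) x y w)
      (λ {x} {y} {w} → step₁ x y w) (homogeneous (t * N) (t * A))

    anisotropic₂ : ∀ {x y w} → Zero M L (t * (t * N)) (t * (t * A)) x y w → x ≡ 0ℤ × y ≡ 0ℤ × w ≡ 0ℤ
    anisotropic₂ = infinite-descent pq (λ x y w → Zero M L (t * (t * N)) (t * (t * A)) x y w)
      (λ {x} {y} {w} → step₂ x y w) (homogeneous (t * (t * N)) (t * (t * A)))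

-- Fermat descent for the concordant forms u² + s² and u² + 4 s²

module ConcordantForms where

  open PolynomialIdentities
  open import Data.Nat.Base hiding (parity)
  open import Data.Nat.Properties
  open import Data.Nat.Divisibility
  open import Data.Nat.Coprimality as Coprimality using (Coprime; coprime-divisor)
  open import Data.Nat.GCD
  open import Data.Nat.Primality using (Prime; prime?; euclidsLemma)
  open import Data.Nat.Induction using (<-rec)
  open import Data.Product.Base using (∃; ∃₂; _×_; _,_)
  open import Data.Sum.Base using (_⊎_; inj₁; inj₂; [_,_]′)
  open import Data.Empty using (⊥; ⊥-elim)
  open import Data.Vec.Base using ([]; _∷_)
  open import Relation.Nullary
  open import Relation.Nullary.Decidable using (from-yes; from-no)
  open import Function.Base using (_∘_; id; case_of_)
  open import Relation.Binary.PropositionalEquality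

  ∣m+n∣n⇒∣m : ∀ {i m n} → i ∣ m + n → i ∣ n → i ∣ m
  ∣m+n∣n⇒∣m {i} {m} {n} h = ∣m+n∣m⇒∣n (subst (i ∣_) (+-comm m n) h)

  record GCDSplit (m n : ℕ) : Set where
    constructor gcdSplit
    field
      g a b    : ℕ
      {{g≢0}}  : NonZero g
      m≡       : m ≡ g * a
      n≡       : n ≡ g * b
      coprime  : Coprime a b

  gcd-split : ∀ m n → NonZero n → GCDSplit m n
  gcd-split m n n≢0 with gcd[m,n]∣m m n | gcd[m,n]∣n m n
  ... | divides a m≡ | divides b n≡ = record
    { m≡ = m≡′ ; n≡ = n≡′ ; g≢0 = g≢0
    ; coprime = λ {d} (d∣a , d∣b) → ∣1⇒≡1 (*-cancelˡ-∣ (gcd m n) {{g≢0}} (subst (gcd m n * d ∣_) (sym (*-identityʳ (gcd m n)))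
        (gcd-greatest (subst (gcd m n * d ∣_) (sym m≡′) (*-monoʳ-∣ (gcd m n) d∣a))
                      (subst (gcd m n * d ∣_) (sym n≡′) (*-monoʳ-∣ (gcd m n) d∣b))))) }
    where
    m≡′ = trans m≡ (*-comm a (gcd m n))
    n≡′ = trans n≡ (*-comm b (gcd m n))
    g≢0 : NonZero (gcd m n)
    g≢0 = ≢-nonZero (λ g≡0 → ≢-nonZero⁻¹ n {{n≢0}} (trans n≡′ (cong (_* b) g≡0)))

  coprime-*ˡ : ∀ {l m n} → Coprime l n → Coprime m n → Coprime (l * m) n
  coprime-*ˡ {l} {m} {n} c c′ {d} (d∣lm , d∣n) = c′ (coprime-divisor d⊥l d∣lm , d∣n)
    where
    d⊥l : Coprime d l
    d⊥l (e∣d , e∣l) = c (e∣l , ∣-trans e∣d d∣n)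

  coprime-∣ : ∀ {k l m n} → k ∣ m → l ∣ n → Coprime m n → Coprime k l
  coprime-∣ k∣m l∣n c (d∣k , d∣l) = c (∣-trans d∣k k∣m , ∣-trans d∣l l∣n)

  coprime-² : ∀ {m n} → Coprime m n → Coprime (m * m) (n * n)
  coprime-² c = Coprimality.sym (coprime-*ˡ c″ c″)
    where c″ = Coprimality.sym (coprime-*ˡ c c)

  -- With d = gcd x t, the coprimality of x and y makes x = d².
  coprime-*≡²⇒squares : ∀ {x y} t → NonZero t → Coprime x y → x * y ≡ t * t → ∃₂ λ c d → x ≡ c * c × y ≡ d * d × t ≡ c * d
  coprime-*≡²⇒squares {x} {y} t t≢0 x⊥y xy≡t² with gcd-split x t t≢0
  ... | gcdSplit d x′ t′ refl refl x′⊥t′ = d , t′ , cong (d *_) x′≡d , y≡ , refl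
    where
    x′y≡dt′² : x′ * y ≡ d * (t′ * t′)
    x′y≡dt′² = *-cancelˡ-≡ _ _ d (trans (sym (*-assoc d x′ y)) (trans xy≡t² (solveⁿ (d ∷ t′ ∷ []) (λ d t → d :* t :* (d :* t) := d :* (d :* (t :* t))) refl refl)))
    x′∣d : x′ ∣ d
    x′∣d = coprime-divisor x′⊥t′ (coprime-divisor x′⊥t′ (divides y (trans (solveⁿ (d ∷ t′ ∷ []) (λ d t → t :* (t :* d) := d :* (t :* t)) refl refl) (trans (sym x′y≡dt′²) (*-comm x′ y)))))
    d∣x′ : d ∣ x′
    d∣x′ = coprime-divisor (coprime-∣ (m∣m*n x′) ∣-refl x⊥y) (divides (t′ * t′) (trans (*-comm y x′) (trans x′y≡dt′² (*-comm d _))))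
    x′≡d = ∣-antisym x′∣d d∣x′
    y≡ : y ≡ t′ * t′
    y≡ = *-cancelˡ-≡ _ _ d (trans (cong (_* y) (sym x′≡d)) x′y≡dt′²)

  -- After division by the gcd, `g′` divides `v′` and is coprime to it, hence is 1.
  ²-cancel-∣ : ∀ {g} v → NonZero v → g * g ∣ v * v → g ∣ v
  ²-cancel-∣ {g} v v≢0 g²∣v² with gcd-split g v v≢0
  ... | gcdSplit d g′ v′ refl refl g′⊥v′ = *-monoʳ-∣ d (subst (_∣ v′) (sym g′≡1) (1∣ v′))
    where
    h : g′ * g′ ∣ v′ * v′
    h = *-cancelˡ-∣ d (*-cancelˡ-∣ d (subst₂ _∣_ (eq g′) (eq v′) g²∣v²))
      where eq : ∀ x → d * x * (d * x) ≡ d * (d * (x * x))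
            eq x = solveⁿ (d ∷ x ∷ []) (λ d t → d :* t :* (d :* t) := d :* (d :* (t :* t))) refl refl
    g′∣v′ : g′ ∣ v′
    g′∣v′ = coprime-divisor g′⊥v′ (∣-trans (m∣m*n g′) h)
    g′≡1 : g′ ≡ 1
    g′≡1 = g′⊥v′ (∣-refl , g′∣v′)

  prime[2] : Prime 2
  prime[2] = from-yes (prime? 2)

  prime[3] : Prime 3
  prime[3] = from-yes (prime? 3)

  data Parity : ℕ → Set where
    even : ∀ k → Parity (2 * k)
    odd  : ∀ k → Parity (1 + 2 * k)

  parity : ∀ n → Parity n
  parity zero    = even 0
  parity (suc n) with parity n
  ... | even k = odd k
  ... | odd k  = subst Parity (solveⁿ (k ∷ []) (λ k → # 2 :* (# 1 :+ k) := # 1 :+ (# 1 :+ # 2 :* k)) refl refl) (even (1 + k))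

  2∤odd : ∀ k → ¬ 2 ∣ 1 + 2 * k
  2∤odd k h = case ∣1⇒≡1 (∣m+n∣n⇒∣m h (m∣m*n k)) of λ ()

  even-cases : ∀ {n} → 2 ∣ n → Parity n → ∃ λ k → n ≡ 2 * k
  even-cases h (even k) = k , refl
  even-cases h (odd k)  = ⊥-elim (2∤odd k h)

  odd-cases : ∀ {n} → ¬ 2 ∣ n → Parity n → ∃ λ k → n ≡ 1 + 2 * k
  odd-cases h (even k) = ⊥-elim (h (m∣m*n k))
  odd-cases h (odd k)  = k , refl

  data Mod3 : ℕ → Set where
    3k : ∀ k → Mod3 (3 * k)
    3k+1 : ∀ k → Mod3 (1 + 3 * k)
    3k+2 : ∀ k → Mod3 (2 + 3 * k)

  mod3 : ∀ n → Mod3 n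
  mod3 zero    = 3k 0
  mod3 (suc n) with mod3 n
  ... | 3k k = 3k+1 k
  ... | 3k+1 k = 3k+2 k
  ... | 3k+2 k = subst Mod3 (solveⁿ (k ∷ []) (λ k → # 3 :* (# 1 :+ k) := # 1 :+ (# 2 :+ # 3 :* k)) refl refl) (3k (1 + k))

  square-mod3 : ∀ n → 3 ∣ n ⊎ ∃ λ k → n * n ≡ 1 + 3 * k
  square-mod3 n with mod3 n
  ... | 3k k = inj₁ (m∣m*n k)
  ... | 3k+1 k = inj₂ (2 * k + 3 * (k * k) , solveⁿ (k ∷ []) (λ k → (# 1 :+ # 3 :* k) :* (# 1 :+ # 3 :* k) := # 1 :+ # 3 :* (# 2 :* k :+ # 3 :* (k :* k))) refl refl)
  ... | 3k+2 k = inj₂ (1 + 4 * k + 3 * (k * k) , solveⁿ (k ∷ []) (λ k → (# 2 :+ # 3 :* k) :* (# 2 :+ # 3 :* k) := # 1 :+ # 3 :* (# 1 :+ # 4 :* k :+ # 3 :* (k :* k))) refl refl)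

  private
    3∤1 : ∀ {k} → ¬ 3 ∣ 1 + 3 * k
    3∤1 {k} h = case ∣1⇒≡1 (∣m+n∣n⇒∣m h (m∣m*n k)) of λ ()

    3∤2 : ∀ {k} → ¬ 3 ∣ 2 + 3 * k
    3∤2 {k} h = from-no (3 ∣? 2) (∣m+n∣n⇒∣m h (m∣m*n k))

  -- Squares are 0 or 1 modulo 3, so 3 would have to divide both numbers.
  3∤sum² : ∀ {p q} → Coprime p q → ¬ 3 ∣ p * p + q * q
  3∤sum² {p} {q} p⊥q h with square-mod3 p | square-mod3 q
  ... | inj₁ a       | inj₁ b       = case p⊥q (a , b) of λ ()
  ... | inj₁ a       | inj₂ (k , b) = 3∤1 {k} (subst (3 ∣_) b (∣m+n∣m⇒∣n h (∣m⇒∣m*n p a)))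
  ... | inj₂ (k , a) | inj₁ b       = 3∤1 {k} (subst (3 ∣_) a (∣m+n∣n⇒∣m h (∣m⇒∣m*n q b)))
  ... | inj₂ (k , a) | inj₂ (l , b) = 3∤2 {k + l} (subst (3 ∣_) (trans (cong₂ _+_ a b)
    (solveⁿ (k ∷ l ∷ []) (λ k l → # 1 :+ # 3 :* k :+ (# 1 :+ # 3 :* l) := # 2 :+ # 3 :* (k :+ l)) refl refl)) h)

  coprime-odd-2 : ∀ {q} → ¬ 2 ∣ q → Coprime q 2
  coprime-odd-2 h {0} (d∣q , d∣2) = case 0∣⇒≡0 d∣2 of λ ()
  coprime-odd-2 h {1} (d∣q , d∣2) = refl
  coprime-odd-2 h {2} (d∣q , d∣2) = ⊥-elim (h d∣q)
  coprime-odd-2 h {suc (suc (suc d))} (d∣q , d∣2) = case ∣⇒≤ d∣2 of λ { (s≤s (s≤s ())) }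

  ∣3⇒1∨3 : ∀ {m} → m ∣ 3 → m ≡ 1 ⊎ m ≡ 3
  ∣3⇒1∨3 {0} h = case 0∣⇒≡0 h of λ ()
  ∣3⇒1∨3 {1} h = inj₁ refl
  ∣3⇒1∨3 {2} h = ⊥-elim (from-no (2 ∣? 3) h)
  ∣3⇒1∨3 {3} h = inj₂ refl
  ∣3⇒1∨3 {suc (suc (suc (suc m)))} h = case ∣⇒≤ h of λ { (s≤s (s≤s (s≤s ()))) }

  record Concordant (u s : ℕ) : Set where
    constructor concordant
    field
      v w     : ℕ
      u²+s²   : u * u + s * s ≡ v * v
      u²+4s²  : u * u + 4 * (s * s) ≡ w * w

  -- The two parametrisations u = ±(p₁² - p₂²) = ±(q₁² - q₂²), s = 2 p₁ p₂ = q₁ q₂ of the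
  -- Pythagorean triples (u , s , v) and (u , 2 s , w) yield a smaller solution (q , p).
  module _ {p₁ p₂ q₁ q₂ : ℕ} (p₁⊥p₂ : Coprime p₁ p₂) (2∤q₁ : ¬ 2 ∣ q₁) (p₂≢0 : NonZero p₂)
           (squares : p₁ * p₁ + q₂ * q₂ ≡ q₁ * q₁ + p₂ * p₂) (products : 2 * (p₁ * p₂) ≡ q₁ * q₂) where

    concordant-descent : ∃₂ λ q p → Coprime q p × ¬ 2 ∣ q × NonZero p × p ∣ p₂ × Concordant q p
    concordant-descent with gcd-split q₁ p₂ p₂≢0
    ... | gcdSplit g q p refl refl q⊥p = q , p , q⊥p , 2∤q , p≢0 , n∣m*n g , concordant h g q²+p² q²+4p²
      where
      2∤q : ¬ 2 ∣ q
      2∤q = 2∤q₁ ∘ ∣n⇒∣m*n g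
      p≢0 : NonZero p
      p≢0 = m*n≢0⇒n≢0 g {{p₂≢0}}
      instance
        q≢0 : NonZero q
        q≢0 = ≢-nonZero (λ { refl → 2∤q (2 ∣0) })
      products′ : p * (2 * p₁) ≡ q * q₂
      products′ = *-cancelˡ-≡ _ _ g (solveⁿ₁ (g ∷ p ∷ q ∷ p₁ ∷ q₂ ∷ []) (λ g p q p₁ q₂ → (g :* (p :* (# 2 :* p₁)) := g :* (q :* q₂)) ,
        # 1 , (# 2 :* (p₁ :* (g :* p)) := g :* q :* q₂)) refl refl products)
      q∣p₁ : q ∣ p₁
      q∣p₁ = coprime-divisor (coprime-odd-2 2∤q) (coprime-divisor q⊥p (divides q₂ (trans products′ (*-comm q q₂))))
      h : ℕ
      h = quotient q∣p₁
      p₁≡ : p₁ ≡ h * q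
      p₁≡ = _∣_.equality q∣p₁
      q₂≡ : q₂ ≡ 2 * (h * p)
      q₂≡ = *-cancelˡ-≡ _ _ q (trans (sym products′) (trans (cong (λ x → p * (2 * x)) p₁≡)
        (solveⁿ (p ∷ q ∷ h ∷ []) (λ p q h → p :* (# 2 :* (h :* q)) := q :* (# 2 :* (h :* p))) refl refl)))
      -- The equation of squares after the substitutions `q₁ = g q`, `p₂ = g p`, `p₁ = h q`,
      -- `q₂ = 2 h p`. Since `p₁` and `p₂` are coprime, so are `g` and `h`, and the two forms in q
      -- and p are `m g²` and `m h²`.
      eq : h * h * (q * q + 4 * (p * p)) ≡ g * g * (q * q + p * p)
      eq = solveⁿ₁ (g ∷ p ∷ q ∷ h ∷ []) (λ g p q h → (h :* h :* (q :* q :+ # 4 :* (p :* p)) := g :* g :* (q :* q :+ p :* p)) ,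
        # 1 , (h :* q :* (h :* q) :+ # 2 :* (h :* p) :* (# 2 :* (h :* p)) := g :* q :* (g :* q) :+ g :* p :* (g :* p))) refl refl
        (subst₂ (λ x y → x * x + y * y ≡ g * q * (g * q) + g * p * (g * p)) p₁≡ q₂≡ squares)
      h∣p₁ : h ∣ p₁
      h∣p₁ = divides q (trans p₁≡ (*-comm h q))
      g²∣ : g * g ∣ q * q + 4 * (p * p)
      g²∣ = coprime-divisor (Coprimality.sym (coprime-² {h} {g} (coprime-∣ h∣p₁ (m∣m*n p) p₁⊥p₂)))
        (divides (q * q + p * p) (trans eq (*-comm (g * g) _)))
      m : ℕ
      m = quotient g²∣
      q²+4p²≡ : q * q + 4 * (p * p) ≡ m * (g * g)
      q²+4p²≡ = _∣_.equality g²∣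
      q²+p²≡ : q * q + p * p ≡ m * (h * h)
      q²+p²≡ = *-cancelˡ-≡ _ _ (g * g) {{m*n≢0 g g}} (trans (sym eq) (trans (cong (h * h *_) q²+4p²≡)
        (solveⁿ (g ∷ h ∷ m ∷ []) (λ g h m → h :* h :* (m :* (g :* g)) := g :* g :* (m :* (h :* h))) refl refl)))
      -- `m` divides 3 q² and 3 p², which are combinations of the two forms; q and p are coprime.
      m∣3 : m ∣ 3
      m∣3 = Coprimality.coprime-factors (coprime-² q⊥p)
        ( ∣m+n∣m⇒∣n (divides (4 * (h * h)) (solveⁿ₁ (p ∷ q ∷ h ∷ m ∷ []) (λ p q h m → (q :* q :+ # 4 :* (p :* p) :+ q :* q :* # 3 := # 4 :* (h :* h) :* m) ,
            # 4 , (q :* q :+ p :* p := m :* (h :* h))) refl refl q²+p²≡)) (divides (g * g) (trans q²+4p²≡ (*-comm m _)))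
        , ∣m+n∣m⇒∣n (divides (g * g) (solveⁿ₁ (p ∷ q ∷ g ∷ m ∷ []) (λ p q g m → (q :* q :+ p :* p :+ p :* p :* # 3 := g :* g :* m) ,
            # 1 , (q :* q :+ # 4 :* (p :* p) := m :* (g :* g))) refl refl q²+4p²≡)) (divides (h * h) (trans q²+p²≡ (*-comm m _))) )
      m≡1 : m ≡ 1
      m≡1 = [ id , (λ m≡3 → ⊥-elim (3∤sum² q⊥p (subst (λ x → 3 ∣ x) (sym q²+p²≡) (subst (λ x → 3 ∣ x * (h * h)) (sym m≡3) (m∣m*n (h * h)))))) ]′ (∣3⇒1∨3 m∣3)
      q²+p² : q * q + p * p ≡ h * h
      q²+p² = trans q²+p²≡ (trans (cong (_* (h * h)) m≡1) (*-identityˡ _))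
      q²+4p² : q * q + 4 * (p * p) ≡ g * g
      q²+4p² = trans q²+4p²≡ (trans (cong (_* (g * g)) m≡1) (*-identityˡ _))

  private
    -- A square difference decides the parities of its two terms by its residue mod 4.
    mixed-parity : ∀ {u a b c d} → u + (2 * b) * (2 * b) ≡ (1 + 2 * a) * (1 + 2 * a) →
                   u + (1 + 2 * d) * (1 + 2 * d) ≡ 2 * c * (2 * c) → ⊥
    mixed-parity {u} {a} {b} {c} {d} e e′ = 2∤odd (a + a * a + (d + d * d)) (divides (b * b + c * c)
      (*-cancelˡ-≡ _ _ 2 (solveⁿ₂ (u ∷ a ∷ b ∷ c ∷ d ∷ []) (λ u a b c d →
        (# 2 :* (# 1 :+ # 2 :* (a :+ a :* a :+ (d :+ d :* d))) := # 2 :* ((b :* b :+ c :* c) :* # 2)) ,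
        (# 1 , ((# 1 :+ # 2 :* a) :* (# 1 :+ # 2 :* a) := u :+ # 2 :* b :* (# 2 :* b))) ,
        # 1 , (u :+ (# 1 :+ # 2 :* d) :* (# 1 :+ # 2 :* d) := # 2 :* c :* (# 2 :* c))) refl refl (sym e) e′)))

    OppositeParities : ℕ → ℕ → Set
    OppositeParities a b = (∃₂ λ i j → a ≡ 1 + 2 * i × b ≡ 2 * j) ⊎ (∃₂ λ i j → a ≡ 2 * i × b ≡ 1 + 2 * j)

    sum-even-odd : ∀ {u a b} → ¬ 2 ∣ u → u + b * b ≡ a * a → OppositeParities a b
    sum-even-odd {u} {a} {b} 2∤u e with parity a | parity b
    ... | odd i  | even j = inj₁ (i , j , refl , refl)
    ... | even i | odd j  = inj₂ (i , j , refl , refl)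
    ... | even i | even j = ⊥-elim (2∤u (∣m+n∣n⇒∣m (subst (2 ∣_) (sym e) (∣m⇒∣m*n _ (m∣m*n i))) (∣m⇒∣m*n _ (m∣m*n j))))
    ... | odd i  | odd j  = ⊥-elim (2∤u (∣m+n∣n⇒∣m {2} {u} {2 * (2 * (j + j * j))} (divides (2 * (i + i * i)) (solveⁿ₁ (u ∷ i ∷ j ∷ []) (λ u i j →
        (u :+ # 2 :* (# 2 :* (j :+ j :* j)) := # 2 :* (i :+ i :* i) :* # 2) ,
        # 1 , (u :+ (# 1 :+ # 2 :* j) :* (# 1 :+ # 2 :* j) := (# 1 :+ # 2 :* i) :* (# 1 :+ # 2 :* i))) refl refl e)) (m∣m*n {2} (2 * (j + j * j)))))

    square-root-≤ : ∀ {u v} → u * u ≤ v * v → u ≤ v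
    square-root-≤ {u} {v} h = ≮⇒≥ (λ v<u → <⇒≱ (*-mono-< v<u v<u) h)

    2∣² : ∀ {n} → 2 ∣ n * n → 2 ∣ n
    2∣² {n} h = [ id , id ]′ (euclidsLemma n n prime[2] h)

    difference-of-squares : ∀ {u v s} → u * u + s * s ≡ v * v → ∃ λ d → s * s ≡ d * (2 * u + d)
    difference-of-squares {u} {v} {s} e with m≤n⇒∃[o]m+o≡n (square-root-≤ {u} {v} (subst (u * u ≤_) e (m≤m+n (u * u) (s * s))))
    ... | d , refl = d , solveⁿ₁ (u ∷ s ∷ d ∷ []) (λ u s d → (s :* s := d :* (# 2 :* u :+ d)) ,
        # 1 , (u :* u :+ s :* s := (u :+ d) :* (u :+ d))) refl refl e

    -- A common divisor divides `u`, and its square divides `t²`.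
    coprime-factors-of-square : ∀ {u y t} → NonZero t → Coprime u t → y * (u + y) ≡ t * t → Coprime y (u + y)
    coprime-factors-of-square {u} {y} {t} t≢0 u⊥t e {d} (d∣y , d∣u+y) = u⊥t
      ( ∣m+n∣n⇒∣m d∣u+y d∣y
      , ²-cancel-∣ t t≢0 (subst (d * d ∣_) e (*-pres-∣ {d} {y} {d} {u + y} d∣y d∣u+y)) )

  -- Strong induction on `s = 2 t`. With v = u + 2 y and w = u + 2 z one has y (u + y) = t² and z (u
  -- + z) = s². The factors are coprime, hence squares: y = b², u + y = a², z = d², u + z = c², with
  -- t = b a and s = d c. This is the input of `concordant-descent`, whose new `p` divides a or b
  -- and so is smaller than `s`.
  concordant-coprime : ∀ s {u} → Coprime u s → ¬ 2 ∣ u → NonZero s → ¬ Concordant u s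
  concordant-coprime = <-rec _ λ s rec {u} u⊥s 2∤u s≢0 (concordant v w e e′) → go s rec u⊥s 2∤u s≢0
      (difference-of-squares {u} {v} {s} e)
      (difference-of-squares {u} {w} {2 * s} (trans (cong (u * u +_) (solveⁿ (s ∷ []) (λ s → # 2 :* s :* (# 2 :* s) := # 4 :* (s :* s)) refl refl)) e′))
    where
    module _ (s : ℕ) (rec : ∀ {p} → p < s → ∀ {u} → Coprime u p → ¬ 2 ∣ u → NonZero p → ¬ Concordant u p)
             {u : ℕ} (u⊥s : Coprime u s) (2∤u : ¬ 2 ∣ u) (s≢0 : NonZero s) where

      finish : ∀ {p₁ p₂ q₁ q₂} → Coprime p₁ p₂ → ¬ 2 ∣ q₁ → NonZero p₂ → p₂ < s →
               p₁ * p₁ + q₂ * q₂ ≡ q₁ * q₁ + p₂ * p₂ → 2 * (p₁ * p₂) ≡ q₁ * q₂ → ⊥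
      finish c o p₂≢0 p₂<s e e′ with concordant-descent c o p₂≢0 e e′
      ... | q , p , q⊥p , 2∤q , p≢0 , p∣p₂ , conc = rec (≤-<-trans (∣⇒≤ {{p₂≢0}} p∣p₂) p₂<s) q⊥p 2∤q p≢0 conc

      squares : ∀ y z t → s ≡ 2 * t → NonZero t → y * (u + y) ≡ t * t → z * (u + z) ≡ 2 * t * (2 * t) → ⊥
      squares y z t refl t≢0 e e′
        with coprime-*≡²⇒squares {y} {u + y} t t≢0 (coprime-factors-of-square t≢0 (coprime-∣ ∣-refl (n∣m*n 2) u⊥s) e) e
           | coprime-*≡²⇒squares {z} {u + z} (2 * t) s≢0 (coprime-factors-of-square s≢0 u⊥s e′) e′
      ... | b , a , refl , u+b²≡a² , t≡ | d , c , refl , u+d²≡c² , 2t≡ = cases (sum-even-odd {u} {a} {b} 2∤u u+b²≡a²) (sum-even-odd {u} {c} {d} 2∤u u+d²≡c²)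
        where
        a⊥b : Coprime a b
        a⊥b = Coprimality.sym (coprime-∣ (m∣m*n b) (subst (a ∣_) (sym u+b²≡a²) (m∣m*n a)) (coprime-factors-of-square t≢0 (coprime-∣ ∣-refl (n∣m*n 2) u⊥s) e))
        a≢0 : NonZero a
        a≢0 = m*n≢0⇒n≢0 b {{subst NonZero t≡ t≢0}}
        b≢0 : NonZero b
        b≢0 = m*n≢0⇒m≢0 b {{subst NonZero t≡ t≢0}}
        t<2t : t < 2 * t
        t<2t = m<m+n t (subst (0 <_) (sym (+-identityʳ t)) (>-nonZero⁻¹ t {{t≢0}}))
        b<s : b < 2 * t
        b<s = ≤-<-trans (subst (b ≤_) (sym t≡) (m≤m*n b a {{a≢0}})) t<2t
        a<s : a < 2 * t
        a<s = ≤-<-trans (subst (a ≤_) (sym t≡) (m≤n*m a b {{b≢0}})) t<2t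
        eq : a * a + d * d ≡ c * c + b * b
        eq = trans (cong (_+ d * d) (sym u+b²≡a²)) (trans (solveⁿ (u ∷ b ∷ d ∷ []) (λ u b d → u :+ b :* b :+ d :* d := u :+ d :* d :+ b :* b) refl refl) (cong (_+ b * b) u+d²≡c²))
        products : 2 * (b * a) ≡ d * c
        products = trans (cong (2 *_) (sym t≡)) 2t≡
        -- In the two admissible cases `p₁` is the odd one of a and b, and `q₁` the odd one of c and
        -- d.
        cases : OppositeParities a b → OppositeParities c d → ⊥
        cases (inj₁ (i , j , refl , refl)) (inj₁ (k , l , refl , refl)) =
          finish a⊥b (2∤odd k) b≢0 b<s eq (trans (cong (2 *_) (*-comm a b)) (trans products (*-comm d c)))
        cases (inj₂ (i , j , refl , refl)) (inj₂ (k , l , refl , refl)) =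
          finish (Coprimality.sym a⊥b) (2∤odd l) a≢0 a<s
            (trans (+-comm (b * b) (c * c)) (trans (sym eq) (+-comm (a * a) (d * d)))) products
        cases (inj₁ (i , j , refl , refl)) (inj₂ (k , l , refl , refl)) = mixed-parity {u} {i} {j} {k} {l} u+b²≡a² u+d²≡c²
        cases (inj₂ (i , j , refl , refl)) (inj₁ (k , l , refl , refl)) = mixed-parity {u} {k} {l} {i} {j} u+d²≡c² u+b²≡a²

      2∣z[u+z] : ∀ z → 2 ∣ z * (u + z)
      2∣z[u+z] z with parity z | odd-cases 2∤u (parity u)
      ... | even k | _        = ∣m⇒∣m*n _ (m∣m*n k)
      ... | odd k  | i , refl = ∣n⇒∣m*n (1 + 2 * k) (divides (1 + i + k) (solveⁿ (i ∷ k ∷ []) (λ i k →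
        # 1 :+ # 2 :* i :+ (# 1 :+ # 2 :* k) := (# 1 :+ i :+ k) :* # 2) refl refl))

      go : (∃ λ d → s * s ≡ d * (2 * u + d)) → (∃ λ e → 2 * s * (2 * s) ≡ e * (2 * u + e)) → ⊥
      go (d , s²≡) (e , 4s²≡) = halves (even-cases 2∣e (parity e)) (even-cases 2∣d (parity d)) (even-cases 2∣s (parity s))
        where
        2∣e : 2 ∣ e
        2∣e = 2∣² (∣m+n∣m⇒∣n {2} {2 * (u * e)} (divides (2 * (s * s)) (solveⁿ₁ (u ∷ s ∷ e ∷ []) (λ u s e →
          (# 2 :* (u :* e) :+ e :* e := # 2 :* (s :* s) :* # 2) , # 1 , (e :* (# 2 :* u :+ e) := # 2 :* s :* (# 2 :* s))) refl refl (sym 4s²≡))) (m∣m*n (u * e)))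
        z[u+z] : ∀ {z} → e ≡ 2 * z → z * (u + z) ≡ s * s
        z[u+z] {z} refl = *-cancelˡ-≡ _ _ 4 (solveⁿ₁ (u ∷ s ∷ z ∷ []) (λ u s z → (# 4 :* (z :* (u :+ z)) := # 4 :* (s :* s)) ,
          # 1 , (# 2 :* z :* (# 2 :* u :+ # 2 :* z) := # 2 :* s :* (# 2 :* s))) refl refl (sym 4s²≡))
        2∣s : 2 ∣ s
        2∣s with even-cases 2∣e (parity e)
        ... | z , e≡ = 2∣² (subst (2 ∣_) (z[u+z] {z} e≡) (2∣z[u+z] z))
        2∣d : 2 ∣ d
        2∣d = 2∣² (∣m+n∣m⇒∣n {2} {2 * (u * d)} (subst (2 ∣_) (solveⁿ₁ (u ∷ s ∷ d ∷ []) (λ u s d →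
          (s :* s := # 2 :* (u :* d) :+ d :* d) , # 1 , (s :* s := d :* (# 2 :* u :+ d))) refl refl s²≡) (∣m⇒∣m*n s 2∣s)) (m∣m*n (u * d)))
        halves : (∃ λ z → e ≡ 2 * z) → (∃ λ y → d ≡ 2 * y) → (∃ λ t → s ≡ 2 * t) → ⊥
        halves (z , e≡) (y , d≡) (t , s≡) = squares y z t s≡ (m*n≢0⇒n≢0 2 {{subst NonZero s≡ s≢0}})
          (*-cancelˡ-≡ _ _ 4 (solveⁿ₁ (u ∷ y ∷ t ∷ []) (λ u y t → (# 4 :* (y :* (u :+ y)) := # 4 :* (t :* t)) ,
            # 1 , (# 2 :* y :* (# 2 :* u :+ # 2 :* y) := # 2 :* t :* (# 2 :* t))) refl refl
            (sym (subst₂ (λ s d → s * s ≡ d * (2 * u + d)) s≡ d≡ s²≡))))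
          (subst (λ s → z * (u + z) ≡ s * s) s≡ (z[u+z] {z} e≡))

  no-concordant : ∀ {u s} → ¬ 2 ∣ u → NonZero s → ¬ Concordant u s
  no-concordant {u} {s} 2∤u s≢0 (concordant v w e e′) with gcd-split u s s≢0
  ... | gcdSplit g u′ s′ refl refl u′⊥s′ = concordant-coprime s′ u′⊥s′ (2∤u ∘ ∣n⇒∣m*n g) (m*n≢0⇒n≢0 g {{s≢0}})
    (concordant v′ w′ (reduce {z′ = v′} e v≡ (solveⁿ (g ∷ u′ ∷ s′ ∷ []) (λ g u s → g :* u :* (g :* u) :+ g :* s :* (g :* s) := g :* g :* (u :* u :+ s :* s)) refl refl))
       (reduce {z′ = w′} e′ w≡ (solveⁿ (g ∷ u′ ∷ s′ ∷ []) (λ g u s → g :* u :* (g :* u) :+ # 4 :* (g :* s :* (g :* s)) := g :* g :* (u :* u :+ # 4 :* (s :* s))) refl refl)))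
    where
    u≢0 : NonZero (g * u′)
    u≢0 = ≢-nonZero (λ u≡0 → 2∤u (subst (2 ∣_) (sym u≡0) (2 ∣0)))
    g∣ : ∀ {x y z} → NonZero z → x + y ≡ z * z → g * g ∣ x → g * g ∣ y → g ∣ z
    g∣ {z = z} z≢0 e h h′ = ²-cancel-∣ z z≢0 (subst (g * g ∣_) e (∣m∣n⇒∣m+n h h′))
    root≢0 : ∀ {y z} → g * u′ * (g * u′) + y ≡ z * z → NonZero z
    root≢0 {y} {z} e = ≢-nonZero (λ { refl → ≢-nonZero⁻¹ (g * u′) {{u≢0}} ([ id , id ]′ (m*n≡0⇒m≡0∨n≡0 (g * u′) (m+n≡0⇒m≡0 _ e))) })
    g²∣ : ∀ x → g * g ∣ g * x * (g * x)
    g²∣ x = *-pres-∣ {g} {g * x} {g} {g * x} (m∣m*n x) (m∣m*n x)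
    g∣v : g ∣ v
    g∣v = g∣ (root≢0 e) e (g²∣ u′) (g²∣ s′)
    g∣w : g ∣ w
    g∣w = g∣ (root≢0 e′) e′ (g²∣ u′) (∣n⇒∣m*n 4 (g²∣ s′))
    v′ = quotient g∣v
    w′ = quotient g∣w
    v≡ : v ≡ v′ * g
    v≡ = _∣_.equality g∣v
    w≡ : w ≡ w′ * g
    w≡ = _∣_.equality g∣w
    reduce : ∀ {x y z z′} → x ≡ z * z → z ≡ z′ * g → x ≡ g * g * y → y ≡ z′ * z′
    reduce {y = y} {z′ = z′} refl refl eq = *-cancelˡ-≡ y _ (g * g) {{m*n≢0 g g}} (trans (sym eq)
      (solveⁿ (g ∷ z′ ∷ []) (λ g z → z :* g :* (z :* g) := g :* g :* (z :* z)) refl refl))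

-- Cubes among the norms P² + 3 k²: Gauss reduction and Euler's lemma

module NormCubes where

  open PolynomialIdentities
  open PrimeDivisibility
  open import Data.Nat.Base as ℕ using (ℕ; zero; suc)
  import Data.Nat.Properties as ℕ
  import Data.Nat.Divisibility as ℕ
  open import Data.Integer.Base hiding (suc)
  open import Data.Integer.Properties
  open import Data.Product.Base using (∃; ∃₂; _×_; _,_; proj₁; proj₂)
  open import Data.Sum.Base using (_⊎_; inj₁; inj₂; [_,_]′)
  open import Data.Empty using (⊥-elim)
  open import Data.Vec.Base using ([]; _∷_)
  open import Relation.Nullary
  open import Function.Base using (case_of_)
  open import Relation.Binary.PropositionalEquality

  -- The binary quadratic form with diagonal entries W, W′ and off-diagonal entry r takes the value
  -- 1; its determinant W W′ - r² will be 3.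
  record RepresentsOne (W r W′ : ℤ) : Set where
    constructor representsOne
    field
      c h   : ℤ
      value : W * (c * c) + + 2 * (r * (c * h)) + W′ * (h * h) ≡ 1ℤ

  represents-swap : ∀ {W r W′} → RepresentsOne W′ r W → RepresentsOne W r W′
  represents-swap {W} {r} {W′} (representsOne c h e) = representsOne h c (trans
    (solve (W ∷ r ∷ W′ ∷ c ∷ h ∷ []) (λ W r W′ c h → W :* (h :* h) :+ # 2 :* (r :* (h :* c)) :+ W′ :* (c :* c)
      := W′ :* (c :* c) :+ # 2 :* (r :* (c :* h)) :+ W :* (h :* h)) refl) e)

  represents-neg : ∀ {W r W′} → RepresentsOne W (- r) W′ → RepresentsOne W r W′
  represents-neg {W} {r} {W′} (representsOne c h e) = representsOne (- c) h (trans
    (solve (W ∷ r ∷ W′ ∷ c ∷ h ∷ []) (λ W r W′ c h → W :* (:- c :* :- c) :+ # 2 :* (r :* (:- c :* h)) :+ W′ :* (h :* h)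
      := W :* (c :* c) :+ # 2 :* (:- r :* (c :* h)) :+ W′ :* (h :* h)) refl) e)

  represents-shift : ∀ {W r W′} → RepresentsOne W (r - W) (W′ - + 2 * r + W) → RepresentsOne W r W′
  represents-shift {W} {r} {W′} (representsOne c h e) = representsOne (c - h) h (trans
    (solve (W ∷ r ∷ W′ ∷ c ∷ h ∷ []) (λ W r W′ c h → W :* ((c :- h) :* (c :- h)) :+ # 2 :* (r :* ((c :- h) :* h)) :+ W′ :* (h :* h)
      := W :* (c :* c) :+ # 2 :* ((r :- W) :* (c :* h)) :+ (W′ :- # 2 :* r :+ W) :* (h :* h)) refl) e)

  represents-∣∣ : ∀ {W W′} r → RepresentsOne W (+ ∣ r ∣) W′ → RepresentsOne W r W′
  represents-∣∣ (+ n)    x = x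
  represents-∣∣ -[1+ n ] x = represents-neg x

  private
    ∣i∣²≡i² : ∀ i → + ∣ i ∣ * + ∣ i ∣ ≡ i * i
    ∣i∣²≡i² (+ n)    = refl
    ∣i∣²≡i² -[1+ n ] = refl

    positive-cofactor : ∀ w x n → + w * x ≡ + suc n → ∃ λ m → x ≡ + m
    positive-cofactor w       (+ m)    n e = m , refl
    positive-cofactor (suc w) -[1+ m ] n ()
    positive-cofactor zero    -[1+ m ] n ()

    unit-norm : ∀ x y → x * x + + 3 * (y * y) ≡ 1ℤ → y ≡ 0ℤ × x * x ≡ 1ℤ
    unit-norm x y e = cases (∣ y ∣) refl
      where
      e′ : ∣ x ∣ ℕ.* ∣ x ∣ ℕ.+ 3 ℕ.* (∣ y ∣ ℕ.* ∣ y ∣) ≡ 1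
      e′ = +-injective (trans (cong₂ _+_ (pos-* (∣ x ∣) (∣ x ∣)) (trans (pos-* 3 (∣ y ∣ ℕ.* ∣ y ∣)) (cong (λ z → + 3 * z) (pos-* (∣ y ∣) (∣ y ∣)))))
        (trans (cong₂ (λ a b → a + + 3 * b) (∣i∣²≡i² x) (∣i∣²≡i² y)) e))
      too-big : ∀ m n → m ℕ.+ 3 ℕ.* (suc n ℕ.* suc n) ≢ 1
      too-big m n e = ℕ.<⇒≢ (ℕ.≤-trans (ℕ.s≤s (ℕ.s≤s ℕ.z≤n)) (ℕ.≤-trans (ℕ.*-monoʳ-≤ 3 {1} {suc n ℕ.* suc n} (ℕ.s≤s ℕ.z≤n)) (ℕ.m≤n+m _ m))) (sym e)
      cases : ∀ n → ∣ y ∣ ≡ n → y ≡ 0ℤ × x * x ≡ 1ℤ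
      cases zero    eq = y≡0 , trans (sym (+-identityʳ (x * x))) (trans (cong (λ z → x * x + + 3 * (z * z)) (sym y≡0)) e)
        where y≡0 = ∣i∣≡0⇒i≡0 {y} eq
      cases (suc n) eq = ⊥-elim (too-big _ n (subst (λ z → ∣ x ∣ ℕ.* ∣ x ∣ ℕ.+ 3 ℕ.* (z ℕ.* z) ≡ 1) eq e′))

    -- the reduction step r ↦ |r - w| when w < 2 r
    smaller : ∀ w r → 0 ℕ.< w → w ℕ.< 2 ℕ.* r → ∣ + r - + w ∣ ℕ.< r
    smaller w r 0<w w<2r = subst (ℕ._< r) (sym (cong ∣_∣ (m-n≡m⊖n r w))) (cases (ℕ.≤-total w r))
      where
      cases : w ℕ.≤ r ⊎ r ℕ.≤ w → ∣ r ⊖ w ∣ ℕ.< r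
      cases (inj₁ w≤r) rewrite ⊖-≥ w≤r = ℕ.∸-monoʳ-< 0<w w≤r
      cases (inj₂ r≤w) rewrite ∣m⊖n∣≡∣n⊖m∣ r w | ⊖-≥ r≤w =
        ℕ.+-cancelʳ-< r _ _ (subst₂ ℕ._<_ (sym (ℕ.m∸n+n≡m r≤w)) (cong (r ℕ.+_) (ℕ.+-identityʳ r)) w<2r)

  Odd : ℕ → Set
  Odd n = ¬ 2 ℕ.∣ n

  -- Gauss reduction of the form of discriminant -12.
  represents-one : ∀ n w r w′ → r ℕ.≤ n → w ℕ.* w′ ≡ r ℕ.* r ℕ.+ 3 → Odd w ⊎ Odd w′ → RepresentsOne (+ w) (+ r) (+ w′)

  private
    -- The new outer coefficient w′ - 2 r + w is a natural number because its product with w is (r -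
    -- w)² + 3. It has the parity of w′ + w, so the two outer coefficients do not become even
    -- together.
    step : ∀ n w r w′ → r ℕ.≤ suc n → w ℕ.< 2 ℕ.* r → w ℕ.* w′ ≡ r ℕ.* r ℕ.+ 3 → Odd w ⊎ Odd w′ → RepresentsOne (+ w) (+ r) (+ w′)
    step n w r w′ r≤n w<2r e o with positive-cofactor w (+ w′ - + 2 * + r + + w) (∣ + r - + w ∣ ℕ.* ∣ + r - + w ∣ ℕ.+ 2) (trans
      (solve₁ (+ w ∷ + r ∷ + w′ ∷ []) (λ w r w′ → (w :* (w′ :- # 2 :* r :+ w) := (r :- w) :* (r :- w) :+ # 3) , # 1 , (w :* w′ := r :* r :+ # 3)) refl
        (trans (sym (pos-* w w′)) (trans (cong +_ e) (cong (_+ + 3) (pos-* r r)))))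
      (trans (cong (_+ + 3) (sym (∣i∣²≡i² (+ r - + w)))) (trans (cong (_+ + 3) (sym (pos-* ∣ + r - + w ∣ ∣ + r - + w ∣))) (cong +_ (ℕ.+-suc _ 2)))))
    ... | w″ , w″≡ = represents-shift (represents-∣∣ (+ r - + w) (subst (RepresentsOne (+ w) (+ ∣ + r - + w ∣)) (sym w″≡)
        (represents-one n w (∣ + r - + w ∣) w″ (ℕ.≤-pred (ℕ.≤-trans (smaller w r 0<w w<2r) r≤n)) product (parity o))))
      where
      0<w : 0 ℕ.< w
      0<w = ℕ.n≢0⇒n>0 (λ { refl → case trans e (ℕ.+-comm (r ℕ.* r) 3) of λ () })
      product : w ℕ.* w″ ≡ ∣ + r - + w ∣ ℕ.* ∣ + r - + w ∣ ℕ.+ 3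
      product = +-injective (trans (pos-* w w″) (trans (cong (λ x → + w * x) (sym w″≡)) (trans
        (solve₁ (+ w ∷ + r ∷ + w′ ∷ []) (λ w r w′ → (w :* (w′ :- # 2 :* r :+ w) := (r :- w) :* (r :- w) :+ # 3) , # 1 , (w :* w′ := r :* r :+ # 3)) refl
          (trans (sym (pos-* w w′)) (trans (cong +_ e) (cong (_+ + 3) (pos-* r r)))))
        (trans (cong (_+ + 3) (sym (∣i∣²≡i² (+ r - + w)))) (cong (_+ + 3) (sym (pos-* ∣ + r - + w ∣ ∣ + r - + w ∣)))))))
      w″+2r : w″ ℕ.+ 2 ℕ.* r ≡ w′ ℕ.+ w
      w″+2r = +-injective (trans (cong (λ x → + w″ + x) (pos-* 2 r)) (trans (cong (_+ + 2 * + r) (sym w″≡))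
        (solve (+ w ∷ + r ∷ + w′ ∷ []) (λ w r w′ → w′ :- # 2 :* r :+ w :+ # 2 :* r := w′ :+ w) refl)))
      parity : Odd w ⊎ Odd w′ → Odd w ⊎ Odd w″
      parity (inj₁ o) = inj₁ o
      parity (inj₂ o) with 2 ℕ.∣? w
      ... | no  o′  = inj₁ o′
      ... | yes 2∣w = inj₂ (λ 2∣w″ → o (ℕ.∣m+n∣m⇒∣n (subst (2 ℕ.∣_) (trans w″+2r (ℕ.+-comm w′ w)) (ℕ.∣m∣n⇒∣m+n 2∣w″ (ℕ.m∣m*n r))) 2∣w))

  represents-one n w r w′ r≤n e o with 2 ℕ.* r ℕ.≤? w | 2 ℕ.* r ℕ.≤? w′
  represents-one zero    w zero w′ ℕ.z≤n e o | no ¬h | _     = ⊥-elim (¬h ℕ.z≤n)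
  represents-one zero    w zero w′ ℕ.z≤n e o | _     | no ¬h = ⊥-elim (¬h ℕ.z≤n)
  represents-one (suc n) w r w′ r≤n e o | no ¬h | _     = step n w r w′ r≤n (ℕ.≰⇒> ¬h) e o
  represents-one (suc n) w r w′ r≤n e o | yes _ | no ¬h = represents-swap
    (step n w′ r w r≤n (ℕ.≰⇒> ¬h) (trans (ℕ.*-comm w′ w) e) ([ inj₂ , inj₁ ]′ o))
  represents-one n w r w′ r≤n e o | yes h | yes h′ = reduced w r w′ h h′ e o
    where
    -- Up to exchange the reduced forms of determinant 3 are x² + 3 y² and 2 x² + 2 x y + 2 y²; the
    -- second, which does not represent 1, is excluded by parity. For r ≥ 2 the product w w′ ≥ 4 r²
    -- is too large.
    reduced : ∀ w r w′ → 2 ℕ.* r ℕ.≤ w → 2 ℕ.* r ℕ.≤ w′ → w ℕ.* w′ ≡ r ℕ.* r ℕ.+ 3 → Odd w ⊎ Odd w′ → RepresentsOne (+ w) (+ r) (+ w′)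
    reduced 1 0 w′ _ _ e o = representsOne 1ℤ 0ℤ (cong (λ x → 1ℤ + x) (*-zeroʳ (+ w′)))
    reduced w 0 1 _ _ e o = representsOne 0ℤ 1ℤ (cong (λ x → x + 0ℤ + 1ℤ) (*-zeroʳ (+ w)))
    reduced w 0 0 _ _ e o = case trans (sym (ℕ.*-zeroʳ w)) e of λ ()
    reduced 0 0 w′ _ _ e o = case e of λ ()
    reduced (suc (suc w)) 0 (suc (suc w′)) _ _ e o = ⊥-elim (ℕ.<⇒≱ (ℕ.s≤s (ℕ.s≤s (ℕ.s≤s (ℕ.s≤s ℕ.z≤n)))) (subst (4 ℕ.≤_) e (ℕ.*-mono-≤ {2} {suc (suc w)} {2} {suc (suc w′)} (ℕ.s≤s (ℕ.s≤s ℕ.z≤n)) (ℕ.s≤s (ℕ.s≤s ℕ.z≤n)))))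
    reduced 1 1 w′ (ℕ.s≤s ()) h′ e o
    reduced 2 1 2 _ _ e (inj₁ o) = ⊥-elim (o ℕ.∣-refl)
    reduced 2 1 2 _ _ e (inj₂ o) = ⊥-elim (o ℕ.∣-refl)
    reduced 2 1 (suc (suc (suc w′))) _ _ e o = ⊥-elim (ℕ.<⇒≢ (ℕ.≤-trans (ℕ.n≤1+n 5) (ℕ.*-monoʳ-≤ 2 {3} {suc (suc (suc w′))} (ℕ.s≤s (ℕ.s≤s (ℕ.s≤s ℕ.z≤n))))) (sym e))
    reduced (suc (suc (suc w))) 1 w′ _ h′ e o = ⊥-elim (ℕ.<⇒≢ (ℕ.≤-trans (ℕ.n≤1+n 5) (ℕ.*-mono-≤ {3} {suc (suc (suc w))} (ℕ.s≤s (ℕ.s≤s (ℕ.s≤s ℕ.z≤n))) h′)) (sym e))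
    reduced w (suc (suc r)) w′ h h′ e o = ⊥-elim (ℕ.<⇒≱ big (subst (2 ℕ.* (2 ℕ.+ r) ℕ.* (2 ℕ.* (2 ℕ.+ r)) ℕ.≤_) e (ℕ.*-mono-≤ h h′)))
      where
      big : (2 ℕ.+ r) ℕ.* (2 ℕ.+ r) ℕ.+ 3 ℕ.< 2 ℕ.* (2 ℕ.+ r) ℕ.* (2 ℕ.* (2 ℕ.+ r))
      big = subst ((2 ℕ.+ r) ℕ.* (2 ℕ.+ r) ℕ.+ 3 ℕ.<_) (solveⁿ (r ∷ []) (λ r → (# 2 :+ r) :* (# 2 :+ r) :+ # 3 :+ (# 9 :+ # 12 :* r :+ # 3 :* (r :* r))
        := # 2 :* (# 2 :+ r) :* (# 2 :* (# 2 :+ r))) refl refl) (ℕ.m<m+n _ (ℕ.s≤s ℕ.z≤n))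

  -- (g + h √-3)³ = cubeRe g h + cubeIm g h √-3
  cubeRe cubeIm : ℤ → ℤ → ℤ
  cubeRe g h = g * g * g - + 9 * (g * (h * h))
  cubeIm g h = + 3 * (g * g * h) - + 3 * (h * h * h)

  private
    :cubeRe :cubeIm : ∀ {n} → Expr n → Expr n → Expr n
    :cubeRe g h = g :* g :* g :- # 9 :* (g :* (h :* h))
    :cubeIm g h = # 3 :* (g :* g :* h) :- # 3 :* (h :* h :* h)

    abstract
      cube-norm : ∀ g h → cubeRe g h * cubeRe g h + + 3 * (cubeIm g h * cubeIm g h)
                  ≡ (g * g + + 3 * (h * h)) * (g * g + + 3 * (h * h)) * (g * g + + 3 * (h * h))
      cube-norm g h = solve (g ∷ h ∷ []) (λ g h → :cubeRe g h :* :cubeRe g h :+ # 3 :* (:cubeIm g h :* :cubeIm g h) :=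
        (g :* g :+ # 3 :* (h :* h)) :* (g :* g :+ # 3 :* (h :* h)) :* (g :* g :+ # 3 :* (h :* h))) refl

      -- As r² ≡ -3 modulo W³, sending √-3 to - r is a ring homomorphism to the residues modulo W³.
      -- It maps γ = (r h + W c) + h √-3 to W c, so γ³ goes to 0.
      cube-root-mod : ∀ r W m c h → r * r + + 3 ≡ W * W * W * m →
        cubeRe (r * h + W * c) h - r * cubeIm (r * h + W * c) h
          ≡ W * W * W * (c * c * c - m * (+ 3 * ((r * h + W * c) * (h * h)) - h * h * h * r))
      cube-root-mod r W m c h e = solve₁ (r ∷ W ∷ m ∷ c ∷ h ∷ []) (λ r W m c h →
        (:cubeRe (r :* h :+ W :* c) h :- r :* :cubeIm (r :* h :+ W :* c) h
          := W :* W :* W :* (c :* c :* c :- m :* (# 3 :* ((r :* h :+ W :* c) :* (h :* h)) :- h :* h :* h :* r))) ,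
        :- (# 3 :* ((r :* h :+ W :* c) :* (h :* h)) :- h :* h :* h :* r) , (r :* r :+ # 3 := W :* W :* W :* m)) refl e

      cube-unit : ∀ X g h → X * X ≡ 1ℤ → X * g * (X * g) + + 3 * (X * h * (X * h)) ≡ g * g + + 3 * (h * h) ×
                  cubeRe g h * X ≡ cubeRe (X * g) (X * h)
      cube-unit X g h e =
          solve₁ (X ∷ g ∷ h ∷ []) (λ X g h → (X :* g :* (X :* g) :+ # 3 :* (X :* h :* (X :* h)) := g :* g :+ # 3 :* (h :* h)) ,
            g :* g :+ # 3 :* (h :* h) , (X :* X := # 1)) refl e
        , solve₁ (X ∷ g ∷ h ∷ []) (λ X g h → (:cubeRe g h :* X := :cubeRe (X :* g) (X :* h)) ,
            :- (X :* :cubeRe g h) , (X :* X := # 1)) refl e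

  -- Euler's lemma for cubes. With r = P / k modulo W³, the Gauss reduction gives γ = g + h √-3 of
  -- norm W with g ≡ r h (mod W), so that (P + k √-3) γ̄³ is divisible by W³; the quotient has norm 1.
  module _ {P k : ℤ} {w : ℕ} (odd-w : Odd w) (norm : P * P + + 3 * (k * k) ≡ + w * + w * + w)
           {x y : ℤ} (bézout : k * x + + w * + w * + w * y ≡ 1ℤ) where

    private
      W W³ r m : ℤ
      W  = + w
      W³ = W * W * W
      r  = P * x
      -- r² + 3 = W³ m
      m  = x * x + + 3 * (y * (1ℤ + k * x))

      r²+3≡ : r * r + + 3 ≡ W³ * m
      r²+3≡ = solve₂ (P ∷ k ∷ W ∷ x ∷ y ∷ []) (λ P k W x y → (P :* x :* (P :* x) :+ # 3 := W :* W :* W :* (x :* x :+ # 3 :* (y :* (# 1 :+ k :* x)))) ,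
        (x :* x , (P :* P :+ # 3 :* (k :* k) := W :* W :* W)) ,
        :- (# 3 :* (# 1 :+ k :* x)) , (k :* x :+ W :* W :* W :* y := # 1)) refl norm bézout

      W≢0 : NonZero W³
      W≢0 = ≢-nonZero λ W³≡0 → W-cases w odd-w W³≡0
        where
        W-cases : ∀ w → Odd w → + w * + w * + w ≢ 0ℤ
        W-cases zero    o e = o (2 ℕ.∣0)
        W-cases (suc w) o ()

      cofactor : ∃ λ w′ → W * W * m ≡ + w′
      cofactor = positive-cofactor w (W * W * m) (∣ r ∣ ℕ.* ∣ r ∣ ℕ.+ 2)
        (trans (solve (W ∷ m ∷ []) (λ W m → W :* (W :* W :* m) := W :* W :* W :* m) refl) (trans (sym r²+3≡)
          (trans (cong (_+ + 3) (trans (sym (∣i∣²≡i² r)) (sym (pos-* ∣ r ∣ ∣ r ∣)))) (cong +_ (ℕ.+-suc _ 2)))))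

      -- The determinant is W · W² m - r² = 3, and the outer coefficient `W` is odd.
      reduction : RepresentsOne W r (W * W * m)
      reduction = subst (RepresentsOne W r) (sym (proj₂ cofactor)) (represents-∣∣ r
        (represents-one (∣ r ∣) w (∣ r ∣) (proj₁ cofactor) ℕ.≤-refl (+-injective (begin
          + (w ℕ.* proj₁ cofactor)          ≡⟨ pos-* w (proj₁ cofactor) ⟩
          W * + proj₁ cofactor              ≡⟨ cong (λ x → W * x) (proj₂ cofactor) ⟨
          W * (W * W * m)                   ≡⟨ solve (W ∷ m ∷ []) (λ W m → W :* (W :* W :* m) := W :* W :* W :* m) refl ⟩
          W³ * m                            ≡⟨ r²+3≡ ⟨
          r * r + + 3                       ≡⟨ cong (_+ + 3) (trans (sym (∣i∣²≡i² r)) (sym (pos-* ∣ r ∣ ∣ r ∣))) ⟩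
          + (∣ r ∣ ℕ.* ∣ r ∣ ℕ.+ 3)         ∎)) (inj₁ odd-w)))
        where open ≡-Reasoning

      c h g G H u X Y : ℤ
      c = RepresentsOne.c reduction
      h = RepresentsOne.h reduction
      g = r * h + W * c
      G = cubeRe g h
      H = cubeIm g h
      u = c * c * c - m * (+ 3 * (g * (h * h)) - h * h * h * r)
      X = k * (r * u + m * H) + P * y * G
      Y = k * u - P * y * H

      abstract
        -- `W` times the value 1 of the form is (W c + r h)² + 3 h².
        g²+3h² : g * g + + 3 * (h * h) ≡ W
        g²+3h² = solve₂ (r ∷ W ∷ m ∷ c ∷ h ∷ []) (λ r W m c h → ((r :* h :+ W :* c) :* (r :* h :+ W :* c) :+ # 3 :* (h :* h) := W) ,
          (W , (W :* (c :* c) :+ # 2 :* (r :* (c :* h)) :+ W :* W :* m :* (h :* h) := # 1)) ,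
          h :* h , (r :* r :+ # 3 := W :* W :* W :* m)) refl (RepresentsOne.value reduction) r²+3≡

        G-rH : G - r * H ≡ W³ * u
        G-rH = cube-root-mod r W m c h r²+3≡

        rG+3H : r * G + + 3 * H ≡ W³ * (r * u + m * H)
        rG+3H = solve₂ (r ∷ W³ ∷ m ∷ G ∷ H ∷ u ∷ []) (λ r W³ m G H u → (r :* G :+ # 3 :* H := W³ :* (r :* u :+ m :* H)) ,
          (r , (G :- r :* H := W³ :* u)) , H , (r :* r :+ # 3 := W³ :* m)) refl G-rH r²+3≡

        P≡ : P ≡ r * k + W³ * (P * y)
        P≡ = solve₁ (P ∷ k ∷ W³ ∷ x ∷ y ∷ []) (λ P k W³ x y → (P := P :* x :* k :+ W³ :* (P :* y)) ,
          :- P , (k :* x :+ W³ :* y := # 1)) refl bézout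

        -- This and `imaginary` are the two parts of (P + k √-3) γ̄³ = W³ (X + Y √-3), where γ³ = G
        -- + H √-3.
        real : P * G + + 3 * (k * H) ≡ W³ * X
        real = solve₂ (P ∷ k ∷ r ∷ W³ ∷ m ∷ y ∷ G ∷ H ∷ u ∷ []) (λ P k r W³ m y G H u →
          (P :* G :+ # 3 :* (k :* H) := W³ :* (k :* (r :* u :+ m :* H) :+ P :* y :* G)) ,
          (G , (P := r :* k :+ W³ :* (P :* y))) , k , (r :* G :+ # 3 :* H := W³ :* (r :* u :+ m :* H))) refl P≡ rG+3H

        imaginary : k * G - P * H ≡ W³ * Y
        imaginary = solve₂ (P ∷ k ∷ r ∷ W³ ∷ y ∷ G ∷ H ∷ u ∷ []) (λ P k r W³ y G H u →
          (k :* G :- P :* H := W³ :* (k :* u :- P :* y :* H)) ,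
          (:- H , (P := r :* k :+ W³ :* (P :* y))) , k , (G :- r :* H := W³ :* u)) refl P≡ G-rH

        G²+3H² : G * G + + 3 * (H * H) ≡ W³
        G²+3H² = trans (cube-norm g h) (cong (λ n → n * n * n) g²+3h²)

        X²+3Y² : X * X + + 3 * (Y * Y) ≡ 1ℤ
        X²+3Y² = *-cancelˡ-≡ W³ _ _ {{W≢0}} (*-cancelˡ-≡ W³ _ _ {{W≢0}} (begin
          W³ * (W³ * (X * X + + 3 * (Y * Y)))
            ≡⟨ solve (W³ ∷ X ∷ Y ∷ []) (λ W³ X Y → W³ :* (W³ :* (X :* X :+ # 3 :* (Y :* Y))) := W³ :* X :* (W³ :* X) :+ # 3 :* (W³ :* Y :* (W³ :* Y))) refl ⟩
          W³ * X * (W³ * X) + + 3 * (W³ * Y * (W³ * Y))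
            ≡⟨ cong₂ (λ a b → a * a + + 3 * (b * b)) real imaginary ⟨
          (P * G + + 3 * (k * H)) * (P * G + + 3 * (k * H)) + + 3 * ((k * G - P * H) * (k * G - P * H))
            ≡⟨ solve (P ∷ k ∷ G ∷ H ∷ []) (λ P k G H → (P :* G :+ # 3 :* (k :* H)) :* (P :* G :+ # 3 :* (k :* H)) :+ # 3 :* ((k :* G :- P :* H) :* (k :* G :- P :* H))
                 := (P :* P :+ # 3 :* (k :* k)) :* (G :* G :+ # 3 :* (H :* H))) refl ⟩
          (P * P + + 3 * (k * k)) * (G * G + + 3 * (H * H))
            ≡⟨ cong₂ _*_ norm G²+3H² ⟩
          W³ * W³
            ≡⟨ cong (λ x → W³ * x) (*-identityʳ W³) ⟨
          W³ * (W³ * 1ℤ) ∎))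
          where open ≡-Reasoning

    abstract
      norm-cube⇒cube : ∃₂ λ g h → g * g + + 3 * (h * h) ≡ + w × P ≡ cubeRe g h
      norm-cube⇒cube = X * g , X * h , trans (proj₁ (cube-unit X g h X²≡1)) g²+3h² , trans P≡GX (proj₂ (cube-unit X g h X²≡1))
        where
        X²≡1 : X * X ≡ 1ℤ
        X²≡1 = proj₂ (unit-norm X Y X²+3Y²)
        kG≡PH : k * G ≡ P * H
        kG≡PH = ≡-from-diff (trans imaginary (trans (cong (λ y → W³ * y) (proj₁ (unit-norm X Y X²+3Y²))) (*-zeroʳ W³)))
        P≡GX : P ≡ G * X
        P≡GX = *-cancelˡ-≡ W³ _ _ {{W≢0}} (begin
          W³ * P                                 ≡⟨ cong (_* P) G²+3H² ⟨
          (G * G + + 3 * (H * H)) * P            ≡⟨ solve₁ (P ∷ k ∷ G ∷ H ∷ []) (λ P k G H → ((G :* G :+ # 3 :* (H :* H)) :* P := G :* (P :* G :+ # 3 :* (k :* H))) ,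
                                                      :- (# 3 :* H) , (k :* G := P :* H)) refl kG≡PH ⟩
          G * (P * G + + 3 * (k * H))            ≡⟨ cong (G *_) real ⟩
          G * (W³ * X)                           ≡⟨ solve (W³ ∷ G ∷ X ∷ []) (λ W G X → G :* (W :* X) := W :* (G :* X)) refl ⟩
          W³ * (G * X)                           ∎)
          where open ≡-Reasoning

-- Identities on y² = x (x + 1) (x + 4) and for duplication and chords on G

module Quartics where

  open PolynomialIdentities hiding (solve; solve₁; solve₂; prove; ⟦_⟧)
  open import Algebra.Bundles using (CommutativeRing)
  open import Algebra.Morphism.Structures using (module RingMorphisms)
  open import Data.Integer.Base as ℤ using (ℤ; +_)
  import Data.Integer.Properties as ℤ
  open import Data.Product.Base using (_,_)
  open import Data.Vec.Base using ([]; _∷_)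
  open import Relation.Binary.PropositionalEquality.Core as ≡ using (_≡_)
  open import Level using (0ℓ)

  module Quartic (R : CommutativeRing 0ℓ 0ℓ)
           (ι : ℤ → CommutativeRing.Carrier R)
           (homomorphism : RingMorphisms.IsRingHomomorphism
             (CommutativeRing.rawRing ℤ.+-*-commutativeRing) (CommutativeRing.rawRing R) ι)
    where

    open CommutativeRing R
    open Solver R ι homomorphism

    -- (ξ , η , ζ) stands for the point (ξ / 4 η² , ζ / 8 η³) of y² = x (x + 1) (x + 4).
    OnCurve : Carrier → Carrier → Carrier → Set
    OnCurve ξ η ζ = ζ * ζ ≈ ξ * (ξ + ι (+ 4) * (η * η)) * (ξ + ι (+ 16) * (η * η))

    module _ (ξ η ζ : Carrier) where
      -- Doubling makes all three factors squares: at the double of the point, x = (r / w)², x + 1 =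
      -- (s / w)² and x + 4 = (u / w)².
      rᶜ sᶜ uᶜ wᶜ : Carrier
      rᶜ = ξ * ξ - ι (+ 64) * (η * η * (η * η))
      sᶜ = ξ * ξ + ι (+ 8) * (ξ * (η * η)) + ι (+ 64) * (η * η * (η * η))
      uᶜ = ξ * ξ + ι (+ 32) * (ξ * (η * η)) + ι (+ 64) * (η * η * (η * η))
      wᶜ = ι (+ 4) * (η * ζ)

      module _ (c : OnCurve ξ η ζ) where
        abstract
          r²+w²≈s² : rᶜ * rᶜ + wᶜ * wᶜ ≈ sᶜ * sᶜ
          r²+w²≈s² = solve₁ (ξ ∷ η ∷ ζ ∷ []) (λ x e z →
            let H = e :* e ; H² = e :* e :* (e :* e) ; r = x :* x :- # 64 :* H² ; s = x :* x :+ # 8 :* (x :* H) :+ # 64 :* H² ; w = # 4 :* (e :* z) in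
            (r :* r :+ w :* w := s :* s) , # 16 :* H , (z :* z := x :* (x :+ # 4 :* H) :* (x :+ # 16 :* H))) ≡.refl c

          r²+4w²≈u² : rᶜ * rᶜ + ι (+ 4) * (wᶜ * wᶜ) ≈ uᶜ * uᶜ
          r²+4w²≈u² = solve₁ (ξ ∷ η ∷ ζ ∷ []) (λ x e z →
            let H = e :* e ; H² = e :* e :* (e :* e) ; r = x :* x :- # 64 :* H² ; u = x :* x :+ # 32 :* (x :* H) :+ # 64 :* H² ; w = # 4 :* (e :* z) in
            (r :* r :+ # 4 :* (w :* w) := u :* u) , # 64 :* H , (z :* z := x :* (x :+ # 4 :* H) :* (x :+ # 16 :* H))) ≡.refl c

    module _ (X a e : Carrier) where
      ξ₀ ξᶜ ηᶜ ζᶜ : Carrier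
      ξ₀ = (X + a) * (X + a) - ι (+ 36) * (a * (e * e))
      ξᶜ = ι (+ 9) * (a * a * ξ₀)
      ηᶜ = ι (+ 9) * (a * (e * e))
      ζᶜ = - (ι (+ 9) * (a * a * (ξ₀ * (ξ₀ + ι (+ 18) * (a * (e * e))))))

      -- The root x = (2 X / a - 4) / 3 of x³ + 4 x² + (4 - 2 c) x - c² = 0, c = 8 e² / a, gives the point
      -- (x , x + c); its sum with (0 , 0) has x-coordinate 4 / x = ξ₀ / 36 e⁴.
      abstract
        onCurve : X * X * X ≈ ι (+ 3) * (a * (a + ι (+ 12) * (e * e)) * X) + ι (+ 2) * (a * (a * a - ι (+ 36) * (a * (e * e)) + ι (+ 108) * (e * e * (e * e)))) →
                  OnCurve ξᶜ ηᶜ ζᶜ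
        onCurve root = solve₁ (ξ₀ ∷ a ∷ e ∷ []) (λ x a e →
          (:- (# 9 :* (a :* a :* (x :* (x :+ # 18 :* (a :* (e :* e)))))) :* :- (# 9 :* (a :* a :* (x :* (x :+ # 18 :* (a :* (e :* e)))))) :=
            # 9 :* (a :* a :* x) :* (# 9 :* (a :* a :* x) :+ # 4 :* (# 9 :* (a :* (e :* e)) :* (# 9 :* (a :* (e :* e)))))
              :* (# 9 :* (a :* a :* x) :+ # 16 :* (# 9 :* (a :* (e :* e)) :* (# 9 :* (a :* (e :* e)))))) ,
          # 81 :* (a :* a :* a :* a :* x) ,
          (x :* ((x :+ # 18 :* (a :* (e :* e))) :* (x :+ # 18 :* (a :* (e :* e)))) :=
            # 9 :* (a :* a) :* ((x :+ # 36 :* (e :* e :* (e :* e))) :* (x :+ # 144 :* (e :* e :* (e :* e)))))) ≡.refl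
          (solve₁ (X ∷ a ∷ e ∷ []) (λ X a e →
            ( :ξ X a e :* ((:ξ X a e :+ # 18 :* (a :* (e :* e))) :* (:ξ X a e :+ # 18 :* (a :* (e :* e)))) :=
              # 9 :* (a :* a) :* ((:ξ X a e :+ # 36 :* (e :* e :* (e :* e))) :* (:ξ X a e :+ # 144 :* (e :* e :* (e :* e))))) ,
            X :* X :* X :+ # 6 :* (a :* X :* X) :+ # 9 :* (a :* a :* X) :- # 36 :* (a :* (e :* e) :* X)
              :+ # 4 :* (a :* a :* a) :- # 144 :* (a :* a :* (e :* e)) :+ # 216 :* (a :* (e :* e) :* (e :* e)) ,
            (X :* X :* X := # 3 :* (a :* (a :+ # 12 :* (e :* e)) :* X) :+ # 2 :* (a :* (a :* a :- # 36 :* (a :* (e :* e)) :+ # 108 :* (e :* e :* (e :* e)))))) ≡.refl root)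
          where
          :ξ : ∀ {n} → Expr n → Expr n → Expr n → Expr n
          :ξ X a e = (X :+ a) :* (X :+ a) :- # 36 :* (a :* (e :* e))

  -- The elliptic curve n² = a³ - 10 a² e² + 88 a e⁴ - 108 e⁶; E stands for e².
  module GroupLaw (R : CommutativeRing 0ℓ 0ℓ)
                  (ι : ℤ → CommutativeRing.Carrier R)
                  (homomorphism : RingMorphisms.IsRingHomomorphism
                    (CommutativeRing.rawRing ℤ.+-*-commutativeRing) (CommutativeRing.rawRing R) ι)
    where

    open CommutativeRing R
    open Solver R ι homomorphism

    cubicE : Carrier → Carrier → Carrier
    cubicE a E = a * a * a - ι (+ 10) * (a * a * E) + ι (+ 88) * (a * (E * E)) - ι (+ 108) * (E * E * E)

    doubleA : Carrier → Carrier → Carrier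
    doubleA a E = a * a * (a * a) - ι (+ 176) * (a * a * (E * E)) + ι (+ 864) * (a * (E * E * E)) + ι (+ 3424) * (E * E * (E * E))

    doubleN : Carrier → Carrier → Carrier
    doubleN a E = a * a * a * (a * a * a) - ι (+ 20) * (a * a * a * (a * a) * E) + ι (+ 440) * (a * a * (a * a) * (E * E)) - ι (+ 2160) * (a * a * a * (E * E * E)) - ι (+ 17120) * (a * a * (E * E * (E * E))) + ι (+ 106496) * (a * (E * E * E * (E * E))) - ι (+ 394624) * (E * E * E * (E * E * E))

    D : Carrier → Carrier → Carrier → Carrier → Carrier
    D a E b F = a * F - b * E

    -- For points P and Q of G, the x-coordinates of P + Q and P - Q have sum 2 `S₀` / `D`² and
    -- product `Π₀` / `D`².
    S₀ : Carrier → Carrier → Carrier → Carrier → Carrier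
    S₀ a E b F = (a * F + b * E) * (a * b + ι (+ 88) * (E * F)) - ι (+ 20) * (a * b * (E * F)) - ι (+ 216) * (E * E * (F * F))

    Π₀ : Carrier → Carrier → Carrier → Carrier → Carrier
    Π₀ a E b F = (a * b - ι (+ 88) * (E * F)) * (a * b - ι (+ 88) * (E * F)) + ι (+ 432) * (E * F * (a * F + b * E - ι (+ 10) * (E * F)))

    C₁ : Carrier → Carrier → Carrier → Carrier → Carrier
    C₁ a E b F = ι (+ 3) * (a * b * b * F) - ι (+ 20) * (a * b * F * F) + ι (+ 88) * (a * F * F * F) + E * b * b * b - ι (+ 20) * (E * b * b * F) + ι (+ 264) * (E * b * F * F) - ι (+ 432) * (E * F * F * F)

    resA : Carrier → Carrier → Carrier
    resA a E = ι (+ 3) * (a * a) - ι (+ 20) * (a * E) + ι (+ 252) * (E * E)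

    resN : Carrier → Carrier → Carrier
    resN a E = - (ι (+ 3) * (a * a * a)) - ι (+ 10) * (a * a * E) + ι (+ 440) * (a * (E * E)) - ι (+ 1156) * (E * E * E)

    double-a⁴ : Carrier → Carrier → Carrier
    double-a⁴ a E = - ι (+ 176) * (a * a * E) + ι (+ 864) * (a * (E * E)) + ι (+ 3424) * (E * E * E)

    node : Carrier → Carrier → Carrier
    node a E = a * a - ι (+ 9) * (a * E) + ι (+ 33) * (E * E)

    node² : Carrier → Carrier → Carrier
    node² a E = ι (+ 213) * (E * E) - ι (+ 10) * (a * a) - ι (+ 12) * (a * E)

    double15 : Carrier → Carrier → Carrier
    double15 a E = a * a * a + ι (+ 15) * (a * a * E) + ι (+ 49) * (a * (E * E)) + ι (+ 1599) * (E * E * E)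

    cubic-a³ : Carrier → Carrier → Carrier
    cubic-a³ a E = ι (+ 88) * (a * E) - ι (+ 10) * (a * a) - ι (+ 108) * (E * E)

    scaled-rest : Carrier → Carrier → Carrier → Carrier
    scaled-rest p h d = ι (+ 88) * (p * h * (d * d * (d * d))) - ι (+ 10) * (h * h * (d * d)) - ι (+ 108) * (p * p * (d * d * (d * d) * (d * d)))

    E⁴ E⁶ : Carrier → Carrier
    E⁴ E = E * E * (E * E)
    E⁶ E = E * E * E * (E * E * E)

    t₇ t₁₅ : Carrier → Carrier → Carrier
    t₇ a E  = a - ι (+ 7) * E
    t₁₅ a E = a - ι (+ 15) * E

    C₂ : Carrier → Carrier → Carrier → Carrier → Carrier
    C₂ a E b F = C₁ b F a E

    private
      :cubicE : ∀ {n} → Expr n → Expr n → Expr n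
      :cubicE a E = a :* a :* a :- # 10 :* (a :* a :* E) :+ # 88 :* (a :* (E :* E)) :- # 108 :* (E :* E :* E)

      :doubleA : ∀ {n} → Expr n → Expr n → Expr n
      :doubleA a E = a :* a :* (a :* a) :- # 176 :* (a :* a :* (E :* E)) :+ # 864 :* (a :* (E :* E :* E)) :+ # 3424 :* (E :* E :* (E :* E))

      :doubleN : ∀ {n} → Expr n → Expr n → Expr n
      :doubleN a E = a :* a :* a :* (a :* a :* a) :- # 20 :* (a :* a :* a :* (a :* a) :* E) :+ # 440 :* (a :* a :* (a :* a) :* (E :* E)) :- # 2160 :* (a :* a :* a :* (E :* E :* E)) :- # 17120 :* (a :* a :* (E :* E :* (E :* E))) :+ # 106496 :* (a :* (E :* E :* E :* (E :* E))) :- # 394624 :* (E :* E :* E :* (E :* E :* E))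

      :D : ∀ {n} → Expr n → Expr n → Expr n → Expr n → Expr n
      :D a E b F = a :* F :- b :* E

      :S₀ : ∀ {n} → Expr n → Expr n → Expr n → Expr n → Expr n
      :S₀ a E b F = (a :* F :+ b :* E) :* (a :* b :+ # 88 :* (E :* F)) :- # 20 :* (a :* b :* (E :* F)) :- # 216 :* (E :* E :* (F :* F))

      :Π₀ : ∀ {n} → Expr n → Expr n → Expr n → Expr n → Expr n
      :Π₀ a E b F = (a :* b :- # 88 :* (E :* F)) :* (a :* b :- # 88 :* (E :* F)) :+ # 432 :* (E :* F :* (a :* F :+ b :* E :- # 10 :* (E :* F)))

      :C₁ : ∀ {n} → Expr n → Expr n → Expr n → Expr n → Expr n
      :C₁ a E b F = # 3 :* (a :* b :* b :* F) :- # 20 :* (a :* b :* F :* F) :+ # 88 :* (a :* F :* F :* F) :+ E :* b :* b :* b :- # 20 :* (E :* b :* b :* F) :+ # 264 :* (E :* b :* F :* F) :- # 432 :* (E :* F :* F :* F)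

      :resA : ∀ {n} → Expr n → Expr n → Expr n
      :resA a E = # 3 :* (a :* a) :- # 20 :* (a :* E) :+ # 252 :* (E :* E)

      :resN : ∀ {n} → Expr n → Expr n → Expr n
      :resN a E = :- (# 3 :* (a :* a :* a)) :- # 10 :* (a :* a :* E) :+ # 440 :* (a :* (E :* E)) :- # 1156 :* (E :* E :* E)

      :double-a⁴ : ∀ {n} → Expr n → Expr n → Expr n
      :double-a⁴ a E = :- # 176 :* (a :* a :* E) :+ # 864 :* (a :* (E :* E)) :+ # 3424 :* (E :* E :* E)

      :node : ∀ {n} → Expr n → Expr n → Expr n
      :node a E = a :* a :- # 9 :* (a :* E) :+ # 33 :* (E :* E)

      :node² : ∀ {n} → Expr n → Expr n → Expr n
      :node² a E = # 213 :* (E :* E) :- # 10 :* (a :* a) :- # 12 :* (a :* E)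

      :double15 : ∀ {n} → Expr n → Expr n → Expr n
      :double15 a E = a :* a :* a :+ # 15 :* (a :* a :* E) :+ # 49 :* (a :* (E :* E)) :+ # 1599 :* (E :* E :* E)

      :C₂ : ∀ {n} → Expr n → Expr n → Expr n → Expr n → Expr n
      :C₂ a E b F = :C₁ b F a E

    abstract
      double-curve : ∀ a E → doubleN a E * doubleN a E ≈ cubicE (doubleA a E) (ι (+ 4) * (E * cubicE a E))
      double-curve a E = solve (a ∷ E ∷ []) (λ a E → :doubleN a E :* :doubleN a E := :cubicE (:doubleA a E) (# 4 :* (E :* :cubicE a E))) ≡.refl

      -- Since 987696 = 2⁴ · 3² · 19³, away from E the numerator of the double and the cubic can
      -- share only the primes 2, 3 and 19.
      resultant : ∀ a E → resA a E * doubleA a E + resN a E * cubicE a E ≈ ι (+ 987696) * E⁶ E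
      resultant a E = solve (a ∷ E ∷ []) (λ a E → :resA a E :* :doubleA a E :+ :resN a E :* :cubicE a E := # 987696 :* (E :* E :* E :* (E :* E :* E))) ≡.refl

      doubleA≈a⁴ : ∀ a E → doubleA a E ≈ a * a * (a * a) + E * double-a⁴ a E
      doubleA≈a⁴ a E = solve (a ∷ E ∷ []) (λ a E → :doubleA a E := a :* a :* (a :* a) :+ E :* :double-a⁴ a E) ≡.refl

      cubic≈a³ : ∀ a E → cubicE a E ≈ a * a * a + E * cubic-a³ a E
      cubic≈a³ a E = solve (a ∷ E ∷ []) (λ a E → :cubicE a E := a :* a :* a :+ E :* (# 88 :* (a :* E) :- # 10 :* (a :* a) :- # 108 :* (E :* E))) ≡.refl

      -- Modulo 19 the curve has the node a = 7 E.
      cubic-mod-19 : ∀ a E → cubicE a E ≈ t₇ a E * t₇ a E * t₁₅ a E + ι (+ 19) * (E * node a E)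
      cubic-mod-19 a E = solve (a ∷ E ∷ []) (λ a E → :cubicE a E := (a :- # 7 :* E) :* (a :- # 7 :* E) :* (a :- # 15 :* E) :+ # 19 :* (E :* :node a E)) ≡.refl

      -- Division by a - 15 E, the other factor of the cubic modulo 19; the remainder 27409 is prime
      -- to 19.
      double-mod-15 : ∀ a E → doubleA a E ≈ t₁₅ a E * double15 a E + ι (+ 27409) * E⁴ E
      double-mod-15 a E = solve (a ∷ E ∷ []) (λ a E → :doubleA a E := (a :- # 15 :* E) :* :double15 a E :+ # 27409 :* (E :* E :* (E :* E))) ≡.refl

      -- Modulo 19 the distance from the node is raised to the fourth power, so the double of a
      -- point off the node is off the node.
      double-mod-19 : ∀ a E → doubleA a E - ι (+ 7) * (ι (+ 4) * (E * cubicE a E)) ≈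
        t₇ a E * t₇ a E * (t₇ a E * t₇ a E) + ι (+ 19) * (E * E * node² a E)
      double-mod-19 a E = solve (a ∷ E ∷ []) (λ a E → :doubleA a E :- # 7 :* (# 4 :* (E :* :cubicE a E)) :=
        (a :- # 7 :* E) :* (a :- # 7 :* E) :* ((a :- # 7 :* E) :* (a :- # 7 :* E)) :+ # 19 :* (E :* E :* :node² a E)) ≡.refl

      -- With m = e f n l, E = e² and F = f², the point (a , e , n) - (b , f , l) has x-coordinate (S₀ + 2 m) / D².
      chord-product : ∀ a E b F m → m * m ≈ E * F * (cubicE a E * cubicE b F) →
                      (S₀ a E b F + ι (+ 2) * m) * (S₀ a E b F - ι (+ 2) * m) ≈ Π₀ a E b F * (D a E b F * D a E b F)
      chord-product a E b F m h = solve₁ (a ∷ E ∷ b ∷ F ∷ m ∷ []) (λ a E b F m →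
        ((:S₀ a E b F :+ # 2 :* m) :* (:S₀ a E b F :- # 2 :* m) := :Π₀ a E b F :* (:D a E b F :* :D a E b F)) ,
        :- # 4 , (m :* m := E :* F :* (:cubicE a E :* :cubicE b F))) ≡.refl h

      chord-square : ∀ a E b F m → m * m ≈ E * F * (cubicE a E * cubicE b F) →
        E * cubicE a E * (C₁ a E b F * C₁ a E b F) + F * cubicE b F * (C₂ a E b F * C₂ a E b F) + ι (+ 2) * (m * (C₁ a E b F * C₂ a E b F))
          ≈ cubicE (S₀ a E b F + ι (+ 2) * m) (D a E b F * D a E b F)
      chord-square a E b F m h = solve₁ (a ∷ E ∷ b ∷ F ∷ m ∷ []) (λ a E b F m →
        (E :* :cubicE a E :* (:C₁ a E b F :* :C₁ a E b F) :+ F :* :cubicE b F :* (:C₂ a E b F :* :C₂ a E b F) :+ # 2 :* (m :* (:C₁ a E b F :* :C₂ a E b F))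
          := :cubicE (:S₀ a E b F :+ # 2 :* m) (:D a E b F :* :D a E b F)) ,
        :- (# 12 :* :S₀ a E b F :+ # 8 :* m :- # 40 :* (:D a E b F :* :D a E b F)) , (m :* m := E :* F :* (:cubicE a E :* :cubicE b F))) ≡.refl h

      -- the congruences used when (a , e , n) ≡ (b , f , l), and when E ≡ F ≡ 0
      chord-diagonal : ∀ a E m → m ≈ E * cubicE a E → S₀ a E a E + ι (+ 2) * m ≈ ι (+ 4) * (E * cubicE a E)
      chord-diagonal a E m h = solve₁ (a ∷ E ∷ m ∷ []) (λ a E m → (:S₀ a E a E :+ # 2 :* m := # 4 :* (E :* :cubicE a E)) , # 2 , (m := E :* :cubicE a E)) ≡.refl h

      S₀-at-O : ∀ a E b F → S₀ a E b F ≈ a * F * (a * b + ι (+ 88) * (E * F)) + E * (b * (a * b + ι (+ 88) * (E * F)) - ι (+ 20) * (a * b * F) - ι (+ 216) * (E * (F * F)))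
      S₀-at-O a E b F = solve (a ∷ E ∷ b ∷ F ∷ []) (λ a E b F → :S₀ a E b F := a :* F :* (a :* b :+ # 88 :* (E :* F)) :+ E :* (b :* (a :* b :+ # 88 :* (E :* F)) :- # 20 :* (a :* b :* F) :- # 216 :* (E :* (F :* F)))) ≡.refl

      Π₀-at-O : ∀ a E b F → Π₀ a E b F ≈ a * b * (a * b) + E * F * (ι (+ 7744) * (E * F) - ι (+ 176) * (a * b) + ι (+ 432) * (a * F + b * E - ι (+ 10) * (E * F)))
      Π₀-at-O a E b F = solve (a ∷ E ∷ b ∷ F ∷ []) (λ a E b F → :Π₀ a E b F := a :* b :* (a :* b) :+ E :* F :* (# 7744 :* (E :* F) :- # 176 :* (a :* b) :+ # 432 :* (a :* F :+ b :* E :- # 10 :* (E :* F)))) ≡.refl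

      S₀-near-diagonal : ∀ a E b F → S₀ a E b F ≈ S₀ a E a E + ((b - a) * (a * a * F + ι (+ 88) * (E * E * F) - ι (+ 20) * (a * E * F) + a * E * (a + b))
        + (F - E) * (a * a * a + ι (+ 88) * (a * E * E) - ι (+ 20) * (a * a * E) + (ι (+ 88) * (a * E) - ι (+ 216) * (E * E)) * (F + E)))
      S₀-near-diagonal a E b F = solve (a ∷ E ∷ b ∷ F ∷ []) (λ a E b F → :S₀ a E b F :=
        :S₀ a E a E :+ ((b :- a) :* (a :* a :* F :+ # 88 :* (E :* E :* F) :- # 20 :* (a :* E :* F) :+ a :* E :* (a :+ b))
          :+ (F :- E) :* (a :* a :* a :+ # 88 :* (a :* E :* E) :- # 20 :* (a :* a :* E) :+ (# 88 :* (a :* E) :- # 216 :* (E :* E)) :* (F :+ E)))) ≡.refl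

      cubic-scale₁ : ∀ p h d → cubicE (p * h) (p * d * (p * d)) ≈
        p * (p * (p * (h * h * h + p * scaled-rest p h d)))
      cubic-scale₁ p h d = solve (p ∷ h ∷ d ∷ []) (λ p h d → :cubicE (p :* h) (p :* d :* (p :* d)) :=
        p :* (p :* (p :* (h :* h :* h :+ p :* (# 88 :* (p :* h :* (d :* d :* (d :* d))) :- # 10 :* (h :* h :* (d :* d)) :- # 108 :* (p :* p :* (d :* d :* (d :* d) :* (d :* d)))))))) ≡.refl

      cubic-scale₂ : ∀ p h d → cubicE (p * (p * h)) (p * d * (p * d)) ≈ p * (p * (p * (p * (p * (p * cubicE h (d * d))))))
      cubic-scale₂ p h d = solve (p ∷ h ∷ d ∷ []) (λ p h d → :cubicE (p :* (p :* h)) (p :* d :* (p :* d)) := p :* (p :* (p :* (p :* (p :* (p :* :cubicE h (d :* d))))))) ≡.refl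

-- Points of G near O at 2, 3 and 19: the numerator is not a cube

module CubesOnG where

  open PolynomialIdentities
  open PrimeDivisibility
  open ConcordantForms using (no-concordant; concordant; prime[2])
  open NormCubes using (norm-cube⇒cube; Odd; cubeRe)
  open Quartics using (module Quartic; module GroupLaw)
  open import Data.Nat.Base as ℕ using (ℕ; suc)
  import Data.Nat.Properties as ℕ
  import Data.Nat.Divisibility as ℕ
  open import Data.Nat.Coprimality using (Coprime; coprime-Bézout)
  open import Data.Nat.GCD using (module Bézout)
  open import Data.Nat.Induction using (<-rec)
  open import Data.Nat.Primality using (Prime; prime⇒nonZero; prime⇒nonTrivial)
  open import Data.Nat.Primality.Factorisation using (factorise)
  open import Data.Nat.ListAction using (product)
  open import Data.List.Base using ([]; _∷_)
  open import Data.List.Relation.Unary.All using ([]; _∷_)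
  open import Data.Integer.Base hiding (suc)
  open import Data.Integer.Properties
  open import Data.Integer.Divisibility.Signed renaming (_∣_ to _∣ˢ_)
  open import Data.Product.Base using (∃; ∃₂; _×_; _,_; proj₁; proj₂)
  open import Data.Sum.Base using (_⊎_; inj₁; inj₂; [_,_]′)
  open import Data.Empty using (⊥; ⊥-elim)
  open import Data.Vec.Base using ([]; _∷_)
  open import Relation.Nullary
  open import Relation.Nullary.Decidable using (from-no)
  open import Function.Base using (_∘_; id; case_of_)
  open import Relation.Binary.PropositionalEquality

  prime-factor : ∀ n → n ≢ 0 → n ≢ 1 → ∃ λ p → Prime p × p ℕ.∣ n
  prime-factor n n≢0 n≢1 with factorise n {{ℕ.≢-nonZero n≢0}}
  ... | record { factors = [] ; isFactorisation = eq } = ⊥-elim (n≢1 eq)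
  ... | record { factors = p ∷ ps ; isFactorisation = eq ; factorsPrime = pp ∷ _ } = p , pp , ℕ.divides (product ps) (trans eq (ℕ.*-comm p (product ps)))

  -- Encodes that the exponent of `q` in `a` is 1 or 2 modulo 3; `s` may contain further factors
  -- `q`.
  record Ramification (a : ℕ) : Set where
    field
      {q}       : ℕ
      q-prime   : Prime q
      s a′      : ℕ
      q∤a′      : ¬ q ℕ.∣ a′
      shape     : a ≡ s ℕ.* s ℕ.* s ℕ.* (q ℕ.* a′) ⊎ a ≡ s ℕ.* s ℕ.* s ℕ.* (q ℕ.* (q ℕ.* a′))

  -- A prime factor of exponent 1 or 2 is a witness; from any other the cube p³ is split off and
  -- moved into `b` or `s`.
  cube-or-ramified : ∀ a → a ≢ 0 → (∃ λ b → a ≡ b ℕ.* b ℕ.* b) ⊎ Ramification a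
  cube-or-ramified = <-rec _ go
    where
    go : ∀ a → (∀ {d} → d ℕ.< a → d ≢ 0 → (∃ λ b → d ≡ b ℕ.* b ℕ.* b) ⊎ Ramification d) →
         a ≢ 0 → (∃ λ b → a ≡ b ℕ.* b ℕ.* b) ⊎ Ramification a
    go a rec a≢0 with a ℕ.≟ 1
    ... | yes a≡1 = inj₁ (1 , a≡1)
    ... | no  a≢1 with prime-factor a a≢0 a≢1
    ...   | p , pp , ℕ.divides b refl with p ℕ.∣? b
    ...     | no  p∤b = inj₂ (record { q-prime = pp ; s = 1 ; a′ = b ; q∤a′ = p∤b ; shape = inj₁ (trans (ℕ.*-comm b p) (sym (ℕ.*-identityˡ _))) })
    ...     | yes (ℕ.divides c refl) with p ℕ.∣? c
    ...       | no  p∤c = inj₂ (record { q-prime = pp ; s = 1 ; a′ = c ; q∤a′ = p∤c ; shape = inj₂ (solveⁿ (p ∷ c ∷ []) (λ p c → c :* p :* p := # 1 :* # 1 :* # 1 :* (p :* (p :* c))) refl refl) })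
    ...       | yes (ℕ.divides d refl) = extend (rec d<a d≢0)
      where
      d≢0 : d ≢ 0
      d≢0 refl = a≢0 refl
      1<p : 1 ℕ.< p
      1<p = ℕ.nonTrivial⇒n>1 p {{prime⇒nonTrivial pp}}
      d<a : d ℕ.< d ℕ.* p ℕ.* p ℕ.* p
      d<a = subst (d ℕ.<_) (trans (sym (ℕ.*-assoc d p (p ℕ.* p))) (sym (ℕ.*-assoc (d ℕ.* p) p p)))
        (ℕ.m<m*n d (p ℕ.* (p ℕ.* p)) {{ℕ.≢-nonZero d≢0}} (ℕ.<-≤-trans 1<p (ℕ.m≤m*n p (p ℕ.* p) {{ℕ.m*n≢0 p p {{prime⇒nonZero pp}} {{prime⇒nonZero pp}}}})))
      extend : (∃ λ b → d ≡ b ℕ.* b ℕ.* b) ⊎ Ramification d → (∃ λ b → d ℕ.* p ℕ.* p ℕ.* p ≡ b ℕ.* b ℕ.* b) ⊎ Ramification (d ℕ.* p ℕ.* p ℕ.* p)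
      extend (inj₁ (b , refl)) = inj₁ (b ℕ.* p , solveⁿ (p ∷ b ∷ []) (λ p b → b :* b :* b :* p :* p :* p := b :* p :* (b :* p) :* (b :* p)) refl refl)
      extend (inj₂ R) = inj₂ (record { q-prime = R.q-prime ; s = R.s ℕ.* p ; a′ = R.a′ ; q∤a′ = R.q∤a′ ; shape = case R.shape of λ
        { (inj₁ e) → inj₁ (trans (cong (λ d → d ℕ.* p ℕ.* p ℕ.* p) e) (solveⁿ (p ∷ R.s ∷ R.q ∷ R.a′ ∷ []) (λ p s q a → s :* s :* s :* (q :* a) :* p :* p :* p := s :* p :* (s :* p) :* (s :* p) :* (q :* a)) refl refl))
        ; (inj₂ e) → inj₂ (trans (cong (λ d → d ℕ.* p ℕ.* p ℕ.* p) e) (solveⁿ (p ∷ R.s ∷ R.q ∷ R.a′ ∷ []) (λ p s q a → s :* s :* s :* (q :* (q :* a)) :* p :* p :* p := s :* p :* (s :* p) :* (s :* p) :* (q :* (q :* a))) refl refl)) } })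
        where module R = Ramification R

  -- The integer constants of the generic identities appear here as id (+ k).
  module G = GroupLaw +-*-commutativeRing id id-isRingHomomorphism

  cubic : ℤ → ℤ → ℤ
  cubic a e = G.cubicE a (e * e)

  :cubic : ∀ {n} → Expr n → Expr n → Expr n
  :cubic a e = a :* a :* a :- # 10 :* (a :* a :* (e :* e)) :+ # 88 :* (a :* (e :* e :* (e :* e))) :- # 108 :* (e :* e :* (e :* e) :* (e :* e))

  CoprimeTo : ℤ → ℤ → Set
  CoprimeTo x y = ∀ {p} → Prime p → + p ∣ˢ x → ¬ + p ∣ˢ y

  record Point : Set where
    field
      a e n    : ℤ
      curve    : n * n ≡ cubic a e
      coprime  : CoprimeTo a e
      e≢0      : e ≢ 0ℤ

  bézout : ∀ k w → CoprimeTo k (+ w) → w ≢ 0 → ∃₂ λ x y → k * x + + w * y ≡ 1ℤ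
  bézout k w k⊥w w≢0 = signed k (identity (coprime-Bézout coprime))
    where
    coprime : Coprime ∣ k ∣ w
    coprime {d} (d∣k , d∣w) with d ℕ.≟ 1
    ... | yes d≡1 = d≡1
    ... | no  d≢1 with prime-factor d (λ { refl → w≢0 (ℕ.0∣⇒≡0 d∣w) }) d≢1
    ...   | p , pp , p∣d = ⊥-elim (k⊥w pp (∣ᵤ⇒∣ (ℕ.∣-trans p∣d d∣k)) (∣ᵤ⇒∣ (ℕ.∣-trans p∣d d∣w)))
    identity : Bézout.Identity 1 ∣ k ∣ w → ∃₂ λ x y → + ∣ k ∣ * x + + w * y ≡ 1ℤ
    identity (Bézout.+- x y eq) = + x , - + y , solve₁ (+ ∣ k ∣ ∷ + w ∷ + x ∷ + y ∷ []) (λ k w x y →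
      (k :* x :+ w :* :- y := # 1) , :- # 1 , (# 1 :+ y :* w := x :* k)) refl
      (trans (cong (_+_ 1ℤ) (sym (pos-* y w))) (trans (cong +_ eq) (pos-* x (∣ k ∣))))
    identity (Bézout.-+ x y eq) = - + x , + y , solve₁ (+ ∣ k ∣ ∷ + w ∷ + x ∷ + y ∷ []) (λ k w x y →
      (k :* :- x :+ w :* y := # 1) , :- # 1 , (# 1 :+ x :* k := y :* w)) refl
      (trans (cong (_+_ 1ℤ) (sym (pos-* x (∣ k ∣)))) (trans (cong +_ eq) (pos-* y w)))
    signed : ∀ k → (∃₂ λ x y → + ∣ k ∣ * x + + w * y ≡ 1ℤ) → ∃₂ λ x y → k * x + + w * y ≡ 1ℤ
    signed (+ n)    h           = h
    signed -[1+ n ] (x , y , e) = - x , y , trans (cong (_+ + w * y) (trans (sym (neg-distribʳ-* -[1+ n ] x)) (neg-distribˡ-* -[1+ n ] x))) e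

  positive-root : ∀ W m → W * W * W ≡ + m → ∃ λ w → W ≡ + w
  positive-root (+ w)    m e = w , refl
  positive-root -[1+ w ] m ()

  *-≢0 : ∀ {x y} → x ≢ 0ℤ → y ≢ 0ℤ → x * y ≢ 0ℤ
  *-≢0 {x} {y} h h′ e = [ h , h′ ]′ (i*j≡0⇒i≡0∨j≡0 x e)

  square≥0 : ∀ x → ∃ λ m → x * x ≡ + m
  square≥0 (+ n)    = _ , sym (pos-* n n)
  square≥0 -[1+ n ] = _ , refl

  module _ where
    private
      module E = Quartic +-*-commutativeRing id id-isRingHomomorphism

      abstract
        odd* : ∀ x y → ¬ + 2 ∣ˢ x → ¬ + 2 ∣ˢ y → ¬ + 2 ∣ˢ x * y
        odd* x y h h′ d = [ h , h′ ]′ (prime-∣* prime[2] {x} {y} d)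

        odd+even : ∀ x k y → ¬ + 2 ∣ˢ x → ¬ + 2 ∣ˢ x + + (2 ℕ.* k) * y
        odd+even x k y h d = h (∣m+n∣n⇒∣m {m = x} {+ (2 ℕ.* k) * y} d (∣m⇒∣m*n {m = + (2 ℕ.* k)} y (∣ᵤ⇒∣ (ℕ.m∣m*n k))))

        odd-even : ∀ x k y → ¬ + 2 ∣ˢ x → ¬ + 2 ∣ˢ x - + (2 ℕ.* k) * y
        odd-even x k y h d = h (∣m+n∣n⇒∣m {m = x} {n = - (+ (2 ℕ.* k) * y)} d (∣m⇒∣-m {m = + (2 ℕ.* k) * y} (∣m⇒∣m*n {m = + (2 ℕ.* k)} y (∣ᵤ⇒∣ (ℕ.m∣m*n k)))))

        odd⇒≢0 : ∀ {x} → ¬ + 2 ∣ˢ x → x ≢ 0ℤ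
        odd⇒≢0 h refl = h (divides 0ℤ refl)

        2∤9 : ¬ + 2 ∣ˢ + 9
        2∤9 d = from-no (2 ℕ.∣? 9) (∣⇒∣ᵤ d)

        ξ₀-odd : ∀ X a e → + 2 ∣ˢ X → ¬ + 2 ∣ˢ a → ¬ + 2 ∣ˢ E.ξ₀ X a e
        ξ₀-odd X a e 2∣X 2∤a = odd-even ((X + a) * (X + a)) 18 (a * (e * e)) (odd* (X + a) (X + a) X+a X+a)
          where
          X+a : ¬ + 2 ∣ˢ X + a
          X+a d = 2∤a (∣m+n∣m⇒∣n {m = X} d 2∣X)

        ξ-odd : ∀ x a → ¬ + 2 ∣ˢ x → ¬ + 2 ∣ˢ a → ¬ + 2 ∣ˢ + 9 * (a * a * x)
        ξ-odd x a 2∤x 2∤a = odd* (+ 9) (a * a * x) 2∤9 (odd* (a * a) x (odd* a a 2∤a 2∤a) 2∤x)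

        η≢0 : ∀ a e → a ≢ 0ℤ → e ≢ 0ℤ → + 9 * (a * (e * e)) ≢ 0ℤ
        η≢0 a e a≢0 e≢0 = *-≢0 {+ 9} (λ ()) (*-≢0 {a} a≢0 (*-≢0 {e} e≢0 e≢0))

        ζ≢0 : ∀ x a y → ¬ + 2 ∣ˢ x → ¬ + 2 ∣ˢ a → - (+ 9 * (a * a * (x * (x + + 18 * y)))) ≢ 0ℤ
        ζ≢0 x a y 2∤x 2∤a eq = odd⇒≢0 (ξ-odd (x * (x + + 18 * y)) a (odd* x (x + + 18 * y) 2∤x (odd+even x 9 y 2∤x)) 2∤a) (neg-injective {j = 0ℤ} eq)

        r-odd : ∀ ξ η ζ → ¬ + 2 ∣ˢ ξ → ¬ + 2 ∣ˢ E.rᶜ ξ η ζ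
        r-odd ξ η ζ 2∤ξ = odd-even (ξ * ξ) 32 (η * η * (η * η)) (odd* ξ ξ 2∤ξ 2∤ξ)

        abs² : ∀ x → + (∣ x ∣ ℕ.* ∣ x ∣) ≡ x * x
        abs² (+ n)    = pos-* n n
        abs² -[1+ n ] = refl

        -- Doubling the point makes r² + w² and r² + 4 w² squares with r odd and w = 4 η ζ nonzero,
        -- against the descent.
        no-odd-point : ∀ ξ η ζ → E.OnCurve ξ η ζ → ¬ + 2 ∣ˢ ξ → η ≢ 0ℤ → ζ ≢ 0ℤ → ⊥
        no-odd-point ξ η ζ c 2∤ξ η≢0 ζ≢0 = absurd (E.rᶜ ξ η ζ) (E.wᶜ ξ η ζ) (E.sᶜ ξ η ζ) (E.uᶜ ξ η ζ)
          (r-odd ξ η ζ 2∤ξ) (*-≢0 {+ 4} {η * ζ} (λ ()) (*-≢0 {η} {ζ} η≢0 ζ≢0)) (E.r²+w²≈s² ξ η ζ c) (E.r²+4w²≈u² ξ η ζ c)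
          where
          absurd : ∀ r s v u → ¬ + 2 ∣ˢ r → s ≢ 0ℤ → r * r + s * s ≡ v * v → r * r + + 4 * (s * s) ≡ u * u → ⊥
          absurd r s v u 2∤r s≢0 e e′ = no-concordant {∣ r ∣} {∣ s ∣} (λ d → 2∤r (∣ᵤ⇒∣ d)) (ℕ.≢-nonZero (λ h → s≢0 (∣i∣≡0⇒i≡0 h)))
            (concordant (∣ v ∣) (∣ u ∣)
              (+-injective (trans (cong₂ _+_ (abs² r) (abs² s)) (trans e (sym (abs² v)))))
              (+-injective (trans (cong₂ _+_ (abs² r) (trans (pos-* 4 (∣ s ∣ ℕ.* ∣ s ∣)) (cong (λ x → + 4 * x) (abs² s)))) (trans e′ (sym (abs² u))))))

    abstract
      -- An integral root gives a rational point of the curve. As X + a is odd, its ξ is odd, and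
      -- its ζ is odd and therefore nonzero.
      no-even-root : ∀ X a e → X * X * X ≡ + 3 * (a * (a + + 12 * (e * e)) * X) + + 2 * (a * (a * a - + 36 * (a * (e * e)) + + 108 * (e * e * (e * e)))) →
                     + 2 ∣ˢ X → ¬ + 2 ∣ˢ a → e ≢ 0ℤ → ⊥
      no-even-root X a e root 2∣X 2∤a e≢0 = no-odd-point (E.ξᶜ X a e) (E.ηᶜ X a e) (E.ζᶜ X a e) (E.onCurve X a e root)
        (ξ-odd (E.ξ₀ X a e) a odd-ξ₀ 2∤a) (η≢0 a e (odd⇒≢0 2∤a) e≢0) (ζ≢0 (E.ξ₀ X a e) a (a * (e * e)) odd-ξ₀ 2∤a)
        where
        odd-ξ₀ : ¬ + 2 ∣ˢ E.ξ₀ X a e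
        odd-ξ₀ = ξ₀-odd X a e 2∣X 2∤a

  -- K = ℚ[X] / (X³ - 3 N X - 2 A)
  module Cubic (a e n : ℤ) where
    N P A k : ℤ
    N = a * (a + + 12 * (e * e))
    P = a * a - + 36 * (a * (e * e)) + + 108 * (e * e * (e * e))
    A = a * P
    k = + 6 * (e * n)

  ∣*-∣² : ∀ {i} x y z → i ∣ˢ x → i ∣ˢ z → i ∣ˢ x * y - z * z
  ∣*-∣² x y z i∣x i∣z = ∣m∣n⇒∣m-n (∣m⇒∣m*n y i∣x) (∣m⇒∣m*n z i∣z)

  abstract
    -- The constants are 108 = 2² · 3³ and, in `cubic-mod-t`, 4332 = 2² · 3 · 19²: a common prime of
    -- n and a, or of n and a + 12 e², divides 114 or e.
    cubic-mod-a : ∀ a e n → n * n ≡ cubic a e → a * (a * a - + 10 * (a * (e * e)) + + 88 * (e * e * (e * e))) - n * n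
      ≡ + 108 * (e * e * (e * e) * (e * e))
    cubic-mod-a a e n = solve₁ (a ∷ e ∷ n ∷ []) (λ a e n →
      (a :* (a :* a :- # 10 :* (a :* (e :* e)) :+ # 88 :* (e :* e :* (e :* e))) :- n :* n :=
        # 108 :* (e :* e :* (e :* e) :* (e :* e))) ,
      :- # 1 , (n :* n := :cubic a e)) refl

    cubic-mod-t : ∀ a e n → n * n ≡ cubic a e → (a + + 12 * (e * e)) * (a * a - + 22 * (a * (e * e)) + + 352 * (e * e * (e * e))) - n * n
      ≡ + 4332 * (e * e * (e * e) * (e * e))
    cubic-mod-t a e n = solve₁ (a ∷ e ∷ n ∷ []) (λ a e n →
      ((a :+ # 12 :* (e :* e)) :* (a :* a :- # 22 :* (a :* (e :* e)) :+ # 352 :* (e :* e :* (e :* e))) :- n :* n :=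
        # 4332 :* (e :* e :* (e :* e) :* (e :* e))) ,
      :- # 1 , (n :* n := :cubic a e)) refl

  module NotACube (S : Point) (2∣e : + 2 ∣ˢ Point.e S) (3∣e : + 3 ∣ˢ Point.e S) (19∣e : + 19 ∣ˢ Point.e S)
                  (b : ℤ) (a≡b³ : Point.a S ≡ b * b * b) where
    open Point S
    open Cubic a e n

    private
      t W : ℤ
      t = a + + 12 * (e * e)
      W = b * t

      abstract
        -- N³ = A² + 3 C² divided by a² reads a t³ = P² + 3 k², and a = b³.
        norm : P * P + + 3 * (k * k) ≡ W * W * W
        norm = solve₂ (a ∷ e ∷ n ∷ b ∷ []) (λ a e n b →
          ((a :* a :- # 36 :* (a :* (e :* e)) :+ # 108 :* (e :* e :* (e :* e))) :* (a :* a :- # 36 :* (a :* (e :* e)) :+ # 108 :* (e :* e :* (e :* e)))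
            :+ # 3 :* (# 6 :* (e :* n) :* (# 6 :* (e :* n))) := b :* (a :+ # 12 :* (e :* e)) :* (b :* (a :+ # 12 :* (e :* e))) :* (b :* (a :+ # 12 :* (e :* e)))) ,
          (# 108 :* (e :* e) , (n :* n := :cubic a e)) ,
          (a :+ # 12 :* (e :* e)) :* (a :+ # 12 :* (e :* e)) :* (a :+ # 12 :* (e :* e)) , (a := b :* b :* b)) refl curve a≡b³

      naturalW : ∃ λ w → W ≡ + w
      naturalW with square≥0 P | square≥0 k
      ... | x , P²≡ | y , k²≡ = positive-root W (x ℕ.+ 3 ℕ.* y) (trans (sym norm) (cong₂ _+_ P²≡ (trans (cong (+ 3 *_) k²≡) (sym (pos-* 3 y)))))

      w : ℕ
      w = proj₁ naturalW
      W≡ : W ≡ + w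
      W≡ = proj₂ naturalW

      module _ {p : ℕ} (pp : Prime p) where
        b⇒a : + p ∣ˢ b → + p ∣ˢ a
        b⇒a h = subst (+ p ∣ˢ_) (sym a≡b³) (∣n⇒∣m*n (b * b) h)
        2⇒e : + p ∣ˢ + 2 → + p ∣ˢ e
        2⇒e h = ∣-trans h 2∣e
        3⇒e : + p ∣ˢ + 3 → + p ∣ˢ e
        3⇒e h = ∣-trans h 3∣e
        19⇒e : + p ∣ˢ + 19 → + p ∣ˢ e
        19⇒e h = ∣-trans h 19∣e

        4⇒e : + p ∣ˢ + 4 → + p ∣ˢ e
        4⇒e d = 2⇒e (prime-∣² pp {+ 2} d)

        108⇒e : + p ∣ˢ + 108 → + p ∣ˢ e
        108⇒e d = [ 4⇒e , (λ d → 3⇒e (prime-∣³ pp {+ 3} d)) ]′ (prime-∣* pp {+ 4} {+ 27} d)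

        4332⇒e : + p ∣ˢ + 4332 → + p ∣ˢ e
        4332⇒e d = [ (λ d → [ 4⇒e , 3⇒e ]′ (prime-∣* pp {+ 4} {+ 3} d)) , (λ d → 19⇒e (prime-∣² pp {+ 19} d)) ]′ (prime-∣* pp {+ 12} {+ 361} d)

        e⁶⇒e : + p ∣ˢ e * e * (e * e) * (e * e) → + p ∣ˢ e
        e⁶⇒e d = prime-∣² pp (prime-∣³ pp {e * e} d)

        -- modulo n, the cubic is a unit at the zeros of a and of t
        na⇒e : + p ∣ˢ n → + p ∣ˢ a → + p ∣ˢ e
        na⇒e p∣n p∣a = [ 108⇒e , e⁶⇒e ]′ (prime-∣* pp {+ 108} {e * e * (e * e) * (e * e)}
          (subst (+ p ∣ˢ_) (cubic-mod-a a e n curve) (∣*-∣² a (a * a - + 10 * (a * (e * e)) + + 88 * (e * e * (e * e))) n p∣a p∣n)))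

        nt⇒e : + p ∣ˢ n → + p ∣ˢ t → + p ∣ˢ e
        nt⇒e p∣n p∣t = [ 4332⇒e , e⁶⇒e ]′ (prime-∣* pp {+ 4332} {e * e * (e * e) * (e * e)}
          (subst (+ p ∣ˢ_) (cubic-mod-t a e n curve) (∣*-∣² t (a * a - + 22 * (a * (e * e)) + + 352 * (e * e * (e * e))) n p∣t p∣n)))

        et⇒a : + p ∣ˢ e → + p ∣ˢ t → + p ∣ˢ a
        et⇒a p∣e p∣t = ∣m+n∣n⇒∣m p∣t (∣n⇒∣m*n (+ 12) (∣n⇒∣m*n e p∣e))

        t⊥e : + p ∣ˢ t → ¬ + p ∣ˢ e
        t⊥e p∣t p∣e = coprime pp (et⇒a p∣e p∣t) p∣e

        b⊥e : + p ∣ˢ b → ¬ + p ∣ˢ e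
        b⊥e p∣b p∣e = coprime pp (b⇒a p∣b) p∣e

        W⊥e : + p ∣ˢ W → ¬ + p ∣ˢ e
        W⊥e p∣W p∣e = [ (λ p∣b → b⊥e p∣b p∣e) , (λ p∣t → t⊥e p∣t p∣e) ]′ (prime-∣* pp p∣W)

        W⊥n : + p ∣ˢ W → ¬ + p ∣ˢ n
        W⊥n p∣W p∣n = [ (λ p∣b → b⊥e p∣b (na⇒e p∣n (b⇒a p∣b))) , (λ p∣t → t⊥e p∣t (nt⇒e p∣n p∣t)) ]′ (prime-∣* pp p∣W)

        -- Makes k invertible modulo W³, as Euler's lemma requires. The factors 2, 3 and e of k are
        -- harmless because W is prime to e; the factor n is handled by the two eliminations.
        k⊥W : + p ∣ˢ k → ¬ + p ∣ˢ W
        k⊥W p∣k p∣W = [ W⊥e p∣W ∘ (λ p∣6 → [ 2⇒e , 3⇒e ]′ (prime-∣* pp {+ 2} {+ 3} p∣6)) , (λ p∣en → [ W⊥e p∣W , W⊥n p∣W ]′ (prime-∣* pp p∣en)) ]′ (prime-∣* pp {+ 6} p∣k)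

      odd-w : Odd w
      odd-w 2∣w = W⊥e prime[2] (subst (+ 2 ∣ˢ_) (sym W≡) (∣ᵤ⇒∣ 2∣w)) 2∣e

      W³ : + w * + w * + w ≡ + (w ℕ.* w ℕ.* w)
      W³ = trans (cong (_* + w) (sym (pos-* w w))) (sym (pos-* (w ℕ.* w) w))

      w≢0 : w ℕ.* w ℕ.* w ≢ 0
      w≢0 eq = [ [ no-w , no-w ]′ ∘ ℕ.m*n≡0⇒m≡0∨n≡0 w , no-w ]′ (ℕ.m*n≡0⇒m≡0∨n≡0 (w ℕ.* w) eq)
        where
        no-w : ¬ w ≡ 0
        no-w w≡0 = odd-w (subst (2 ℕ.∣_) (sym w≡0) (2 ℕ.∣0))

      bz : ∃₂ λ x y → k * x + + (w ℕ.* w ℕ.* w) * y ≡ 1ℤ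
      bz = bézout k (w ℕ.* w ℕ.* w) (λ {p} pp p∣k p∣w³ → k⊥W pp p∣k (subst (+ p ∣ˢ_) (sym W≡) (prime-∣³ pp (subst (+ p ∣ˢ_) (sym W³) p∣w³)))) w≢0

      euler : ∃₂ λ g h → g * g + + 3 * (h * h) ≡ + w × P ≡ cubeRe g h
      euler = norm-cube⇒cube {P} {k} {w} odd-w (trans norm (cong (λ W → W * W * W) W≡)) {proj₁ bz} {proj₁ (proj₂ bz)}
        (trans (cong (λ z → k * proj₁ bz + z * proj₁ (proj₂ bz)) W³) (proj₂ (proj₂ bz)))

      g h X : ℤ
      g = proj₁ euler
      h = proj₁ (proj₂ euler)
      -- Cardano's formula: up to the sign of h, the cube roots of A ± C √-3 are b (g ± h √-3), and
      -- X is their sum.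
      X = + 2 * (g * b)

      abstract
        root : X * X * X ≡ + 3 * (a * (a + + 12 * (e * e)) * X) + + 2 * (a * P)
        root = solve-root a t P g h b a≡b³ (trans (proj₁ (proj₂ (proj₂ euler))) (sym W≡)) (proj₂ (proj₂ (proj₂ euler)))
          where
          solve-root : ∀ a t P g h b → a ≡ b * b * b → g * g + + 3 * (h * h) ≡ b * t → P ≡ cubeRe g h →
                       + 2 * (g * b) * (+ 2 * (g * b)) * (+ 2 * (g * b)) ≡ + 3 * (a * t * (+ 2 * (g * b))) + + 2 * (a * P)
          solve-root a t P g h b refl e refl = solve₁ (t ∷ g ∷ h ∷ b ∷ []) (λ t g h b →
            (# 2 :* (g :* b) :* (# 2 :* (g :* b)) :* (# 2 :* (g :* b)) := # 3 :* (b :* b :* b :* t :* (# 2 :* (g :* b))) :+ # 2 :* (b :* b :* b :* (g :* g :* g :- # 9 :* (g :* (h :* h))))) ,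
            # 6 :* (b :* b :* b :* g) , (g :* g :+ # 3 :* (h :* h) := b :* t)) refl e

      2∣X : + 2 ∣ˢ X
      2∣X = divides (g * b) (*-comm (+ 2) (g * b))

    not-a-cube : ⊥
    not-a-cube = no-even-root X a e root 2∣X (λ 2∣a → coprime prime[2] 2∣a 2∣e) e≢0

-- The doubling sequence on G, congruent points and lowest terms

module GroupLawOnG where

  open PolynomialIdentities
  open PrimeDivisibility
  open ConcordantForms using (prime[2])
  open CubesOnG using (module G; cubic; Point; CoprimeTo; *-≢0; prime-factor)
  open import Data.Nat.Base as ℕ using (ℕ; zero; suc)
  import Data.Nat.Properties as ℕ
  import Data.Nat.Divisibility as ℕ
  open import Data.Nat.GCD using (gcd; gcd[m,n]∣m; gcd[m,n]∣n; gcd-greatest)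
  open import Data.Nat.Induction using (<-wellFounded)
  open import Induction.WellFounded using (Acc; acc)
  open import Data.Nat.Primality using (Prime; prime⇒nonTrivial)
  open import Data.Fin.Base as Fin using (Fin; combine)
  import Data.Fin.Properties as Fin
  open import Data.Integer.Base hiding (suc)
  open import Data.Integer.DivMod using (_%ℕ_; _/ℕ_; n%ℕd<d; a≡a%ℕn+[a/ℕn]*n)
  open import Data.Integer.Properties
  open import Data.Integer.Divisibility.Signed renaming (_∣_ to _∣ˢ_)
  open import Data.Product.Base using (∃; ∃₂; _×_; _,_; proj₁; proj₂)
  open import Data.Sum.Base using (_⊎_; inj₁; inj₂; [_,_]′)
  open import Data.Vec.Base using (Vec; []; _∷_)
  open import Data.Vec.Relation.Binary.Pointwise.Inductive as Pointwise using ([]; _∷_)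
  open import Relation.Nullary
  open import Function.Base using (id)
  open import Relation.Binary.PropositionalEquality

  ∣-* : ∀ {i} x y → i ∣ˢ x → i ∣ˢ x * y
  ∣-* x y = ∣m⇒∣m*n {m = x} y

  *-∣ : ∀ {i} x y → i ∣ˢ y → i ∣ˢ x * y
  *-∣ x y = ∣n⇒∣m*n x {y}

  ∣-+ : ∀ {i} x y → i ∣ˢ x → i ∣ˢ y → i ∣ˢ x + y
  ∣-+ x y = ∣m∣n⇒∣m+n {m = x} {n = y}

  ∣-- : ∀ {i} x y → i ∣ˢ x → i ∣ˢ y → i ∣ˢ x - y
  ∣-- x y = ∣m∣n⇒∣m-n {m = x} {n = y}

  ∣-+⁻ˡ : ∀ {i} x y → i ∣ˢ x + y → i ∣ˢ y → i ∣ˢ x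
  ∣-+⁻ˡ x y = ∣m+n∣n⇒∣m {m = x} {n = y}

  ∣-≡ : ∀ {i x y} → x ≡ y → i ∣ˢ x → i ∣ˢ y
  ∣-≡ {i} = subst (i ∣ˢ_)

  prime∤1 : ∀ {p} → Prime p → ¬ + p ∣ˢ 1ℤ
  prime∤1 {p} pp d = ℕ.<⇒≢ (ℕ.nonTrivial⇒n>1 p {{prime⇒nonTrivial pp}}) (sym (ℕ.∣1⇒≡1 (∣⇒∣ᵤ d)))

  -- A point in lowest terms near O at 2 and 3, and off the node modulo 19.
  record Good : Set where
    field
      a e n    : ℤ
      curve    : n * n ≡ cubic a e
      coprime  : CoprimeTo a e
      2∣e      : + 2 ∣ˢ e
      3∣e      : + 3 ∣ˢ e
      e≢0      : e ≢ 0ℤ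
      off-node : ∀ {p} → Prime p → + p ∣ˢ + 19 → ¬ + p ∣ˢ G.t₇ a (e * e)

  module Double (T : Good) where
    open Good T

    E a′ e′ n′ : ℤ
    E  = e * e
    a′ = G.doubleA a E
    e′ = + 2 * (e * n)
    n′ = G.doubleN a E

    abstract
      e′² : id (+ 4) * (E * G.cubicE a E) ≡ e′ * e′
      e′² = trans (cong (λ z → id (+ 4) * (E * z)) (sym curve)) (solve (e ∷ n ∷ []) (λ e n → # 4 :* (e :* e :* (n :* n)) := # 2 :* (e :* n) :* (# 2 :* (e :* n))) refl)

      curve′ : n′ * n′ ≡ cubic a′ e′
      curve′ = trans (G.double-curve a E) (cong (G.cubicE a′) e′²)

      module _ {p : ℕ} (pp : Prime p) where
        2⇒e : + p ∣ˢ + 2 → + p ∣ˢ e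
        2⇒e h = ∣-trans h 2∣e

        3⇒e : + p ∣ˢ + 3 → + p ∣ˢ e
        3⇒e h = ∣-trans h 3∣e

        E⇒e : + p ∣ˢ E → + p ∣ˢ e
        E⇒e h = prime-∣² pp {e} h

        n⇒cubic : + p ∣ˢ n → + p ∣ˢ G.cubicE a E
        n⇒cubic h = ∣-≡ curve (∣-* n n h)

        ¬e : + p ∣ˢ a′ → ¬ + p ∣ˢ e
        ¬e p∣a′ p∣e = coprime pp (prime-∣² pp {a} (prime-∣² pp {a * a}
          (∣-+⁻ˡ (a * a * (a * a)) (E * G.double-a⁴ a E) (∣-≡ (G.doubleA≈a⁴ a E) p∣a′) (∣-* E (G.double-a⁴ a E) (∣-* e e p∣e))))) p∣e

        -- At 19 the resultant gives no information. Off the node, n ≡ 0 forces a ≡ 15 E, and there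
        -- the numerator of the double is 27409 E⁴, a unit.
        ¬19 : + p ∣ˢ a′ → + p ∣ˢ n → ¬ + p ∣ˢ + 19
        ¬19 p∣a′ p∣n p∣19 = [ ¬27409 , (λ d → ¬e p∣a′ (E⇒e (prime-∣² pp {E} (prime-∣² pp {E * E} d)))) ]′ (prime-∣* pp {+ 27409} {G.E⁴ E} p∣15)
          where
          p∣a-15E : + p ∣ˢ G.t₁₅ a E
          p∣a-15E = prime-∣*ʳ pp {G.t₇ a E * G.t₇ a E} (λ d → off-node pp p∣19 (prime-∣² pp {G.t₇ a E} d))
            (∣-+⁻ˡ (G.t₇ a E * G.t₇ a E * G.t₁₅ a E) (id (+ 19) * (E * G.node a E)) (∣-≡ (G.cubic-mod-19 a E) (n⇒cubic p∣n)) (∣-* (id (+ 19)) (E * G.node a E) p∣19))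
          p∣15 : + p ∣ˢ + 27409 * G.E⁴ E
          p∣15 = ∣m+n∣m⇒∣n {m = G.t₁₅ a E * G.double15 a E} {n = + 27409 * G.E⁴ E} (∣-≡ (G.double-mod-15 a E) p∣a′) (∣-* (G.t₁₅ a E) (G.double15 a E) p∣a-15E)
          ¬27409 : ¬ + p ∣ˢ + 27409
          ¬27409 d = prime∤1 pp (∣-- (+ 27409 * + 7) (+ 19 * + 10098) (∣-* (+ 27409) (+ 7) d) (∣-* (+ 19) (+ 10098) p∣19))

        ¬n : + p ∣ˢ a′ → ¬ + p ∣ˢ n
        ¬n p∣a′ p∣n = [ ¬987696 , (λ d → ¬e p∣a′ (E⇒e (prime-∣³ pp {E} (prime-∣² pp {E * E * E} d)))) ]′
          (prime-∣* pp {+ 987696} {G.E⁶ E} (∣-≡ (G.resultant a E)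
            (∣-+ (G.resA a E * a′) (G.resN a E * G.cubicE a E) (*-∣ (G.resA a E) a′ p∣a′) (*-∣ (G.resN a E) (G.cubicE a E) (n⇒cubic p∣n)))))
          where
          ¬987696 : ¬ + p ∣ˢ + 987696
          ¬987696 d = [ (λ d → ¬e p∣a′ ([ (λ d → 2⇒e (prime-∣² pp {+ 2} (prime-∣² pp {+ 4} d))) , (λ d → 3⇒e (prime-∣² pp {+ 3} d)) ]′ (prime-∣* pp {+ 16} {+ 9} d)))
                      , (λ d → ¬19 p∣a′ p∣n (prime-∣³ pp {+ 19} d)) ]′ (prime-∣* pp {+ 144} {+ 6859} d)

      coprime′ : CoprimeTo a′ e′
      coprime′ pp p∣a′ p∣e′ = [ (λ d → ¬e pp p∣a′ (2⇒e pp d)) , (λ d → [ ¬e pp p∣a′ , ¬n pp p∣a′ ]′ (prime-∣* pp {e} {n} d)) ]′ (prime-∣* pp {+ 2} {e * n} p∣e′)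

      off-node′ : ∀ {p} → Prime p → + p ∣ˢ + 19 → ¬ + p ∣ˢ G.t₇ a′ (e′ * e′)
      off-node′ {p} pp p∣19 d = off-node pp p∣19 (prime-∣² pp {t} (prime-∣² pp {t * t}
        (∣-+⁻ˡ (t * t * (t * t)) (id (+ 19) * (E * E * G.node² a E)) (∣-≡ (trans (cong (G.t₇ a′) (sym e′²)) (G.double-mod-19 a E)) d) (∣-* (id (+ 19)) (E * E * G.node² a E) p∣19))))
        where
        t : ℤ
        t = G.t₇ a E

      n≢0 : n ≢ 0ℤ
      n≢0 n≡0 = coprime prime[2] (prime-∣³ prime[2] {a} (∣-+⁻ˡ (a * a * a) (E * G.cubic-a³ a E) (∣-≡ (G.cubic≈a³ a E) (n⇒cubic prime[2] (divides 0ℤ n≡0))) (∣-* E (G.cubic-a³ a E) (∣-* e e 2∣e)))) 2∣e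

      2∣e′ : + 2 ∣ˢ e′
      2∣e′ = ∣-* (+ 2) (e * n) ∣-refl

      3∣e′ : + 3 ∣ˢ e′
      3∣e′ = *-∣ (+ 2) (e * n) (∣-* e n 3∣e)

      e′≢0 : e′ ≢ 0ℤ
      e′≢0 = *-≢0 {+ 2} (λ ()) (*-≢0 {e} e≢0 n≢0)

    double : Good
    double = record { a = a′ ; e = e′ ; n = n′ ; curve = curve′ ; coprime = coprime′ ; 2∣e = 2∣e′ ; 3∣e = 3∣e′ ; e≢0 = e′≢0 ; off-node = off-node′ }

  open Double using (double)

  -- 24 times a generator: the multiples of 3 are off the node modulo 19, those of 8 are near O at 2 and 3.
  base : Good
  base = record
    { a = + 228922952657705814132289
    ; e = + 388598966892
    ; n = - + 142618188222728011007246389581192943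
    ; curve = refl
    -- The multipliers are Bézout coefficients for a and e; those in `off-node` belong to a - 7 e²
    -- and 19.
    ; coprime = λ pp p∣a p∣e → prime∤1 pp (∣-- (+ 228922952657705814132289 * + 98902438093) (+ 388598966892 * + 58263248444476564791353)
        (∣-* (+ 228922952657705814132289) (+ 98902438093) p∣a) (∣-* (+ 388598966892) (+ 58263248444476564791353) p∣e))
    ; 2∣e = divides (+ 194299483446) refl
    ; 3∣e = divides (+ 129532988964) refl
    ; e≢0 = λ ()
    ; off-node = λ pp p∣19 p∣x → prime∤1 pp (∣-- (- + 828141146829002170845359 * + 6) (+ 19 * - + 261518256893369106582745)
        (∣-* (- + 828141146829002170845359) (+ 6) p∣x) (∣-* (+ 19) (- + 261518256893369106582745) p∣19))
    }

  T : ℕ → Good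
  T zero    = base
  T (suc k) = double (T k)

  module T k = Good (T k)

  abstract
    -- Doubling multiplies e by 2 n.
    e∣e : ∀ {i j} → i ℕ.<′ j → ∃ λ m → T.e j ≡ T.e i * (T.n i * (+ 2 * m))
    e∣e {i} (ℕ.<′-base)       = 1ℤ , solve (T.e i ∷ T.n i ∷ []) (λ e n → # 2 :* (e :* n) := e :* (n :* (# 2 :* # 1))) refl
    e∣e {i} (ℕ.≤′-step {j} h) with e∣e h
    ... | m , e≡ = + 2 * (m * T.n j) , trans (cong (λ e → + 2 * (e * T.n j)) e≡)
      (solve (T.e i ∷ T.n i ∷ m ∷ T.n j ∷ []) (λ e n m l → # 2 :* (e :* (n :* (# 2 :* m)) :* l) := e :* (n :* (# 2 :* (# 2 :* (m :* l))))) refl)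

    -- The power of 2 in e grows along the sequence: equal x-coordinates would make `T.a j` a
    -- multiple of 4, although it is prime to the even number `T.e j`.
    x-coordinates-differ : ∀ {i j} → i ℕ.<′ j → G.D (T.a i) (T.e i * T.e i) (T.a j) (T.e j * T.e j) ≢ 0ℤ
    x-coordinates-differ {i} {j} h D≡0 with e∣e h
    ... | m , e≡ = T.coprime j prime[2] (divides (T.a i * (T.n i * m * (T.n i * m)) * + 2) b≡) (T.2∣e j)
      where
      e²≢0 : NonZero (T.e i * T.e i)
      e²≢0 = ≢-nonZero (*-≢0 {T.e i} (T.e≢0 i) (T.e≢0 i))
      b≡ : T.a j ≡ T.a i * (T.n i * m * (T.n i * m)) * + 2 * + 2
      b≡ = *-cancelˡ-≡ (T.e i * T.e i) _ _ {{e²≢0}} (solve₁ (T.a i ∷ T.e i ∷ T.n i ∷ m ∷ T.a j ∷ []) (λ a e n m b →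
        (e :* e :* b := e :* e :* (a :* (n :* m :* (n :* m)) :* # 2 :* # 2)) , :- # 1 ,
        (a :* (e :* (n :* (# 2 :* m)) :* (e :* (n :* (# 2 :* m)))) :- b :* (e :* e) := # 0)) refl
        (trans (cong (λ f → T.a i * (f * f) - T.a j * (T.e i * T.e i)) (sym e≡)) D≡0))

  module _ (M : ℕ) {{M≢0 : ℕ.NonZero M}} where

    private
      res : ℤ → Fin M
      res x = Fin.fromℕ< (n%ℕd<d x M)

      res-injective : ∀ x y → res x ≡ res y → + M ∣ˢ x - y
      res-injective x y eq = divides (x /ℕ M - y /ℕ M) (trans
        (cong₂ _-_ (a≡a%ℕn+[a/ℕn]*n x M) (trans (a≡a%ℕn+[a/ℕn]*n y M) (cong (λ r → + r + (y /ℕ M) * + M)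
          (sym (Fin.fromℕ<-injective _ _ (n%ℕd<d x M) (n%ℕd<d y M) eq)))))
        (solve (+ (x %ℕ M) ∷ x /ℕ M ∷ y /ℕ M ∷ + M ∷ []) (λ r s t m → r :+ s :* m :- (r :+ t :* m) := (s :- t) :* m) refl))

      state : ℕ → Fin (M ℕ.* (M ℕ.* M))
      state k = combine (res (T.a k)) (combine (res (T.e k)) (res (T.n k)))

    abstract
      congruent-points : ∃₂ λ i j → i ℕ.< j × (+ M ∣ˢ T.a i - T.a j) × (+ M ∣ˢ T.e i - T.e j) × (+ M ∣ˢ T.n i - T.n j)
      congruent-points = congruences (Fin.pigeonhole {M ℕ.* (M ℕ.* M)} {suc (M ℕ.* (M ℕ.* M))} (ℕ.n<1+n _) (λ k → state (Fin.toℕ k)))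
        where
        split : ∀ i j → state i ≡ state j → i ℕ.< j → (+ M ∣ˢ T.a i - T.a j) × (+ M ∣ˢ T.e i - T.e j) × (+ M ∣ˢ T.n i - T.n j)
        split i j eq i<j with Fin.combine-injective (res (T.a i)) (combine (res (T.e i)) (res (T.n i))) (res (T.a j)) (combine (res (T.e j)) (res (T.n j))) eq
        ... | eqₐ , eq′ with Fin.combine-injective (res (T.e i)) (res (T.n i)) (res (T.e j)) (res (T.n j)) eq′
        ...   | eqₑ , eqₙ = res-injective (T.a i) (T.a j) eqₐ , res-injective (T.e i) (T.e j) eqₑ , res-injective (T.n i) (T.n j) eqₙ

        congruences : (∃₂ λ (i j : Fin (suc (M ℕ.* (M ℕ.* M)))) → i Fin.< j × state (Fin.toℕ i) ≡ state (Fin.toℕ j)) →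
                      ∃₂ λ i j → i ℕ.< j × (+ M ∣ˢ T.a i - T.a j) × (+ M ∣ˢ T.e i - T.e j) × (+ M ∣ˢ T.n i - T.n j)
        congruences (i , j , i<j , eq) = Fin.toℕ i , Fin.toℕ j , i<j , split (Fin.toℕ i) (Fin.toℕ j) eq i<j

  abstract
    cubic-scale₁ : ∀ p h d → G.cubicE (p * h) (p * d * (p * d)) ≡ p * (p * (p * (h * h * h + p * G.scaled-rest p h d)))
    cubic-scale₁ = G.cubic-scale₁

    cubic-scale₂ : ∀ p h d → G.cubicE (p * (p * h)) (p * d * (p * d)) ≡ p * (p * (p * (p * (p * (p * G.cubicE h (d * d))))))
    cubic-scale₂ = G.cubic-scale₂

    quotient′ : ∀ {p x} → p ∣ˢ x → ∃ λ y → x ≡ p * y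
    quotient′ {p} (divides y e) = y , trans e (*-comm y p)

  module Descend {p : ℕ} (pp : Prime p) where

    private
      P : ℤ
      P = + p

      multiple : ∀ {x} y → x ≡ P * y → P ∣ˢ x
      multiple y e = divides y (trans e (*-comm P y))

      square : ∀ j → P * j * (P * j) ≡ P * (P * (j * j))
      square j = solve (P ∷ j ∷ []) (λ p j → p :* j :* (p :* j) := p :* (p :* (j :* j))) refl

      cancel² : ∀ {x y} → P * (P * x) ≡ P * (P * y) → x ≡ y
      cancel² e = cancel-prime pp (cancel-prime pp e)

    abstract
      divide : ∀ {j x} → j * j ≡ P * x → ∃ λ k → j ≡ P * k
      divide {j} {x} e = quotient′ (prime-∣² pp {j} (multiple x e))

      divide² : ∀ {j x} → j * j ≡ P * (P * x) → ∃ λ k → j ≡ P * k × k * k ≡ x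
      divide² {j} {x} e = next (divide {j} {P * x} e)
        where
        next : (∃ λ k → j ≡ P * k) → ∃ λ k → j ≡ P * k × k * k ≡ x
        next (k , j≡) = k , j≡ , cancel² (trans (sym (square k)) (trans (sym (cong (λ j → j * j) j≡)) e))

      -- The valuation of a square is even, so it cannot be exactly 3.
      divide³ : ∀ {j} h x → j * j ≡ P * (P * (P * (h * h * h + P * x))) → P ∣ˢ h
      divide³ {j} h x e = next (divide² {j} {P * (h * h * h + P * x)} e)
        where
        next′ : ∀ k → k * k ≡ P * (h * h * h + P * x) → (∃ λ l → k ≡ P * l) → P ∣ˢ h
        next′ k e (l , k≡) = prime-∣³ pp {h} (∣-+⁻ˡ (h * h * h) (P * x)
          (multiple (l * l) (cancel-prime pp (trans (sym e) (trans (cong (λ k → k * k) k≡) (square l))))) (∣-* P x ∣-refl))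
        next : (∃ λ k → j ≡ P * k × k * k ≡ P * (h * h * h + P * x)) → P ∣ˢ h
        next (k , _ , e) = next′ k e (divide {k} {h * h * h + P * x} e)

      divide⁶ : ∀ {j} x → j * j ≡ P * (P * (P * (P * (P * (P * x))))) → ∃ λ k → k * k ≡ x
      divide⁶ {j} x e = third (second (divide² {j} {P * (P * (P * (P * x)))} e))
        where
        second : (∃ λ k → j ≡ P * k × k * k ≡ P * (P * (P * (P * x)))) → ∃ λ k → k * k ≡ P * (P * x)
        second (k , _ , e) = proj₁ (divide² {k} {P * (P * x)} e) , proj₂ (proj₂ (divide² {k} {P * (P * x)} e))
        third : (∃ λ k → k * k ≡ P * (P * x)) → ∃ λ k → k * k ≡ x
        third (k , e) = proj₁ (divide² {k} {x} e) , proj₂ (proj₂ (divide² {k} {x} e))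

      -- If p divided H only once, the right-hand side would have the odd valuation 3. So p² divides
      -- H, the cubic is divisible by p⁶, and the fraction H / D² is cancelled without leaving G.
      divide-point : ∀ H D J → J * J ≡ G.cubicE H (D * D) → P ∣ˢ H → P ∣ˢ D →
                     ∃ λ h → ∃ λ d → ∃ λ j → H ≡ P * (P * h) × D ≡ P * d × j * j ≡ G.cubicE h (d * d)
      divide-point H D J e p∣H p∣D = first (quotient′ p∣H) (quotient′ p∣D)
        where
        second : ∀ h d → H ≡ P * h → D ≡ P * d → (∃ λ l → h ≡ P * l) → ∃ λ h → ∃ λ d → ∃ λ j → H ≡ P * (P * h) × D ≡ P * d × j * j ≡ G.cubicE h (d * d)
        second h d H≡ D≡ (l , h≡) = l , d , proj₁ root , trans H≡ (cong (P *_) h≡) , D≡ , proj₂ root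
          where
          root : ∃ λ j → j * j ≡ G.cubicE l (d * d)
          root = divide⁶ {J} (G.cubicE l (d * d)) (trans e (trans (cong₂ (λ H D → G.cubicE H (D * D)) (trans H≡ (cong (P *_) h≡)) D≡) (cubic-scale₂ P l d)))
        first : (∃ λ h → H ≡ P * h) → (∃ λ d → D ≡ P * d) → ∃ λ h → ∃ λ d → ∃ λ j → H ≡ P * (P * h) × D ≡ P * d × j * j ≡ G.cubicE h (d * d)
        first (h , H≡) (d , D≡) = second h d H≡ D≡ (quotient′ (divide³ {J} h (G.scaled-rest P h d)
          (trans e (trans (cong₂ (λ H D → G.cubicE H (D * D)) H≡ D≡) (cubic-scale₁ P h d)))))

    smaller : ∀ d → P * d ≢ 0ℤ → ∣ d ∣ ℕ.< ∣ P * d ∣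
    smaller d Pd≢0 = subst (∣ d ∣ ℕ.<_) (trans (ℕ.*-comm (∣ d ∣) p) (sym (abs-* P d)))
      (ℕ.m<m*n (∣ d ∣) p {{ℕ.≢-nonZero (λ d≡0 → Pd≢0 (trans (cong (P *_) (∣i∣≡0⇒i≡0 d≡0)) (*-zeroʳ P)))}} (ℕ.nonTrivial⇒n>1 p {{prime⇒nonTrivial pp}}))

  abstract
    scale-x : ∀ p d l a e → a * (d * d) ≡ l * (e * e) → a * (p * d * (p * d)) ≡ p * (p * l) * (e * e)
    scale-x p d l a e eq = solve₁ (p ∷ d ∷ l ∷ a ∷ e ∷ []) (λ p d l a e →
      (a :* (p :* d :* (p :* d)) := p :* (p :* l) :* (e :* e)) , p :* p , (a :* (d :* d) := l :* (e :* e))) refl eq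

    common-prime : ∀ H D → D ≢ 0ℤ → CoprimeTo H D ⊎ (∃ λ p → Prime p × (+ p ∣ˢ H) × (+ p ∣ˢ D))
    common-prime H D D≢0 with gcd (∣ H ∣) (∣ D ∣) ℕ.≟ 1
    ... | yes gcd≡1 = inj₁ (λ {p} pp p∣H p∣D → prime∤1 pp (∣ᵤ⇒∣ (subst (p ℕ.∣_) gcd≡1 (gcd-greatest (∣⇒∣ᵤ p∣H) (∣⇒∣ᵤ p∣D)))))
    ... | no  gcd≢1 with prime-factor (gcd (∣ H ∣) (∣ D ∣)) (λ g≡0 → D≢0 (∣i∣≡0⇒i≡0 (ℕ.0∣⇒≡0 (subst (ℕ._∣ (∣ D ∣)) g≡0 (gcd[m,n]∣n (∣ H ∣) (∣ D ∣)))))) gcd≢1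
    ...   | p , pp , p∣g = inj₂ (p , pp , ∣ᵤ⇒∣ (ℕ.∣-trans p∣g (gcd[m,n]∣m (∣ H ∣) (∣ D ∣))) , ∣ᵤ⇒∣ (ℕ.∣-trans p∣g (gcd[m,n]∣n (∣ H ∣) (∣ D ∣))))

  LowestTerms : ℤ → ℤ → Set
  LowestTerms H D = ∃ λ (S : Point) → Point.a S * (D * D) ≡ H * (Point.e S * Point.e S)

  abstract
    lowest-terms : ∀ H D J → D ≢ 0ℤ → J * J ≡ G.cubicE H (D * D) → LowestTerms H D
    lowest-terms H D J = go H D J (<-wellFounded (∣ D ∣))
      where
      go : ∀ H D J → Acc ℕ._<_ (∣ D ∣) → D ≢ 0ℤ → J * J ≡ G.cubicE H (D * D) → LowestTerms H D
      go H D J (acc rec) D≢0 c with common-prime H D D≢0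
      ... | inj₁ coprime = record { a = H ; e = D ; n = J ; curve = c ; e≢0 = D≢0 ; coprime = coprime } , refl
      ... | inj₂ (p , pp , p∣H , p∣D) with Descend.divide-point pp H D J c p∣H p∣D
      ...   | h , d , j , refl , refl , c′ with go h d j (rec (Descend.smaller pp d D≢0)) (λ { refl → D≢0 (*-zeroʳ (+ p)) }) c′
      ...     | S , eq = S , scale-x (+ p) d h (Point.a S) (Point.e S) eq

-- Differences of congruent points: points of G near O at given primes

module Chords where

  open PolynomialIdentities
  open PrimeDivisibility
  open CubesOnG using (module G; cubic; Point; *-≢0)
  open GroupLawOnG
  open import Data.Nat.Base as ℕ using (ℕ; suc)
  import Data.Nat.Properties as ℕ
  import Data.Nat.Divisibility as ℕ
  open import Data.Nat.Primality using (Prime)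
  open import Data.Integer.Base hiding (suc)
  open import Data.Integer.Properties
  open import Data.Integer.Divisibility.Signed renaming (_∣_ to _∣ˢ_; _∣?_ to _∣ˢ?_)
  open import Data.Product.Base using (∃; ∃₂; _×_; _,_; proj₁; proj₂)
  open import Data.Sum.Base using ([_,_]′)
  open import Data.Vec.Base using ([]; _∷_)
  open import Relation.Nullary
  open import Function.Base using (id)
  open import Relation.Binary.PropositionalEquality hiding (J)

  -- The difference of two points (a , e , n) and (b , f , l) of G.
  module Chord (a e n b f l : ℤ) (curve : n * n ≡ cubic a e) (curve′ : l * l ≡ cubic b f) where

    E F m D H H′ J : ℤ
    E  = e * e
    F  = f * f
    m  = e * n * (f * l)
    D  = G.D a E b F
    H  = G.S₀ a E b F + id (+ 2) * m
    -- `H′` / `D`² is the x-coordinate of the sum. It is needed at primes where both points reduce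
    -- to O, since H and D can vanish there together.
    H′ = G.S₀ a E b F - id (+ 2) * m
    J  = e * n * G.C₁ a E b F + f * l * G.C₂ a E b F

    abstract
      m² : m * m ≡ E * F * (G.cubicE a E * G.cubicE b F)
      m² = trans (solve (e ∷ n ∷ f ∷ l ∷ []) (λ e n f l → e :* n :* (f :* l) :* (e :* n :* (f :* l)) := e :* e :* (f :* f) :* (n :* n :* (l :* l))) refl)
        (cong₂ (λ x y → E * F * (x * y)) curve curve′)

      chord-curve : J * J ≡ G.cubicE H (D * D)
      chord-curve = trans (expand (G.C₁ a E b F) (G.C₂ a E b F)) (G.chord-square a E b F m m²)
        where
        expand : ∀ c d → (e * n * c + f * l * d) * (e * n * c + f * l * d) ≡ E * G.cubicE a E * (c * c) + F * G.cubicE b F * (d * d) + id (+ 2) * (m * (c * d))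
        expand c d = trans (solve (e ∷ n ∷ f ∷ l ∷ c ∷ d ∷ []) (λ e n f l c d → (e :* n :* c :+ f :* l :* d) :* (e :* n :* c :+ f :* l :* d) :=
            e :* e :* (n :* n) :* (c :* c) :+ f :* f :* (l :* l) :* (d :* d) :+ # 2 :* (e :* n :* (f :* l) :* (c :* d))) refl)
          (cong₂ (λ x y → E * x * (c * c) + F * y * (d * d) + id (+ 2) * (m * (c * d))) curve curve′)

      HH′ : H * H′ ≡ G.Π₀ a E b F * (D * D)
      HH′ = G.chord-product a E b F m m²

      -- both points reduce to O
      module _ {p : ℕ} (pp : Prime p) (p∣e : + p ∣ˢ e) (p∣f : + p ∣ˢ f) (p∤a : ¬ + p ∣ˢ a) (p∤b : ¬ + p ∣ˢ b) where
        p∣H′ : + p ∣ˢ H′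
        p∣H′ = ∣-- (G.S₀ a E b F) (id (+ 2) * m)
          (∣-≡ (sym (G.S₀-at-O a E b F)) (∣-+ (a * F * u) (E * v) (∣-* (a * F) u (*-∣ a F (∣-* f f p∣f))) (∣-* E v (∣-* e e p∣e))))
          (*-∣ (id (+ 2)) m (∣-* (e * n) (f * l) (∣-* e n p∣e)))
          where
          u v : ℤ
          u = a * b + id (+ 88) * (E * F)
          v = b * u - id (+ 20) * (a * b * F) - id (+ 216) * (E * (F * F))

        p∤Π₀ : ¬ + p ∣ˢ G.Π₀ a E b F
        p∤Π₀ d = [ p∤a , p∤b ]′ (prime-∣* pp {a} {b} (prime-∣² pp {a * b} (∣-+⁻ˡ (a * b * (a * b)) (E * F * w)
          (∣-≡ (G.Π₀-at-O a E b F) d) (∣-* (E * F) w (∣-* E F (∣-* e e p∣e))))))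
          where
          w : ℤ
          w = id (+ 7744) * (E * F) - id (+ 176) * (a * b) + id (+ 432) * (a * F + b * E - id (+ 10) * (E * F))

      -- the two points are congruent
      module _ {p : ℕ} (pp : Prime p) (p∤2 : ¬ + p ∣ˢ + 2) (p∤e : ¬ + p ∣ˢ e) (p∤n : ¬ + p ∣ˢ n)
               (a≋b : + p ∣ˢ a - b) (e≋f : + p ∣ˢ e - f) (n≋l : + p ∣ˢ n - l) where

        F≋E : + p ∣ˢ F - E
        F≋E = ∣-≡ (solve (e ∷ f ∷ []) (λ e f → (e :- f) :* :- (e :+ f) := f :* f :- e :* e) refl) (∣-* (e - f) (- (e + f)) e≋f)

        p∣D : + p ∣ˢ D
        p∣D = ∣-≡ (solve (a ∷ E ∷ b ∷ F ∷ []) (λ a E b F → (a :- b) :* F :+ (F :- E) :* b := a :* F :- b :* E) refl)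
          (∣-+ ((a - b) * F) ((F - E) * b) (∣-* (a - b) F a≋b) (∣-* (F - E) b F≋E))

        -- Modulo p the two points coincide and H becomes 4 E n², the denominator of duplication, a
        -- unit because p divides none of 2, e, n.
        p∤H : ¬ + p ∣ˢ H
        p∤H d = [ (λ d → p∤2 (prime-∣² pp {+ 2} d)) , (λ d → [ (λ d → p∤e (prime-∣² pp {e} d)) , (λ d → p∤n (prime-∣² pp {n} (∣-≡ (sym curve) d))) ]′ (prime-∣* pp {E} {G.cubicE a E} d)) ]′
          (prime-∣* pp {id (+ 4)} {E * G.cubicE a E} (∣-≡ (G.chord-diagonal a E (E * G.cubicE a E) refl)
            (∣-≡ (solve (G.S₀ a E a E ∷ rest ∷ m ∷ E * G.cubicE a E ∷ []) (λ s r m c → s :+ r :+ # 2 :* m :- r :+ # 2 :* (c :- m) := s :+ # 2 :* c) refl)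
              (∣-+ (G.S₀ a E a E + rest + id (+ 2) * m - rest) (id (+ 2) * (E * G.cubicE a E - m))
                (∣-- (G.S₀ a E a E + rest + id (+ 2) * m) rest (∣-≡ (cong (λ s → s + id (+ 2) * m) (G.S₀-near-diagonal a E b F)) d)
                  (∣-+ ((b - a) * u) ((F - E) * v) (∣-* (b - a) u b≋a) (∣-* (F - E) v F≋E)))
                (*-∣ (id (+ 2)) (E * G.cubicE a E - m) m≋)))))
          where
          u v rest : ℤ
          u = a * a * F + id (+ 88) * (E * E * F) - id (+ 20) * (a * E * F) + a * E * (a + b)
          v = a * a * a + id (+ 88) * (a * E * E) - id (+ 20) * (a * a * E) + (id (+ 88) * (a * E) - id (+ 216) * (E * E)) * (F + E)
          rest = (b - a) * u + (F - E) * v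
          b≋a : + p ∣ˢ b - a
          b≋a = ∣-≡ (solve (a ∷ b ∷ []) (λ a b → :- (a :- b) := b :- a) refl) (∣m⇒∣-m {m = a - b} a≋b)
          m≋ : + p ∣ˢ E * G.cubicE a E - m
          m≋ = ∣-≡ (trans (solve (e ∷ n ∷ f ∷ l ∷ []) (λ e n f l → (e :- f) :* (e :* n :* l) :+ (n :- l) :* (e :* e :* n) := e :* e :* (n :* n) :- e :* n :* (f :* l)) refl)
              (cong (λ x → E * x - m) curve))
            (∣-+ ((e - f) * (e * n * l)) ((n - l) * (e * e * n)) (∣-* (e - f) (e * n * l) e≋f) (∣-* (n - l) (e * e * n) n≋l))

  abstract
    ∣e-by-H : ∀ {p} → Prime p → ∀ {a e D H} → a * (D * D) ≡ H * (e * e) → + p ∣ˢ D → ¬ + p ∣ˢ H → + p ∣ˢ e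
    ∣e-by-H pp {a} {e} {D} {H} eq p∣D p∤H = prime-∣² pp {e} (prime-∣*ʳ pp {H} {e * e} p∤H (∣-≡ eq (*-∣ a (D * D) (∣-* D D p∣D))))

    -- Multiplying by H′ and cancelling D² replaces H by a quantity that is a unit at p: a H′ = Π
    -- e².
    ∣e-by-H′ : ∀ {p} → Prime p → ∀ {a e D H H′ Π} → D ≢ 0ℤ → a * (D * D) ≡ H * (e * e) → H * H′ ≡ Π * (D * D) → + p ∣ˢ H′ → ¬ + p ∣ˢ Π → + p ∣ˢ e
    ∣e-by-H′ pp {a} {e} {D} {H} {H′} {Π} D≢0 eq eq′ p∣H′ p∤Π = prime-∣² pp {e} (prime-∣*ʳ pp {Π} {e * e} p∤Π (∣-≡ aH′ (*-∣ a H′ p∣H′)))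
      where
      aH′ : a * H′ ≡ Π * (e * e)
      aH′ = *-cancelʳ-≡ (a * H′) (Π * (e * e)) (D * D) {{≢-nonZero (*-≢0 {D} D≢0 D≢0)}}
        (solve₂ (a ∷ e ∷ D ∷ H ∷ H′ ∷ Π ∷ []) (λ a e D H H′ Π → (a :* H′ :* (D :* D) := Π :* (e :* e) :* (D :* D)) ,
          (H′ , (a :* (D :* D) := H :* (e :* e))) , e :* e , (H :* H′ := Π :* (D :* D))) refl eq eq′)

  -- The point is the difference of two points of the doubling sequence that are congruent modulo M.
  private
    point-near-O′ : ∀ M → ℕ.NonZero M → ∃ λ (S : Point) → ∀ {p} → Prime p → p ℕ.∣ M → + p ∣ˢ Point.e S
    point-near-O′ M M≢0 = build (congruent-points M {{M≢0}})
      where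
      module _ (i j : ℕ) (i<j : i ℕ.<′ j) (a≋ : + M ∣ˢ T.a i - T.a j) (e≋ : + M ∣ˢ T.e i - T.e j) (n≋ : + M ∣ˢ T.n i - T.n j) where
        open Chord (T.a i) (T.e i) (T.n i) (T.a j) (T.e j) (T.n j) (T.curve i) (T.curve j)

        D≢0 : D ≢ 0ℤ
        D≢0 = x-coordinates-differ i<j

        module _ (S : Point) (eq : Point.a S * (D * D) ≡ H * (Point.e S * Point.e S)) {p : ℕ} (pp : Prime p) (p∣M : p ℕ.∣ M) where
          private
            mod : ∀ {x} → + M ∣ˢ x → + p ∣ˢ x
            mod = ∣-trans (∣ᵤ⇒∣ p∣M)

            m′ : ∃ λ m → T.e j ≡ T.e i * (T.n i * (+ 2 * m))
            m′ = e∣e i<j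

          at-O : + p ∣ˢ T.e i → + p ∣ˢ Point.e S
          at-O p∣e = ∣e-by-H′ pp {Point.a S} {Point.e S} {D} {H} {H′} {G.Π₀ (T.a i) E (T.a j) F} D≢0 eq HH′
              (p∣H′ pp p∣e p∣f (p∤ i p∣e) (p∤ j p∣f)) (p∤Π₀ pp p∣e p∣f (p∤ i p∣e) (p∤ j p∣f))
            where
            p∤ : ∀ k → + p ∣ˢ T.e k → ¬ + p ∣ˢ T.a k
            p∤ k p∣e p∣a = T.coprime k pp p∣a p∣e
            p∣f : + p ∣ˢ T.e j
            p∣f = ∣-≡ (sym (proj₂ m′)) (∣-* (T.e i) (T.n i * (+ 2 * proj₁ m′)) p∣e)

          off-O : ¬ + p ∣ˢ T.e i → + p ∣ˢ Point.e S
          off-O p∤e = ∣e-by-H pp {Point.a S} {Point.e S} {D} {H} eq (p∣D pp p∤2 p∤e p∤n (mod a≋) (mod e≋) (mod n≋)) (p∤H pp p∤2 p∤e p∤n (mod a≋) (mod e≋) (mod n≋))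
            where
            p∤2 : ¬ + p ∣ˢ + 2
            p∤2 d = p∤e (∣-trans d (T.2∣e i))
            -- `T.n i` divides `T.e j`, which is congruent to `T.e i` modulo p.
            p∤n : ¬ + p ∣ˢ T.n i
            p∤n d = p∤e (∣-+⁻ˡ (T.e i) (- T.e j) (mod e≋) (∣m⇒∣-m {m = T.e j} (∣-≡ (sym (proj₂ m′)) (*-∣ (T.e i) (T.n i * (+ 2 * proj₁ m′)) (∣-* (T.n i) (+ 2 * proj₁ m′) d)))))

          near-O : + p ∣ˢ Point.e S
          near-O = cases (+ p ∣ˢ? T.e i)
            where
            cases : Dec (+ p ∣ˢ T.e i) → + p ∣ˢ Point.e S
            cases (yes h) = at-O h
            cases (no h)  = off-O h

        result : LowestTerms H D → ∃ λ (S : Point) → ∀ {p} → Prime p → p ℕ.∣ M → + p ∣ˢ Point.e S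
        result (S , eq) = S , near-O S eq

        difference : ∃ λ (S : Point) → ∀ {p} → Prime p → p ℕ.∣ M → + p ∣ˢ Point.e S
        difference = result (lowest-terms H D J D≢0 chord-curve)

      build : (∃₂ λ i j → i ℕ.< j × (+ M ∣ˢ T.a i - T.a j) × (+ M ∣ˢ T.e i - T.e j) × (+ M ∣ˢ T.n i - T.n j)) →
              ∃ λ (S : Point) → ∀ {p} → Prime p → p ℕ.∣ M → + p ∣ˢ Point.e S
      build (i , j , i<j , a≋ , e≋ , n≋) = difference i j (ℕ.<⇒<′ i<j) a≋ e≋ n≋

  abstract
    point-near-O : ∀ M → ℕ.NonZero M → ∃ λ (S : Point) → ∀ {p} → Prime p → p ℕ.∣ M → + p ∣ˢ Point.e S
    point-near-O = point-near-O′

-- The algebra of X³ = 3 N X + 2 A: multiplication, norm and characteristic polynomial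

module CubicAlgebras where

  open PolynomialIdentities hiding (solve; solve₁; solve₂; prove; ⟦_⟧)
  open import Algebra.Bundles using (CommutativeRing)
  open import Algebra.Morphism.Structures using (module RingMorphisms)
  open import Data.Integer.Base as ℤ using (ℤ; +_)
  import Data.Integer.Properties as ℤ
  open import Data.Fin.Patterns using (0F; 1F; 2F; 3F; 4F; 5F; 6F; 7F)
  open import Data.Nat.Base using (ℕ)
  open import Data.Product.Base using (_×_; _,_; proj₁; proj₂)
  open import Data.Vec.Base using (Vec; []; _∷_)
  open import Data.Vec.N-ary using (N-ary; _$ⁿ_)
  open import Function.Base using (_∘_; id)
  open import Relation.Binary.PropositionalEquality.Core as ≡ using (_≡_)
  open import Level using (0ℓ)
  import Algebra.Morphism.Construct.Composition as Composition

  -- R[X] / (X³ - 3 N X - 2 A), in the basis 1, X, Y = X² - 2 N.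
  module CubicAlgebra (R : CommutativeRing 0ℓ 0ℓ)
                      (ι : ℤ → CommutativeRing.Carrier R)
                      (homomorphism : RingMorphisms.IsRingHomomorphism
                        (CommutativeRing.rawRing ℤ.+-*-commutativeRing) (CommutativeRing.rawRing R) ι)
                      (N A : CommutativeRing.Carrier R)
    where

    private module R = CommutativeRing R
    open CommutativeRing R using (_+_; _*_; -_; _-_; 0#; 1#; _≈_)
    open Solver R ι homomorphism
    private module ι = RingMorphisms.IsRingHomomorphism homomorphism

    Element : Set
    Element = R.Carrier × R.Carrier × R.Carrier

    infix 4 _≈ᴷ_
    infixl 6 _+ᴷ_
    infixl 7 _*ᴷ_

    _≈ᴷ_ : Element → Element → Set
    (x₀ , x₁ , x₂) ≈ᴷ (y₀ , y₁ , y₂) = x₀ ≈ y₀ × x₁ ≈ y₁ × x₂ ≈ y₂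

    _+ᴷ_ _*ᴷ_ : Element → Element → Element
    (x₀ , x₁ , x₂) +ᴷ (y₀ , y₁ , y₂) = x₀ + y₀ , x₁ + y₁ , x₂ + y₂
    (x₀ , x₁ , x₂) *ᴷ (y₀ , y₁ , y₂) =
        x₀ * y₀ + ι (+ 2) * (N * (x₁ * y₁) + A * (x₁ * y₂ + x₂ * y₁) + N * N * (x₂ * y₂))
      , x₀ * y₁ + x₁ * y₀ + N * (x₁ * y₂ + x₂ * y₁) + ι (+ 2) * (A * (x₂ * y₂))
      , x₀ * y₂ + x₂ * y₀ + x₁ * y₁ - N * (x₂ * y₂)

    -ᴷ_ : Element → Element
    -ᴷ (x₀ , x₁ , x₂) = - x₀ , - x₁ , - x₂

    scalar : R.Carrier → Element
    scalar x = x , 0# , 0#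

    -- Both have trace 0, so the trace of an element is three times its first coordinate.
    X Y : Element
    X = 0# , 1# , 0#
    Y = 0# , 0# , 1#

    private
      E³ : ℕ → Set
      E³ n = Expr n × Expr n × Expr n

      module _ {n} (N A : Expr n) where

        infixl 7 _⊠_

        _⊠_ : E³ n → E³ n → E³ n
        (x₀ , x₁ , x₂) ⊠ (y₀ , y₁ , y₂) =
            x₀ :* y₀ :+ # 2 :* (N :* (x₁ :* y₁) :+ A :* (x₁ :* y₂ :+ x₂ :* y₁) :+ N :* N :* (x₂ :* y₂))
          , x₀ :* y₁ :+ x₁ :* y₀ :+ N :* (x₁ :* y₂ :+ x₂ :* y₁) :+ # 2 :* (A :* (x₂ :* y₂))
          , x₀ :* y₂ :+ x₂ :* y₀ :+ x₁ :* y₁ :- N :* (x₂ :* y₂)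

      _⊞_ : ∀ {n} → E³ n → E³ n → E³ n
      (x₀ , x₁ , x₂) ⊞ (y₀ , y₁ , y₂) = x₀ :+ y₀ , x₁ :+ y₁ , x₂ :+ y₂

      ⊟_ : ∀ {n} → E³ n → E³ n
      ⊟ (x₀ , x₁ , x₂) = :- x₀ , :- x₁ , :- x₂

      ⟨_⟩ : ∀ {n} → Expr n → E³ n
      ⟨ x ⟩ = x , # 0 , # 0

      ⟦_⟧³ : ∀ {n} → E³ n → Vec R.Carrier n → Element
      ⟦ x₀ , x₁ , x₂ ⟧³ ρ = ⟦ x₀ ⟧ ρ , ⟦ x₁ ⟧ ρ , ⟦ x₂ ⟧ ρ

      _≡³_ : ∀ {n} → E³ n → E³ n → Set
      (x₀ , x₁ , x₂) ≡³ (y₀ , y₁ , y₂) = x₀ ≡ᵖ y₀ × x₁ ≡ᵖ y₁ × x₂ ≡ᵖ y₂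

      solve³ : ∀ {n} (ρ : Vec R.Carrier n) (f : N-ary n (Expr n) (E³ n × E³ n)) →
               proj₁ (_$ⁿ_ {B = E³ n × E³ n} f vars) ≡³ proj₂ (_$ⁿ_ {B = E³ n × E³ n} f vars) →
               ⟦ proj₁ (_$ⁿ_ {B = E³ n × E³ n} f vars) ⟧³ ρ ≈ᴷ ⟦ proj₂ (_$ⁿ_ {B = E³ n × E³ n} f vars) ⟧³ ρ
      solve³ {n} ρ f (e₀ , e₁ , e₂) = let ((x₀ , x₁ , x₂) , (y₀ , y₁ , y₂)) = _$ⁿ_ {B = E³ n × E³ n} f vars in
        prove x₀ y₀ ρ e₀ , prove x₁ y₁ ρ e₁ , prove x₂ y₂ ρ e₂

      -- Literals of the solver denote images under `ι`; `0≈` and `1≈` reconcile them with the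
      -- constants of the ring.
      0≈ : 0# ≈ ι (+ 0)
      0≈ = R.sym ι.0#-homo

      1≈ : 1# ≈ ι (+ 1)
      1≈ = R.sym ι.1#-homo

      ≈ᴷ-refl : ∀ {x} → x ≈ᴷ x
      ≈ᴷ-refl = R.refl , R.refl , R.refl

      ≈ᴷ-sym : ∀ {x y} → x ≈ᴷ y → y ≈ᴷ x
      ≈ᴷ-sym (a , b , c) = R.sym a , R.sym b , R.sym c

      ≈ᴷ-trans : ∀ {x y z} → x ≈ᴷ y → y ≈ᴷ z → x ≈ᴷ z
      ≈ᴷ-trans (a , b , c) (a′ , b′ , c′) = R.trans a a′ , R.trans b b′ , R.trans c c′

      *ᴷ-cong : ∀ {x x′ y y′} → x ≈ᴷ x′ → y ≈ᴷ y′ → x *ᴷ y ≈ᴷ x′ *ᴷ y′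
      *ᴷ-cong (x₀ , x₁ , x₂) (y₀ , y₁ , y₂) =
          R.+-cong (R.*-cong x₀ y₀) (R.*-congˡ (R.+-cong (R.+-cong (R.*-congˡ (R.*-cong x₁ y₁)) (R.*-congˡ m)) (R.*-congˡ (R.*-cong x₂ y₂))))
        , R.+-cong (R.+-cong (R.+-cong (R.*-cong x₀ y₁) (R.*-cong x₁ y₀)) (R.*-congˡ m)) (R.*-congˡ (R.*-congˡ (R.*-cong x₂ y₂)))
        , R.+-cong (R.+-cong (R.+-cong (R.*-cong x₀ y₂) (R.*-cong x₂ y₀)) (R.*-cong x₁ y₁)) (R.-‿cong (R.*-congˡ (R.*-cong x₂ y₂)))
        where m = R.+-cong (R.*-cong x₁ y₂) (R.*-cong x₂ y₁)

      abstract
        *ᴷ-assoc : ∀ x y z → (x *ᴷ y) *ᴷ z ≈ᴷ x *ᴷ (y *ᴷ z)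
        *ᴷ-assoc (x₀ , x₁ , x₂) (y₀ , y₁ , y₂) (z₀ , z₁ , z₂) = solve³ (N ∷ A ∷ x₀ ∷ x₁ ∷ x₂ ∷ y₀ ∷ y₁ ∷ y₂ ∷ z₀ ∷ z₁ ∷ z₂ ∷ [])
          (λ N A x₀ x₁ x₂ y₀ y₁ y₂ z₀ z₁ z₂ → let _∙_ = _⊠_ N A ; x = x₀ , x₁ , x₂ ; y = y₀ , y₁ , y₂ ; z = z₀ , z₁ , z₂ in
            ((x ∙ y) ∙ z) , (x ∙ (y ∙ z))) (≡.refl , ≡.refl , ≡.refl)

        *ᴷ-comm : ∀ x y → x *ᴷ y ≈ᴷ y *ᴷ x
        *ᴷ-comm (x₀ , x₁ , x₂) (y₀ , y₁ , y₂) = solve³ (N ∷ A ∷ x₀ ∷ x₁ ∷ x₂ ∷ y₀ ∷ y₁ ∷ y₂ ∷ [])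
          (λ N A x₀ x₁ x₂ y₀ y₁ y₂ → let _∙_ = _⊠_ N A ; x = x₀ , x₁ , x₂ ; y = y₀ , y₁ , y₂ in (x ∙ y) , (y ∙ x)) (≡.refl , ≡.refl , ≡.refl)

        *ᴷ-distribˡ-+ᴷ : ∀ x y z → x *ᴷ (y +ᴷ z) ≈ᴷ (x *ᴷ y) +ᴷ (x *ᴷ z)
        *ᴷ-distribˡ-+ᴷ (x₀ , x₁ , x₂) (y₀ , y₁ , y₂) (z₀ , z₁ , z₂) = solve³ (N ∷ A ∷ x₀ ∷ x₁ ∷ x₂ ∷ y₀ ∷ y₁ ∷ y₂ ∷ z₀ ∷ z₁ ∷ z₂ ∷ [])
          (λ N A x₀ x₁ x₂ y₀ y₁ y₂ z₀ z₁ z₂ → let _∙_ = _⊠_ N A ; x = x₀ , x₁ , x₂ ; y = y₀ , y₁ , y₂ ; z = z₀ , z₁ , z₂ in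
            (x ∙ (y ⊞ z)) , ((x ∙ y) ⊞ (x ∙ z))) (≡.refl , ≡.refl , ≡.refl)

        *ᴷ-identityˡ : ∀ x → scalar 1# *ᴷ x ≈ᴷ x
        *ᴷ-identityˡ (x₀ , x₁ , x₂) = ≈ᴷ-trans (*ᴷ-cong {y = x₀ , x₁ , x₂} (1≈ , 0≈ , 0≈) ≈ᴷ-refl)
          (solve³ (N ∷ A ∷ x₀ ∷ x₁ ∷ x₂ ∷ []) (λ N A x₀ x₁ x₂ → _⊠_ N A ⟨ # 1 ⟩ (x₀ , x₁ , x₂) , (x₀ , x₁ , x₂)) (≡.refl , ≡.refl , ≡.refl))

    commutativeRing : CommutativeRing 0ℓ 0ℓ
    commutativeRing = record
      { Carrier = Element ; _≈_ = _≈ᴷ_ ; _+_ = _+ᴷ_ ; _*_ = _*ᴷ_ ; -_ = -ᴷ_ ; 0# = scalar 0# ; 1# = scalar 1#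
      ; isCommutativeRing = record
        { isRing = record
          { +-isAbelianGroup = record
            { isGroup = record
              { isMonoid = record
                { isSemigroup = record
                  { isMagma = record
                    { isEquivalence = record { refl = ≈ᴷ-refl ; sym = ≈ᴷ-sym ; trans = ≈ᴷ-trans }
                    ; ∙-cong = λ (a , b , c) (a′ , b′ , c′) → R.+-cong a a′ , R.+-cong b b′ , R.+-cong c c′ }
                  ; assoc = λ (a , b , c) (a′ , b′ , c′) (a″ , b″ , c″) → R.+-assoc a a′ a″ , R.+-assoc b b′ b″ , R.+-assoc c c′ c″ }
                ; identity = (λ (a , b , c) → R.+-identityˡ a , R.+-identityˡ b , R.+-identityˡ c)
                           , (λ (a , b , c) → R.+-identityʳ a , R.+-identityʳ b , R.+-identityʳ c) }
              ; inverse = (λ (a , b , c) → R.-‿inverseˡ a , R.-‿inverseˡ b , R.-‿inverseˡ c)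
                        , (λ (a , b , c) → R.-‿inverseʳ a , R.-‿inverseʳ b , R.-‿inverseʳ c)
              ; ⁻¹-cong = λ (a , b , c) → R.-‿cong a , R.-‿cong b , R.-‿cong c }
            ; comm = λ (a , b , c) (a′ , b′ , c′) → R.+-comm a a′ , R.+-comm b b′ , R.+-comm c c′ }
          ; *-cong = *ᴷ-cong
          ; *-assoc = *ᴷ-assoc
          ; *-identity = *ᴷ-identityˡ , (λ x → ≈ᴷ-trans (*ᴷ-comm x (scalar 1#)) (*ᴷ-identityˡ x))
          ; distrib = *ᴷ-distribˡ-+ᴷ
                    , (λ x y z → ≈ᴷ-trans (*ᴷ-comm (y +ᴷ z) x) (≈ᴷ-trans (*ᴷ-distribˡ-+ᴷ x y z)
                        (let (a , b , c) = *ᴷ-comm x y ; (a′ , b′ , c′) = *ᴷ-comm x z in R.+-cong a a′ , R.+-cong b b′ , R.+-cong c c′)))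
          }
        ; *-comm = *ᴷ-comm } }

    module K = CommutativeRing commutativeRing

    abstract
      scalar-* : ∀ x y → scalar (x * y) ≈ᴷ scalar x *ᴷ scalar y
      scalar-* x y = ≈ᴷ-trans (R.refl , 0≈ , 0≈) (≈ᴷ-trans (solve³ (N ∷ A ∷ x ∷ y ∷ []) (λ N A x y → ⟨ x :* y ⟩ , _⊠_ N A ⟨ x ⟩ ⟨ y ⟩) (≡.refl , ≡.refl , ≡.refl))
        (*ᴷ-cong {x , ι (+ 0) , ι (+ 0)} {scalar x} {y , ι (+ 0) , ι (+ 0)} {scalar y} (R.refl , R.sym 0≈ , R.sym 0≈) (R.refl , R.sym 0≈ , R.sym 0≈)))

      scalar-*ᴷ : ∀ x y → scalar x *ᴷ y ≈ᴷ (x * proj₁ y , x * proj₁ (proj₂ y) , x * proj₂ (proj₂ y))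
      scalar-*ᴷ x (y₀ , y₁ , y₂) = ≈ᴷ-trans (*ᴷ-cong {scalar x} {x , ι (+ 0) , ι (+ 0)} {y₀ , y₁ , y₂} (R.refl , 0≈ , 0≈) ≈ᴷ-refl)
        (solve³ (N ∷ A ∷ x ∷ y₀ ∷ y₁ ∷ y₂ ∷ []) (λ N A x y₀ y₁ y₂ → _⊠_ N A ⟨ x ⟩ (y₀ , y₁ , y₂) , (x :* y₀ , x :* y₁ , x :* y₂)) (≡.refl , ≡.refl , ≡.refl))

      scalar-+ : ∀ x y → scalar (x + y) ≈ᴷ scalar x +ᴷ scalar y
      scalar-+ x y = R.refl , R.sym (R.+-identityˡ 0#) , R.sym (R.+-identityˡ 0#)

      scalar-neg : ∀ x → scalar (- x) ≈ᴷ -ᴷ scalar x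
      scalar-neg x = R.refl , 0≈-0 , 0≈-0
        where
        0≈-0 : 0# ≈ - 0#
        0≈-0 = R.trans (R.sym (R.-‿inverseʳ 0#)) (R.+-identityˡ (- 0#))

    scalar-isRingHomomorphism : RingMorphisms.IsRingHomomorphism (CommutativeRing.rawRing R) K.rawRing scalar
    scalar-isRingHomomorphism = record
      { isSemiringHomomorphism = record
        { isNearSemiringHomomorphism = record
          { +-isMonoidHomomorphism = record
            { isMagmaHomomorphism = record
              { isRelHomomorphism = record { cong = λ e → e , R.refl , R.refl }
              ; homo = scalar-+ }
            ; ε-homo = ≈ᴷ-refl }
          ; *-homo = scalar-* }
        ; 1#-homo = ≈ᴷ-refl }
      ; -‿homo = scalar-neg }

    ιᴷ : ℤ → Element
    ιᴷ = scalar ∘ ι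

    ιᴷ-isRingHomomorphism : RingMorphisms.IsRingHomomorphism (CommutativeRing.rawRing ℤ.+-*-commutativeRing) K.rawRing ιᴷ
    ιᴷ-isRingHomomorphism = Composition.isRingHomomorphism K.trans homomorphism scalar-isRingHomomorphism

    module KSolver = Solver commutativeRing ιᴷ ιᴷ-isRingHomomorphism

    Q F : R.Carrier → R.Carrier → R.Carrier
    Q x y = N * (x * x) + ι (+ 2) * (A * (x * y)) + N * N * (y * y)
    F x y = A * (x * x * x) + ι (+ 3) * (N * N * (x * x * y)) + ι (+ 3) * (N * A * (x * (y * y)))
      + (ι (+ 2) * (A * A) - N * N * N) * (y * y * y)

    form : R.Carrier → R.Carrier → R.Carrier → R.Carrier → R.Carrier → R.Carrier
    form M L x y w = M * (w * w * w) - ι (+ 3) * (L * (Q x y * w)) + ι (+ 2) * F x y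

    norm : Element → R.Carrier
    norm (x₀ , x₁ , x₂) = form (ι (+ 1)) (ι (+ 1)) x₁ x₂ x₀

    -- By Cayley-Hamilton, x² - 3 x₀ x + 3 (x₀² - Q): the cofactor of x in its norm.
    adjugate : Element → Element
    adjugate (x₀ , x₁ , x₂) = (x₀ , x₁ , x₂) *ᴷ (x₀ , x₁ , x₂) +ᴷ (ι (+ 3) * (x₀ * x₀) - ι (+ 3) * Q x₁ x₂ - ι (+ 3) * (x₀ * x₀) , - (ι (+ 3) * (x₀ * x₁)) , - (ι (+ 3) * (x₀ * x₂)))

    private
      :Q :F : ∀ {n} (N A x y : Expr n) → Expr n
      :Q N A x y = N :* (x :* x) :+ # 2 :* (A :* (x :* y)) :+ N :* N :* (y :* y)
      :F N A x y = A :* (x :* x :* x) :+ # 3 :* (N :* N :* (x :* x :* y)) :+ # 3 :* (N :* A :* (x :* (y :* y)))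
        :+ (# 2 :* (A :* A) :- N :* N :* N) :* (y :* y :* y)

    abstract
      form-cong : ∀ M L {x x′ y y′ w w′} → x ≈ x′ → y ≈ y′ → w ≈ w′ → form M L x y w ≈ form M L x′ y′ w′
      form-cong M L x y w = R.+-cong (R.+-cong (R.*-congˡ (R.*-cong (R.*-cong w w) w)) (R.-‿cong (R.*-congˡ (R.*-congˡ (R.*-cong
          (R.+-cong (R.+-cong (R.*-congˡ (R.*-cong x x)) (R.*-congˡ (R.*-congˡ (R.*-cong x y)))) (R.*-congˡ (R.*-cong y y))) w)))))
        (R.*-congˡ (R.+-cong (R.+-cong (R.+-cong (R.*-congˡ (R.*-cong (R.*-cong x x) x)) (R.*-congˡ (R.*-congˡ (R.*-cong (R.*-cong x x) y))))
          (R.*-congˡ (R.*-congˡ (R.*-cong x (R.*-cong y y))))) (R.*-congˡ (R.*-cong (R.*-cong y y) y))))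

      form-homogeneous : ∀ M L d x y w → form M L (d * x) (d * y) (d * w) ≈ d * (d * (d * form M L x y w))
      form-homogeneous M L d x y w = solve (M ∷ L ∷ N ∷ A ∷ d ∷ x ∷ y ∷ w ∷ []) (λ M L N A d x y w →
        RamifiedForm.:R M L N A (d :* x) (d :* y) (d :* w) := d :* (d :* (d :* RamifiedForm.:R M L N A x y w))) ≡.refl

      *-adjugate : ∀ x → x *ᴷ adjugate x ≈ᴷ scalar (norm x)
      *-adjugate (x₀ , x₁ , x₂) = ≈ᴷ-trans (solve³ (N ∷ A ∷ x₀ ∷ x₁ ∷ x₂ ∷ []) (λ N A x₀ x₁ x₂ → let _∙_ = _⊠_ N A ; x = x₀ , x₁ , x₂ in
          (x ∙ ((x ∙ x) ⊞ (# 3 :* (x₀ :* x₀) :- # 3 :* :Q N A x₁ x₂ :- # 3 :* (x₀ :* x₀) , :- (# 3 :* (x₀ :* x₁)) , :- (# 3 :* (x₀ :* x₂))))) ,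
          ⟨ # 1 :* (x₀ :* x₀ :* x₀) :- # 3 :* (# 1 :* (:Q N A x₁ x₂ :* x₀)) :+ # 2 :* :F N A x₁ x₂ ⟩) (≡.refl , ≡.refl , ≡.refl))
        (R.refl , R.sym 0≈ , R.sym 0≈)

      -- Cayley-Hamilton for multiplication by x; the coefficients exhibit the trace 3 x₀ and the
      -- norm.
      cubic-relation : ∀ x₀ x₁ x₂ → let x = x₀ , x₁ , x₂ in
        (x *ᴷ x *ᴷ x) ≈ᴷ scalar (ι (+ 3) * x₀) *ᴷ (x *ᴷ x) +ᴷ (scalar (ι (+ 3) * (Q x₁ x₂ - x₀ * x₀)) *ᴷ x +ᴷ scalar (norm x))
      cubic-relation x₀ x₁ x₂ = ≈ᴷ-trans (solve³ (N ∷ A ∷ x₀ ∷ x₁ ∷ x₂ ∷ []) (λ N A x₀ x₁ x₂ → let _∙_ = _⊠_ N A ; x = x₀ , x₁ , x₂ in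
          ((x ∙ x) ∙ x) , ((⟨ # 3 :* x₀ ⟩ ∙ (x ∙ x)) ⊞ ((⟨ # 3 :* (:Q N A x₁ x₂ :- x₀ :* x₀) ⟩ ∙ x) ⊞ ⟨ # 1 :* (x₀ :* x₀ :* x₀) :- # 3 :* (# 1 :* (:Q N A x₁ x₂ :* x₀)) :+ # 2 :* :F N A x₁ x₂ ⟩))) (≡.refl , ≡.refl , ≡.refl))
        (K.+-cong {_} {scalar (ι (+ 3) * x₀) *ᴷ (x *ᴷ x)} (K.*-congʳ {x *ᴷ x} {_} {scalar (ι (+ 3) * x₀)} 0s) (K.+-cong {_} {scalar (ι (+ 3) * (Q x₁ x₂ - x₀ * x₀)) *ᴷ x} (K.*-congʳ {x} {_} {scalar (ι (+ 3) * (Q x₁ x₂ - x₀ * x₀))} 0s) 0s))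
        where
        x : Element
        x = x₀ , x₁ , x₂
        0s : ∀ {y} → (y , ι (+ 0) , ι (+ 0)) ≈ᴷ scalar y
        0s = R.refl , R.sym 0≈ , R.sym 0≈

      X³ : X *ᴷ X *ᴷ X ≈ᴷ scalar (ι (+ 3) * N) *ᴷ X +ᴷ scalar (ι (+ 2) * A)
      X³ = ≈ᴷ-trans (*ᴷ-cong {X *ᴷ X} {X′ *ᴷ X′} {X} {X′} (*ᴷ-cong {X} {X′} {X} {X′} X≈ X≈) X≈)
        (≈ᴷ-trans (solve³ (N ∷ A ∷ []) (λ N A → let _∙_ = _⊠_ N A ; X = # 0 , # 1 , # 0 in ((X ∙ X) ∙ X) , ((⟨ # 3 :* N ⟩ ∙ X) ⊞ ⟨ # 2 :* A ⟩)) (≡.refl , ≡.refl , ≡.refl))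
        (K.+-cong {_} {scalar (ι (+ 3) * N) *ᴷ X} (*ᴷ-cong {_} {scalar (ι (+ 3) * N)} {X′} {X} (R.refl , R.sym 0≈ , R.sym 0≈) (K.sym X≈)) (R.refl , R.sym 0≈ , R.sym 0≈)))
        where
        X′ : Element
        X′ = ι (+ 0) , ι (+ 1) , ι (+ 0)
        X≈ : X ≈ᴷ X′
        X≈ = 0≈ , 1≈ , 0≈

      coordinates : ∀ x₀ x₁ x₂ → scalar x₀ *ᴷ scalar 1# +ᴷ (scalar x₁ *ᴷ X +ᴷ (scalar x₂ *ᴷ Y +ᴷ scalar 0#)) ≈ᴷ (x₀ , x₁ , x₂)
      coordinates x₀ x₁ x₂ = ≈ᴷ-trans (K.+-cong (K.trans (K.*-identityʳ (scalar x₀)) (R.refl , 0≈ , 0≈))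
          (K.+-cong (K.trans (scalar-*ᴷ x₁ X) (R.*-congˡ 0≈ , R.*-identityʳ x₁ , R.*-congˡ 0≈))
            (K.+-cong (K.trans (scalar-*ᴷ x₂ Y) (R.*-congˡ 0≈ , R.*-congˡ 0≈ , R.*-identityʳ x₂)) (0≈ , 0≈ , 0≈))))
        (solve³ (x₀ ∷ x₁ ∷ x₂ ∷ []) (λ x₀ x₁ x₂ → ⟨ x₀ ⟩ ⊞ ((x₁ :* # 0 , x₁ , x₁ :* # 0) ⊞ ((x₂ :* # 0 , x₂ :* # 0 , x₂) ⊞ ⟨ # 0 ⟩)) , (x₀ , x₁ , x₂)) (≡.refl , ≡.refl , ≡.refl))

      X-powers : ∀ c₂ c₁ c₀ → scalar c₂ *ᴷ (X *ᴷ X) +ᴷ (scalar c₁ *ᴷ X +ᴷ scalar c₀) ≈ᴷ (c₂ * (ι (+ 2) * N) + c₀ , c₁ , c₂)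
      X-powers c₂ c₁ c₀ = ≈ᴷ-trans (K.+-cong (*ᴷ-cong {_} {⟨c⟩ c₂} {X *ᴷ X} {X′ *ᴷ X′} (0s c₂) (*ᴷ-cong {X} {X′} {X} {X′} X≈ X≈)) (K.+-cong (*ᴷ-cong {_} {⟨c⟩ c₁} {X} {X′} (0s c₁) X≈) (0s c₀)))
        (solve³ (N ∷ A ∷ c₂ ∷ c₁ ∷ c₀ ∷ []) (λ N A c₂ c₁ c₀ → let _∙_ = _⊠_ N A ; X = # 0 , # 1 , # 0 in
          ((⟨ c₂ ⟩ ∙ (X ∙ X)) ⊞ ((⟨ c₁ ⟩ ∙ X) ⊞ ⟨ c₀ ⟩)) , (c₂ :* (# 2 :* N) :+ c₀ , c₁ , c₂)) (≡.refl , ≡.refl , ≡.refl))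
        where
        X′ : Element
        X′ = ι (+ 0) , ι (+ 1) , ι (+ 0)
        X≈ : X ≈ᴷ X′
        X≈ = 0≈ , 1≈ , 0≈
        ⟨c⟩ : R.Carrier → Element
        ⟨c⟩ c = c , ι (+ 0) , ι (+ 0)
        0s : ∀ c → scalar c ≈ᴷ ⟨c⟩ c
        0s c = R.refl , 0≈ , 0≈

      -- Comparing with the characteristic polynomial of x, the trace 3 x₀ vanishes.
      trace-zero-root : ∀ M B x₀ x₁ x₂ → let x = x₀ , x₁ , x₂ in
        x *ᴷ x *ᴷ x ≈ᴷ scalar M *ᴷ x +ᴷ scalar (ι (+ 2) * B) →
        (∀ c₂ c₁ c₀ → scalar c₂ *ᴷ (x *ᴷ x) +ᴷ (scalar c₁ *ᴷ x +ᴷ scalar c₀) ≈ᴷ scalar 0# → c₂ ≈ 0# × c₀ ≈ 0#) →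
        ι (+ 3) * x₀ ≈ 0# × norm x ≈ ι (+ 2) * B
      trace-zero-root M B x₀ x₁ x₂ root independent = proj₁ zeros , x∙y⁻¹≈ε⇒x≈y (norm x) (ι (+ 2) * B) (proj₂ zeros)
        where
        open import Algebra.Properties.Ring R.ring using (x∙y⁻¹≈ε⇒x≈y)
        module S = RingMorphisms.IsRingHomomorphism scalar-isRingHomomorphism
        x : Element
        x = x₀ , x₁ , x₂
        M′ : R.Carrier
        M′ = ι (+ 3) * (Q x₁ x₂ - x₀ * x₀)
        combine : ∀ (x a b c d e : Element) → x *ᴷ x *ᴷ x ≈ᴷ a *ᴷ x +ᴷ b → x *ᴷ x *ᴷ x ≈ᴷ c *ᴷ (x *ᴷ x) +ᴷ (d *ᴷ x +ᴷ e) →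
                  c *ᴷ (x *ᴷ x) +ᴷ ((d +ᴷ -ᴷ a) *ᴷ x +ᴷ (e +ᴷ -ᴷ b)) ≈ᴷ ιᴷ (+ 0)
        combine x a b c d e h h′ = KSolver.solve₂ (x ∷ a ∷ b ∷ c ∷ d ∷ e ∷ []) (λ x a b c d e →
          (c :* (x :* x) :+ ((d :- a) :* x :+ (e :- b)) := # 0) , (# 1 , (x :* x :* x := a :* x :+ b)) , :- # 1 , (x :* x :* x := c :* (x :* x) :+ (d :* x :+ e)))
          ≡.refl h h′
        difference : ∀ y z → scalar (y - z) ≈ᴷ scalar y +ᴷ -ᴷ scalar z
        difference y z = K.trans (S.+-homo y (- z)) (K.+-congˡ (S.-‿homo z))
        zeros : ι (+ 3) * x₀ ≈ 0# × norm x - ι (+ 2) * B ≈ 0#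
        zeros = independent (ι (+ 3) * x₀) (M′ - M) (norm x - ι (+ 2) * B)
          (K.trans (K.+-congˡ (K.+-cong (K.*-congʳ (difference M′ M)) (difference (norm x) (ι (+ 2) * B))))
            (K.trans (combine x (scalar M) (scalar (ι (+ 2) * B)) (scalar (ι (+ 3) * x₀)) (scalar M′) (scalar (norm x)) root (cubic-relation x₀ x₁ x₂))
              (ι.0#-homo , R.refl , R.refl)))

      -- Turns the norm equation for an element of trace 0 into a zero, with last coordinate 1, of
      -- the form that is anisotropic at ramified primes.
      norm⇒form : ∀ B x₀ x₁ x₂ → x₀ ≈ ι (+ 0) → norm (x₀ , x₁ , x₂) ≈ ι (+ 2) * B → form (- (ι (+ 2) * B)) (ι (+ 0)) x₁ x₂ (ι (+ 1)) ≈ ι (+ 0)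
      norm⇒form B x₀ x₁ x₂ h h′ = solve₂ (N ∷ A ∷ B ∷ x₀ ∷ x₁ ∷ x₂ ∷ []) (λ N A B x₀ x₁ x₂ →
        (RamifiedForm.:R (:- (# 2 :* B)) (# 0) N A x₁ x₂ (# 1) := # 0) ,
        (:- (x₀ :* x₀ :- # 3 :* :Q N A x₁ x₂) , (x₀ := # 0)) , # 1 , (RamifiedForm.:R (# 1) (# 1) N A x₁ x₂ x₀ := # 2 :* B)) ≡.refl h h′

  module IntegralForm (R : CommutativeRing 0ℓ 0ℓ)
                      (ι : ℤ → CommutativeRing.Carrier R)
                      (homomorphism : RingMorphisms.IsRingHomomorphism
                        (CommutativeRing.rawRing ℤ.+-*-commutativeRing) (CommutativeRing.rawRing R) ι)
                      (N A : ℤ) where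

    open CommutativeRing R using (_≈_)
    open Evaluation R ι homomorphism
    open CubicAlgebra R ι homomorphism (ι N) (ι A) using (form)

    abstract
      form-ι : ∀ M L x y w → form (ι M) (ι L) (ι x) (ι y) (ι w) ≈ ι (RamifiedForm.Rf M L N A x y w)
      form-ι M L x y w = ⟦⟧-ι (RamifiedForm.:R (var 0F) (var 1F) (var 2F) (var 3F) (var 4F) (var 5F) (var 6F)) (M ∷ L ∷ N ∷ A ∷ x ∷ y ∷ w ∷ [])

  module BaseChange (R : CommutativeRing 0ℓ 0ℓ)
                    (ι : ℤ → CommutativeRing.Carrier R)
                    (homomorphism : RingMorphisms.IsRingHomomorphism
                      (CommutativeRing.rawRing ℤ.+-*-commutativeRing) (CommutativeRing.rawRing R) ι)
                    (N A : ℤ) where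

    private
      module R = CommutativeRing R
      module ι = RingMorphisms.IsRingHomomorphism homomorphism
      module Λ = CubicAlgebra ℤ.+-*-commutativeRing id id-isRingHomomorphism N A
      module K = CubicAlgebra R ι homomorphism (ι N) (ι A)
      open Evaluation R ι homomorphism

    -- The inclusion of the order spanned by 1, X and Y; parity arguments are carried out in the
    -- order.
    extend : Λ.Element → K.Element
    extend (x₀ , x₁ , x₂) = ι x₀ , ι x₁ , ι x₂

    private
      abstract
        extend-* : ∀ x y → extend (x Λ.*ᴷ y) K.≈ᴷ extend x K.*ᴷ extend y
        extend-* (x₀ , x₁ , x₂) (y₀ , y₁ , y₂) =
            R.sym (⟦⟧-ι (a₀ :* b₀ :+ # 2 :* (M :* (a₁ :* b₁) :+ B :* (a₁ :* b₂ :+ a₂ :* b₁) :+ M :* M :* (a₂ :* b₂))) ρ)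
          , R.sym (⟦⟧-ι (a₀ :* b₁ :+ a₁ :* b₀ :+ M :* (a₁ :* b₂ :+ a₂ :* b₁) :+ # 2 :* (B :* (a₂ :* b₂))) ρ)
          , R.sym (⟦⟧-ι (a₀ :* b₂ :+ a₂ :* b₀ :+ a₁ :* b₁ :- M :* (a₂ :* b₂)) ρ)
          where
          M B a₀ a₁ a₂ b₀ b₁ b₂ : Expr 8
          M = var 0F
          B = var 1F
          a₀ = var 2F
          a₁ = var 3F
          a₂ = var 4F
          b₀ = var 5F
          b₁ = var 6F
          b₂ = var 7F
          ρ : Vec ℤ 8
          ρ = N ∷ A ∷ x₀ ∷ x₁ ∷ x₂ ∷ y₀ ∷ y₁ ∷ y₂ ∷ []

    extend-isRingHomomorphism : RingMorphisms.IsRingHomomorphism Λ.K.rawRing K.K.rawRing extend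
    extend-isRingHomomorphism = record
      { isSemiringHomomorphism = record
        { isNearSemiringHomomorphism = record
          { +-isMonoidHomomorphism = record
            { isMagmaHomomorphism = record
              { isRelHomomorphism = record { cong = λ (e₀ , e₁ , e₂) → ι.⟦⟧-cong e₀ , ι.⟦⟧-cong e₁ , ι.⟦⟧-cong e₂ }
              ; homo = λ (x₀ , x₁ , x₂) (y₀ , y₁ , y₂) → ι.+-homo x₀ y₀ , ι.+-homo x₁ y₁ , ι.+-homo x₂ y₂ }
            ; ε-homo = ι.0#-homo , ι.0#-homo , ι.0#-homo }
          ; *-homo = extend-* }
        ; 1#-homo = ι.1#-homo , ι.0#-homo , ι.0#-homo }
      ; -‿homo = λ (x₀ , x₁ , x₂) → ι.-‿homo x₀ , ι.-‿homo x₁ , ι.-‿homo x₂ }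

-- The automorphism of order 3 and the field structure

module CyclicCubics where

  open PolynomialIdentities hiding (solve; solve₁; solve₂; prove; ⟦_⟧)
  open CubicAlgebras using (module CubicAlgebra)
  open import Algebra.Apartness.Bundles using (HeytingField)
  open import Algebra.Bundles using (CommutativeRing)
  open import Algebra.Morphism.Structures using (module RingMorphisms)
  open import Data.Integer.Base as ℤ using (ℤ; +_)
  import Data.Integer.Properties as ℤ
  open import Data.Product.Base using (∃; _×_; _,_; proj₁; proj₂)
  open import Data.Vec.Base using (Vec; []; _∷_)
  open import Relation.Binary.Bundles using (DecSetoid)
  open import Relation.Binary.Definitions using (Decidable)
  import Relation.Binary.Properties.DecSetoid as DecSetoidProperties
  open import Relation.Binary.PropositionalEquality.Core as ≡ using (_≡_)
  open import Relation.Nullary using (¬_)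
  open import Relation.Nullary.Decidable using (_×-dec_)
  open import Level using (0ℓ)

  module CyclicCubic (R : CommutativeRing 0ℓ 0ℓ)
                     (ι : ℤ → CommutativeRing.Carrier R)
                     (homomorphism : RingMorphisms.IsRingHomomorphism
                       (CommutativeRing.rawRing ℤ.+-*-commutativeRing) (CommutativeRing.rawRing R) ι)
                     (N A : CommutativeRing.Carrier R)
    where

    open CommutativeRing R
    open Solver R ι homomorphism
    open CubicAlgebra R ι homomorphism N A public

    -- With N³ = A² + 3 C², the substitution X = ∛(A + C √-3) + ∛(A - C √-3) leads to the automorphism κ τ.
    module Conjugation (C κ : Carrier) (κ2C≈1 : κ * (ι (+ 2) * C) ≈ 1#) (N³ : N * N * N ≈ A * A + ι (+ 3) * (C * C)) where

      -- If α and β are the two cube roots, with α β = N, then X = α + β, Y = α² + β², and σ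
      -- multiplies α by ω and β by ω², ω a primitive cube root of unity. `τ` is 2 C σ, free of
      -- denominators.
      τ : Element → Element
      τ (x₀ , x₁ , x₂) = ι (+ 2) * C * x₀ , (A - C) * x₁ + N * N * x₂ , - (N * x₁) - (A + C) * x₂

      σ : Element → Element
      σ x = scalar κ *ᴷ τ x

      abstract
        τ-cong : ∀ {x y} → x ≈ᴷ y → τ x ≈ᴷ τ y
        τ-cong (a , b , c) = *-congˡ a , +-cong (*-congˡ b) (*-congˡ c) , +-cong (-‿cong (*-congˡ b)) (-‿cong (*-congˡ c))

        τ-+ : ∀ x y → τ (x +ᴷ y) ≈ᴷ τ x +ᴷ τ y
        τ-+ (x₀ , x₁ , x₂) (y₀ , y₁ , y₂) =
            solve (N ∷ A ∷ C ∷ x₀ ∷ y₀ ∷ []) (λ N A C x₀ y₀ → # 2 :* C :* (x₀ :+ y₀) := # 2 :* C :* x₀ :+ # 2 :* C :* y₀) ≡.refl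
          , solve (N ∷ A ∷ C ∷ x₁ ∷ x₂ ∷ y₁ ∷ y₂ ∷ []) (λ N A C x₁ x₂ y₁ y₂ → (A :- C) :* (x₁ :+ y₁) :+ N :* N :* (x₂ :+ y₂)
              := (A :- C) :* x₁ :+ N :* N :* x₂ :+ ((A :- C) :* y₁ :+ N :* N :* y₂)) ≡.refl
          , solve (N ∷ A ∷ C ∷ x₁ ∷ x₂ ∷ y₁ ∷ y₂ ∷ []) (λ N A C x₁ x₂ y₁ y₂ → :- (N :* (x₁ :+ y₁)) :- (A :+ C) :* (x₂ :+ y₂)
              := :- (N :* x₁) :- (A :+ C) :* x₂ :+ (:- (N :* y₁) :- (A :+ C) :* y₂)) ≡.refl

        τ-scalar-* : ∀ k x → τ (scalar k *ᴷ x) ≈ᴷ scalar k *ᴷ τ x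
        τ-scalar-* k x@(x₀ , x₁ , x₂) = K.trans (τ-cong (scalar-*ᴷ k x)) (K.trans
          ( solve (C ∷ k ∷ x₀ ∷ []) (λ C k x → # 2 :* C :* (k :* x) := k :* (# 2 :* C :* x)) ≡.refl
          , solve (N ∷ A ∷ C ∷ k ∷ x₁ ∷ x₂ ∷ []) (λ N A C k x y → (A :- C) :* (k :* x) :+ N :* N :* (k :* y) := k :* ((A :- C) :* x :+ N :* N :* y)) ≡.refl
          , solve (N ∷ A ∷ C ∷ k ∷ x₁ ∷ x₂ ∷ []) (λ N A C k x y → :- (N :* (k :* x)) :- (A :+ C) :* (k :* y) := k :* (:- (N :* x) :- (A :+ C) :* y)) ≡.refl )
          (K.sym (scalar-*ᴷ k (τ x))))

        τ-* : ∀ x y → τ x *ᴷ τ y ≈ᴷ scalar (ι (+ 2) * C) *ᴷ τ (x *ᴷ y)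
        τ-* x@(x₀ , x₁ , x₂) y@(y₀ , y₁ , y₂) = K.trans
          ( solve₁ (N ∷ A ∷ C ∷ x₀ ∷ x₁ ∷ x₂ ∷ y₀ ∷ y₁ ∷ y₂ ∷ []) (λ N A C x₀ x₁ x₂ y₀ y₁ y₂ →
              ( # 2 :* C :* x₀ :* (# 2 :* C :* y₀) :+ # 2 :* (N :* (t₁ N A C x₁ x₂ :* t₁ N A C y₁ y₂) :+ A :* (t₁ N A C x₁ x₂ :* t₂ N A C y₁ y₂ :+ t₂ N A C x₁ x₂ :* t₁ N A C y₁ y₂) :+ N :* N :* (t₂ N A C x₁ x₂ :* t₂ N A C y₁ y₂))
                := # 2 :* C :* (# 2 :* C :* (x₀ :* y₀ :+ # 2 :* (N :* (x₁ :* y₁) :+ A :* (x₁ :* y₂ :+ x₂ :* y₁) :+ N :* N :* (x₂ :* y₂))))) ,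
              # 2 :* (N :* N :* x₂ :* y₂ :+ N :* x₁ :* y₁ :+ A :* (x₁ :* y₂ :+ x₂ :* y₁)) , (N :* N :* N := A :* A :+ # 3 :* (C :* C))) ≡.refl N³
          , solve₁ (N ∷ A ∷ C ∷ x₀ ∷ x₁ ∷ x₂ ∷ y₀ ∷ y₁ ∷ y₂ ∷ []) (λ N A C x₀ x₁ x₂ y₀ y₁ y₂ →
              ( # 2 :* C :* x₀ :* t₁ N A C y₁ y₂ :+ t₁ N A C x₁ x₂ :* (# 2 :* C :* y₀) :+ N :* (t₁ N A C x₁ x₂ :* t₂ N A C y₁ y₂ :+ t₂ N A C x₁ x₂ :* t₁ N A C y₁ y₂) :+ # 2 :* (A :* (t₂ N A C x₁ x₂ :* t₂ N A C y₁ y₂))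
                := # 2 :* C :* t₁ N A C (m₁ N A x₀ x₁ x₂ y₀ y₁ y₂) (m₂ N A x₀ x₁ x₂ y₀ y₁ y₂)) ,
              :- (N :* (x₁ :* y₂ :+ x₂ :* y₁) :+ # 2 :* (A :* x₂ :* y₂)) , (N :* N :* N := A :* A :+ # 3 :* (C :* C))) ≡.refl N³
          , solve₁ (N ∷ A ∷ C ∷ x₀ ∷ x₁ ∷ x₂ ∷ y₀ ∷ y₁ ∷ y₂ ∷ []) (λ N A C x₀ x₁ x₂ y₀ y₁ y₂ →
              ( # 2 :* C :* x₀ :* t₂ N A C y₁ y₂ :+ t₂ N A C x₁ x₂ :* (# 2 :* C :* y₀) :+ t₁ N A C x₁ x₂ :* t₁ N A C y₁ y₂ :- N :* (t₂ N A C x₁ x₂ :* t₂ N A C y₁ y₂)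
                := # 2 :* C :* t₂ N A C (m₁ N A x₀ x₁ x₂ y₀ y₁ y₂) (m₂ N A x₀ x₁ x₂ y₀ y₁ y₂)) ,
              N :* x₂ :* y₂ :- x₁ :* y₁ , (N :* N :* N := A :* A :+ # 3 :* (C :* C))) ≡.refl N³ )
          (K.sym (scalar-*ᴷ (ι (+ 2) * C) (τ (x *ᴷ y))))
          where
          t₁ t₂ : ∀ {n} → Expr n → Expr n → Expr n → Expr n → Expr n → Expr n
          t₁ N A C x y = (A :- C) :* x :+ N :* N :* y
          t₂ N A C x y = :- (N :* x) :- (A :+ C) :* y
          m₁ m₂ : ∀ {n} → Expr n → Expr n → Expr n → Expr n → Expr n → Expr n → Expr n → Expr n → Expr n
          m₁ N A x₀ x₁ x₂ y₀ y₁ y₂ = x₀ :* y₁ :+ x₁ :* y₀ :+ N :* (x₁ :* y₂ :+ x₂ :* y₁) :+ # 2 :* (A :* (x₂ :* y₂))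
          m₂ N A x₀ x₁ x₂ y₀ y₁ y₂ = x₀ :* y₂ :+ x₂ :* y₀ :+ x₁ :* y₁ :- N :* (x₂ :* y₂)

        private
          κ2Cᴷ : scalar κ *ᴷ scalar (ι (+ 2) * C) ≈ᴷ K.1#
          κ2Cᴷ = K.trans (K.sym (scalar-* κ (ι (+ 2) * C))) (κ2C≈1 , refl , refl)

        σ-cong : ∀ {x y} → x ≈ᴷ y → σ x ≈ᴷ σ y
        σ-cong e = K.*-congˡ {scalar κ} (τ-cong e)

        σ-+ : ∀ x y → σ (x +ᴷ y) ≈ᴷ σ x +ᴷ σ y
        σ-+ x y = K.trans (K.*-congˡ {scalar κ} (τ-+ x y)) (K.distribˡ (scalar κ) (τ x) (τ y))

        σ-* : ∀ x y → σ (x *ᴷ y) ≈ᴷ σ x *ᴷ σ y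
        σ-* x y = KSolver.solve₂ (scalar κ ∷ scalar (ι (+ 2) * C) ∷ τ (x *ᴷ y) ∷ τ x ∷ τ y ∷ []) (λ k c t u v →
          (k :* t := k :* u :* (k :* v)) , (:- (k :* t) , (k :* c := # 1)) , :- (k :* k) , (u :* v := c :* t)) ≡.refl κ2C1 (τ-* x y)
          where
          κ2C1 : scalar κ *ᴷ scalar (ι (+ 2) * C) ≈ᴷ ιᴷ (+ 1)
          κ2C1 = K.trans κ2Cᴷ (sym ι1 , refl , refl)
            where
            ι1 : ι (+ 1) ≈ 1#
            ι1 = RingMorphisms.IsRingHomomorphism.1#-homo homomorphism

        σ-scalar : ∀ x → σ (scalar x) ≈ᴷ scalar x
        σ-scalar x = K.trans (K.*-congˡ {scalar κ} (K.trans (refl , 0₁ , 0₂) (scalar-* (ι (+ 2) * C) x)))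
          (K.trans (K.sym (K.*-assoc (scalar κ) (scalar (ι (+ 2) * C)) (scalar x))) (K.trans (K.*-congʳ {scalar x} κ2Cᴷ) (K.*-identityˡ (scalar x))))
          where
          0≈ι0 : 0# ≈ ι (+ 0)
          0≈ι0 = sym (RingMorphisms.IsRingHomomorphism.0#-homo homomorphism)
          0₁ : (A - C) * 0# + N * N * 0# ≈ 0#
          0₁ = trans (solve₁ (N ∷ A ∷ C ∷ 0# ∷ []) (λ N A C z → ((A :- C) :* z :+ N :* N :* z := # 0) , A :- C :+ N :* N , (z := # 0)) ≡.refl 0≈ι0) (sym 0≈ι0)
          0₂ : - (N * 0#) - (A + C) * 0# ≈ 0#
          0₂ = trans (solve₁ (N ∷ A ∷ C ∷ 0# ∷ []) (λ N A C z → (:- (N :* z) :- (A :+ C) :* z := # 0) , :- (N :+ A :+ C) , (z := # 0)) ≡.refl 0≈ι0) (sym 0≈ι0)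

    module Automorphism (C κ : Carrier) (κ2C≈1 : κ * (ι (+ 2) * C) ≈ 1#) (N³ : N * N * N ≈ A * A + ι (+ 3) * (C * C)) where

      open import Algebra.Properties.Ring ring using (-‿distribˡ-*; -‿distribʳ-*; -‿involutive)

      private
        abstract
          κ2C⁻ : - κ * (ι (+ 2) * - C) ≈ 1#
          κ2C⁻ = trans (solve (κ ∷ C ∷ []) (λ k c → :- k :* (# 2 :* :- c) := k :* (# 2 :* c)) ≡.refl) κ2C≈1

          N³⁻ : N * N * N ≈ A * A + ι (+ 3) * (- C * - C)
          N³⁻ = trans N³ (solve (A ∷ C ∷ []) (λ a c → a :* a :+ # 3 :* (c :* c) := a :* a :+ # 3 :* (:- c :* :- c)) ≡.refl)

        module F = Conjugation C κ κ2C≈1 N³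
        module B = Conjugation (- C) (- κ) κ2C⁻ N³⁻

        abstract
          inverse : ∀ C′ κ′ (h : κ′ * (ι (+ 2) * C′) ≈ 1#) (N³′ : N * N * N ≈ A * A + ι (+ 3) * (C′ * C′))
                    (g : - κ′ * (ι (+ 2) * - C′) ≈ 1#) (N³″ : N * N * N ≈ A * A + ι (+ 3) * (- C′ * - C′)) →
                    ∀ x → Conjugation.σ C′ κ′ h N³′ (Conjugation.σ (- C′) (- κ′) g N³″ x) ≈ᴷ x
          inverse C κ h N³ g N³′ x@(x₀ , x₁ , x₂) = K.trans (K.*-congˡ {scalar κ} (P.τ-scalar-* (- κ) (M.τ x)))
            (K.trans (K.sym (K.*-assoc (scalar κ) (scalar (- κ)) (P.τ (M.τ x)))) (K.trans (K.*-congʳ {P.τ (M.τ x)} (K.sym (scalar-* κ (- κ))))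
              (K.trans (scalar-*ᴷ (κ * - κ) (P.τ (M.τ x)))
                ( solve₁ (κ ∷ C ∷ x₀ ∷ []) (λ k c x → (k :* :- k :* (# 2 :* c :* (# 2 :* :- c :* x)) := x) , (k :* (# 2 :* c) :+ # 1) :* x , (k :* (# 2 :* c) := # 1)) ≡.refl h′
                , solve₂ (κ ∷ N ∷ A ∷ C ∷ x₁ ∷ x₂ ∷ []) (λ k N A C x y →
                    (k :* :- k :* ((A :- C) :* ((A :- :- C) :* x :+ N :* N :* y) :+ N :* N :* (:- (N :* x) :- (A :+ :- C) :* y)) := x) ,
                    ((k :* (# 2 :* C) :+ # 1) :* x , (k :* (# 2 :* C) := # 1)) , k :* k :* x , (N :* N :* N := A :* A :+ # 3 :* (C :* C))) ≡.refl h′ N³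
                , solve₂ (κ ∷ N ∷ A ∷ C ∷ x₁ ∷ x₂ ∷ []) (λ k N A C x y →
                    (k :* :- k :* (:- (N :* ((A :- :- C) :* x :+ N :* N :* y)) :- (A :+ C) :* (:- (N :* x) :- (A :+ :- C) :* y)) := y) ,
                    ((k :* (# 2 :* C) :+ # 1) :* y , (k :* (# 2 :* C) := # 1)) , k :* k :* y , (N :* N :* N := A :* A :+ # 3 :* (C :* C))) ≡.refl h′ N³ ))))
            where
            module P = Conjugation C κ h N³
            module M = Conjugation (- C) (- κ) g N³′
            h′ : κ * (ι (+ 2) * C) ≈ ι (+ 1)
            h′ = trans h (sym (RingMorphisms.IsRingHomomorphism.1#-homo homomorphism))

          parameter-cong : ∀ C κ C′ κ′ h N³ h′ N³′ → C ≈ C′ → κ ≈ κ′ → ∀ x → Conjugation.σ C κ h N³ x ≈ᴷ Conjugation.σ C′ κ′ h′ N³′ x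
          parameter-cong C κ C′ κ′ h N³ h′ N³′ C≈ κ≈ x = K.*-cong {scalar κ} {scalar κ′} {Conjugation.τ C κ h N³ x} (κ≈ , refl , refl)
            ( *-congʳ (*-congˡ C≈) , +-congʳ (*-congʳ (+-congˡ (-‿cong C≈))) , +-congˡ (-‿cong (*-congʳ (+-congˡ C≈))) )

        -- Negating C and κ exchanges ω and ω², which inverts σ.
        σ⁻ : Element → Element
        σ⁻ = B.σ

        σ-σ⁻ : ∀ x → F.σ (σ⁻ x) ≈ᴷ x
        σ-σ⁻ = inverse C κ κ2C≈1 N³ κ2C⁻ N³⁻

        σ⁻-σ : ∀ x → σ⁻ (F.σ x) ≈ᴷ x
        σ⁻-σ x = K.trans (B.σ-cong (parameter-cong C κ (- - C) (- - κ) κ2C≈1 N³ h N³′ (sym (-‿involutive C)) (sym (-‿involutive κ)) x))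
          (inverse (- C) (- κ) κ2C⁻ N³⁻ h N³′ x)
          where
          h : - - κ * (ι (+ 2) * - - C) ≈ 1#
          h = trans (*-cong (-‿involutive κ) (*-congˡ (-‿involutive C))) κ2C≈1
          N³′ : N * N * N ≈ A * A + ι (+ 3) * (- - C * - - C)
          N³′ = trans N³ (+-congˡ (*-congˡ (sym (*-cong (-‿involutive C) (-‿involutive C)))))

      σ : Element → Element
      σ = F.σ

      open F public using (σ-scalar)

      σ-isRingIsomorphism : RingMorphisms.IsRingIsomorphism K.rawRing K.rawRing σ
      σ-isRingIsomorphism = record
        { isRingMonomorphism = record
          { isRingHomomorphism = record
            { isSemiringHomomorphism = record
              { isNearSemiringHomomorphism = record
                { +-isMonoidHomomorphism = record
                  { isMagmaHomomorphism = record
                    { isRelHomomorphism = record { cong = F.σ-cong }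
                    ; homo = F.σ-+ }
                  ; ε-homo = F.σ-scalar 0# }
                ; *-homo = F.σ-* }
              ; 1#-homo = F.σ-scalar 1# }
            ; -‿homo = neg }
          ; injective = λ {x} {y} e → K.trans (K.sym (σ⁻-σ x)) (K.trans (B.σ-cong e) (σ⁻-σ y)) }
        ; surjective = λ y → σ⁻ y , λ e → K.trans (F.σ-cong e) (σ-σ⁻ y) }
        where
        neg : ∀ x → F.σ (-ᴷ x) ≈ᴷ -ᴷ F.σ x
        neg x = negation-unique (F.σ (-ᴷ x)) (F.σ x) (K.trans (K.sym (F.σ-+ (-ᴷ x) x)) (K.trans (F.σ-cong (K.-‿inverseˡ x)) (F.σ-scalar 0#)))
          where open import Algebra.Properties.Group K.+-group using () renaming (inverseˡ-unique to negation-unique)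

      abstract
        -- The coordinates x₁ and x₂ solve the linear system τ = 2 C, of determinant N³ - A² + 9 C²
        -- = 12 C², which is invertible along with 2 C and 3.
        fixed⇒scalar : (θ : Carrier) → θ * ι (+ 3) ≈ 1# → ∀ x → σ x ≈ᴷ x → scalar (proj₁ x) ≈ᴷ x
        fixed⇒scalar θ 3θ x@(x₀ , x₁ , x₂) fixed = refl , sym (vanish x₁ 12C²x₁) , sym (vanish x₂ 12C²x₂)
          where
          κ2C : κ * (ι (+ 2) * C) ≈ ι (+ 1)
          κ2C = trans κ2C≈1 (sym (RingMorphisms.IsRingHomomorphism.1#-homo homomorphism))
          fixed′ : (κ * F.τ x .proj₁ , κ * F.τ x .proj₂ .proj₁ , κ * F.τ x .proj₂ .proj₂) ≈ᴷ x
          fixed′ = K.trans (K.sym (scalar-*ᴷ κ (F.τ x))) fixed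
          e₁ : (A - C) * x₁ + N * N * x₂ ≈ ι (+ 2) * C * x₁
          e₁ = solve₂ (κ ∷ C ∷ (A - C) * x₁ + N * N * x₂ ∷ x₁ ∷ []) (λ k C t x → (t := # 2 :* C :* x) , (# 2 :* C , (k :* t := x)) , :- t , (k :* (# 2 :* C) := # 1)) ≡.refl (proj₁ (proj₂ fixed′)) κ2C
          e₂ : - (N * x₁) - (A + C) * x₂ ≈ ι (+ 2) * C * x₂
          e₂ = solve₂ (κ ∷ C ∷ - (N * x₁) - (A + C) * x₂ ∷ x₂ ∷ []) (λ k C t x → (t := # 2 :* C :* x) , (# 2 :* C , (k :* t := x)) , :- t , (k :* (# 2 :* C) := # 1)) ≡.refl (proj₂ (proj₂ fixed′)) κ2C
          12C²x₁ : ι (+ 12) * (C * C) * x₁ ≈ ι (+ 0)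
          12C²x₁ = trans (solve₂ (N ∷ A ∷ C ∷ x₁ ∷ x₂ ∷ []) (λ N A C x y → (# 12 :* (C :* C) :* x := (A :* A :+ # 3 :* (C :* C) :- N :* N :* N) :* x) ,
              (:- (A :+ # 3 :* C) , ((A :- C) :* x :+ N :* N :* y := # 2 :* C :* x)) , :- (N :* N) , (:- (N :* x) :- (A :+ C) :* y := # 2 :* C :* y)) ≡.refl e₁ e₂)
            (solve₁ (N ∷ A ∷ C ∷ x₁ ∷ []) (λ N A C x → ((A :* A :+ # 3 :* (C :* C) :- N :* N :* N) :* x := # 0) , :- x , (N :* N :* N := A :* A :+ # 3 :* (C :* C))) ≡.refl N³)
          12C²x₂ : ι (+ 12) * (C * C) * x₂ ≈ ι (+ 0)
          12C²x₂ = trans (solve₂ (N ∷ A ∷ C ∷ x₁ ∷ x₂ ∷ []) (λ N A C x y → (# 12 :* (C :* C) :* y := (A :* A :+ # 3 :* (C :* C) :- N :* N :* N) :* y) ,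
              (N , ((A :- C) :* x :+ N :* N :* y := # 2 :* C :* x)) , A :- # 3 :* C , (:- (N :* x) :- (A :+ C) :* y := # 2 :* C :* y)) ≡.refl e₁ e₂)
            (solve₁ (N ∷ A ∷ C ∷ x₂ ∷ []) (λ N A C x → ((A :* A :+ # 3 :* (C :* C) :- N :* N :* N) :* x := # 0) , :- x , (N :* N :* N := A :* A :+ # 3 :* (C :* C))) ≡.refl N³)
          vanish : ∀ y → ι (+ 12) * (C * C) * y ≈ ι (+ 0) → y ≈ 0#
          vanish y e = trans (trans (sym (*-identityˡ y)) (trans (*-congʳ (sym 3θ)) (trans (solve₂ (θ ∷ κ ∷ C ∷ y ∷ []) (λ θ k C y → (θ :* # 3 :* y := # 0) ,
            (:- (θ :* # 3 :* y :* (k :* (# 2 :* C) :+ # 1)) , (k :* (# 2 :* C) := # 1)) , θ :* k :* k , (# 12 :* (C :* C) :* y := # 0)) ≡.refl κ2C e) refl)))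
            (RingMorphisms.IsRingHomomorphism.0#-homo homomorphism)

    module Field (_≟_ : Decidable _≈_)
                 (1≉0 : ¬ 1# ≈ 0#)
                 (invert : ∀ x → ¬ x ≈ 0# → ∃ λ y → x * y ≈ 1#)
                 (anisotropic : ∀ x → norm x ≈ 0# → x ≈ᴷ scalar 0#)
      where

      private
        decSetoid : DecSetoid 0ℓ 0ℓ
        decSetoid = record
          { Carrier = Element
          ; _≈_ = _≈ᴷ_
          ; isDecEquivalence = record { isEquivalence = K.isEquivalence ; _≟_ = λ (x₀ , x₁ , x₂) (y₀ , y₁ , y₂) → (x₀ ≟ y₀) ×-dec (x₁ ≟ y₁) ×-dec (x₂ ≟ y₂) }
          }

        abstract
          invertᴷ : ∀ x → ¬ x ≈ᴷ K.0# → ∃ λ y → (y *ᴷ x ≈ᴷ K.1#) × (x *ᴷ y ≈ᴷ K.1#)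
          invertᴷ x x≉0 with invert (norm x) (λ e → x≉0 (anisotropic x e))
          ... | y , ny≈1 = adjugate x *ᴷ scalar y , K.trans (K.*-comm (adjugate x *ᴷ scalar y) x) x*y , x*y
            where
            x*y : x *ᴷ (adjugate x *ᴷ scalar y) ≈ᴷ K.1#
            x*y = K.trans (K.sym (K.*-assoc x (adjugate x) (scalar y))) (K.trans (K.*-congʳ {scalar y} (*-adjugate x))
              (K.trans (K.sym (scalar-* (norm x) y)) (ny≈1 , refl , refl)))

      open import Algebra.Properties.Group K.+-group using () renaming (x∙y⁻¹≈ε⇒x≈y to x-y≈0⇒x≈y)

      heytingField : HeytingField 0ℓ 0ℓ 0ℓ
      heytingField = record
        { _#_ = λ x y → ¬ x ≈ᴷ y
        ; isHeytingField = record
          { isHeytingCommutativeRing = record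
            { isCommutativeRing = K.isCommutativeRing
            ; isApartnessRelation = DecSetoidProperties.≉-isApartnessRelation decSetoid
            ; #⇒invertible = λ {x} {y} x≉y → invertᴷ (x K.- y) (λ e → x≉y (x-y≈0⇒x≈y x y e))
            ; invertible⇒# = λ {x} {y} (z , zx , _) x≈y → 1≉0 (proj₁ (K.trans (K.sym zx)
                (K.trans (K.*-congˡ {z} (K.trans (K.+-congʳ {K.- y} x≈y) (K.-‿inverseʳ y))) (K.zeroʳ z))))
            }
          ; tight = DecSetoidProperties.≉-tight decSetoid
          }
        }

-- The embedding of ℤ in ℚ and common denominators

module IntegersInRationals where

  open PolynomialIdentities hiding (solve; solve₁; solve₂; prove; ⟦_⟧)
  open import Algebra.Bundles using (CommutativeRing)
  open import Algebra.Morphism.Structures using (module RingMorphisms)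
  open import Data.Integer.Base as ℤ using (ℤ; +_)
  import Data.Integer.Properties as ℤ
  open import Data.Nat.Base as ℕ using (ℕ)
  import Data.Nat.Properties as ℕ
  open import Data.Product.Base using (∃; _,_)
  open import Data.Rational.Base using (ℚ; mkℚ; toℚᵘ; _+_; _*_; -_; 0ℚ; 1ℚ; ↥_; ↧_; 1/_; ≢-nonZero)
  open import Data.Rational.Literals using (fromℤ)
  import Data.Rational.Properties as ℚ
  import Data.Rational.Unnormalised.Base as ℚᵘ
  open import Data.Rational.Unnormalised.Base using (*≡*; _≃_)
  import Data.Rational.Unnormalised.Properties as ℚᵘ
  open import Relation.Binary.PropositionalEquality

  private
    ≃⇒≡ : ∀ {p q} → toℚᵘ p ≃ toℚᵘ q → p ≡ q
    ≃⇒≡ = ℚ.toℚᵘ-injective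

  abstract
    fromℤ-injective : ∀ {x y} → fromℤ x ≡ fromℤ y → x ≡ y
    fromℤ-injective e = cong ↥_ e

    fromℤ-+ : ∀ x y → fromℤ (x ℤ.+ y) ≡ fromℤ x + fromℤ y
    fromℤ-+ x y = ≃⇒≡ (ℚᵘ.≃-trans (*≡* (cong (ℤ._* + 1) (sym (cong₂ ℤ._+_ (ℤ.*-identityʳ x) (ℤ.*-identityʳ y))))) (ℚᵘ.≃-sym (ℚ.toℚᵘ-homo-+ (fromℤ x) (fromℤ y))))

    fromℤ-* : ∀ x y → fromℤ (x ℤ.* y) ≡ fromℤ x * fromℤ y
    fromℤ-* x y = ≃⇒≡ (ℚᵘ.≃-trans (*≡* refl) (ℚᵘ.≃-sym (ℚ.toℚᵘ-homo-* (fromℤ x) (fromℤ y))))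

    fromℤ-neg : ∀ x → fromℤ (ℤ.- x) ≡ - fromℤ x
    fromℤ-neg x = ≃⇒≡ (ℚᵘ.≃-trans (*≡* refl) (ℚᵘ.≃-sym (ℚ.toℚᵘ-homo‿- (fromℤ x))))

    clear-denominator : ∀ q → fromℤ (↧ q) * q ≡ fromℤ (↥ q)
    clear-denominator q@(mkℚ n d-1 _) = ≃⇒≡ (ℚᵘ.≃-trans (ℚ.toℚᵘ-homo-* (fromℤ (↧ q)) q)
      (*≡* (trans (ℤ.*-identityʳ (↧ q ℤ.* n)) (trans (ℤ.*-comm (↧ q) n) (cong (n ℤ.*_) (sym (ℤ.*-identityˡ (↧ q))))))))

  ℚ-ring : CommutativeRing _ _
  ℚ-ring = ℚ.+-*-commutativeRing

  fromℤ-isRingHomomorphism : RingMorphisms.IsRingHomomorphism (CommutativeRing.rawRing ℤ.+-*-commutativeRing) (CommutativeRing.rawRing ℚ-ring) fromℤ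
  fromℤ-isRingHomomorphism = record
    { isSemiringHomomorphism = record
      { isNearSemiringHomomorphism = record
        { +-isMonoidHomomorphism = record
          { isMagmaHomomorphism = record
            { isRelHomomorphism = record { cong = cong fromℤ }
            ; homo = fromℤ-+ }
          ; ε-homo = refl }
        ; *-homo = fromℤ-* }
      ; 1#-homo = refl }
    ; -‿homo = fromℤ-neg }

  abstract
    invert : ∀ x → x ≢ 0ℚ → ∃ λ y → x * y ≡ 1ℚ
    invert x x≢0 = (1/ x) {{≢-nonZero x≢0}} , ℚ.*-inverseʳ x {{≢-nonZero x≢0}}

    *≡0⇒≡0 : ∀ d x → d ≢ + 0 → fromℤ d * x ≡ 0ℚ → x ≡ 0ℚ
    *≡0⇒≡0 d x d≢0 e with invert (fromℤ d) (λ h → d≢0 (fromℤ-injective h))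
    ... | y , dy≡1 = begin
      x                    ≡⟨ ℚ.*-identityʳ x ⟨
      x * 1ℚ               ≡⟨ cong (x *_) dy≡1 ⟨
      x * (fromℤ d * y)    ≡⟨ ℚ.*-assoc x (fromℤ d) y ⟨
      x * fromℤ d * y      ≡⟨ cong (_* y) (trans (ℚ.*-comm x (fromℤ d)) e) ⟩
      0ℚ * y               ≡⟨ ℚ.*-zeroˡ y ⟩
      0ℚ                   ∎
      where open ≡-Reasoning

  record Cleared (x y z : ℚ) : Set where
    field
      d p q r : ℤ
      d≢0     : d ≢ + 0
      x≡      : fromℤ d * x ≡ fromℤ p
      y≡      : fromℤ d * y ≡ fromℤ q
      z≡      : fromℤ d * z ≡ fromℤ r

  abstract
    clear : ∀ x y z → Cleared x y z
    clear x y z = record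
      { d = ↧ x ℤ.* (↧ y ℤ.* ↧ z) ; p = ↥ x ℤ.* (↧ y ℤ.* ↧ z) ; q = ↥ y ℤ.* (↧ z ℤ.* ↧ x) ; r = ↥ z ℤ.* (↧ x ℤ.* ↧ y)
      ; d≢0 = λ ()
      ; x≡ = one x (↧ y ℤ.* ↧ z)
      ; y≡ = trans (cong (λ d → fromℤ d * y) (trans (sym (ℤ.*-comm (↧ y ℤ.* ↧ z) (↧ x))) (ℤ.*-assoc (↧ y) (↧ z) (↧ x)))) (one y (↧ z ℤ.* ↧ x))
      ; z≡ = trans (cong (λ d → fromℤ d * z) (trans (sym (ℤ.*-assoc (↧ x) (↧ y) (↧ z))) (ℤ.*-comm (↧ x ℤ.* ↧ y) (↧ z)))) (one z (↧ x ℤ.* ↧ y)) }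
      where
      one : ∀ x k → fromℤ (↧ x ℤ.* k) * x ≡ fromℤ (↥ x ℤ.* k)
      one x k = begin
        fromℤ (↧ x ℤ.* k) * x           ≡⟨ cong (_* x) (trans (cong fromℤ (ℤ.*-comm (↧ x) k)) (fromℤ-* k (↧ x))) ⟩
        fromℤ k * fromℤ (↧ x) * x       ≡⟨ ℚ.*-assoc (fromℤ k) (fromℤ (↧ x)) x ⟩
        fromℤ k * (fromℤ (↧ x) * x)     ≡⟨ cong (fromℤ k *_) (clear-denominator x) ⟩
        fromℤ k * fromℤ (↥ x)           ≡⟨ fromℤ-* k (↥ x) ⟨
        fromℤ (k ℤ.* ↥ x)               ≡⟨ cong fromℤ (ℤ.*-comm k (↥ x)) ⟩
        fromℤ (↥ x ℤ.* k)               ∎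
        where open ≡-Reasoning

-- Cyclic cubic number fields from anisotropic norm forms

module CubicFields where

  open PolynomialIdentities using (var; #; _:+_; _:*_; module Evaluation)
  open RamifiedForm using (Rf)
  open CubicAlgebras using (module IntegralForm)
  open CyclicCubics using (module CyclicCubic)
  open IntegersInRationals
  open import Data.Fin.Patterns using (0F; 1F; 2F)
  open import Data.Integer.Base as ℤ using (ℤ; +_)
  import Data.Integer.Properties as ℤ
  open import Data.Product.Base using (∃; _×_; _,_; proj₁; proj₂)
  open import Data.Rational.Base using (ℚ; _+_; _*_; 0ℚ; 1ℚ)
  open import Data.Rational.Literals using (fromℤ)
  import Data.Rational.Properties as ℚ
  open import Data.Sum.Base using ([_,_]′)
  open import Data.Vec.Base using ([]; _∷_)
  open import Data.Vec.Functional using (Vector)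
  open import Relation.Binary.PropositionalEquality

  module RationalForm (N A : ℤ) where
    open CyclicCubic ℚ-ring fromℤ fromℤ-isRingHomomorphism (fromℤ N) (fromℤ A)

    abstract
      -- The form is homogeneous of degree 3, so a common denominator turns a rational zero into an
      -- integral one.
      form-anisotropic : ∀ M L → (∀ {x y w} → Rf M L N A x y w ≡ + 0 → x ≡ + 0 × y ≡ + 0 × w ≡ + 0) →
                         ∀ x y w → form (fromℤ M) (fromℤ L) x y w ≡ 0ℚ → x ≡ 0ℚ × y ≡ 0ℚ × w ≡ 0ℚ
      form-anisotropic M L integral x y w e = conclude (integral integral-zero)
        where
        open Cleared (clear x y w)
        integral-zero : Rf M L N A p q r ≡ + 0
        integral-zero = fromℤ-injective (trans (sym (IntegralForm.form-ι ℚ-ring fromℤ fromℤ-isRingHomomorphism N A M L p q r))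
          (trans (form-cong (fromℤ M) (fromℤ L) (sym x≡) (sym y≡) (sym z≡)) (trans (form-homogeneous (fromℤ M) (fromℤ L) (fromℤ d) x y w)
            (trans (cong (λ z → fromℤ d * (fromℤ d * (fromℤ d * z))) e) (trans (cong (λ z → fromℤ d * (fromℤ d * z)) (ℚ.*-zeroʳ (fromℤ d)))
              (trans (cong (fromℤ d *_) (ℚ.*-zeroʳ (fromℤ d))) (ℚ.*-zeroʳ (fromℤ d))))))))
        conclude : p ≡ + 0 × q ≡ + 0 × r ≡ + 0 → x ≡ 0ℚ × y ≡ 0ℚ × w ≡ 0ℚ
        conclude (p≡0 , q≡0 , r≡0) = *≡0⇒≡0 d x d≢0 (trans x≡ (cong fromℤ p≡0)) , *≡0⇒≡0 d y d≢0 (trans y≡ (cong fromℤ q≡0)) , *≡0⇒≡0 d w d≢0 (trans z≡ (cong fromℤ r≡0))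

  -- `N³` makes the discriminant a square, `C≢0` makes it nonzero, and `anisotropic` makes the
  -- algebra a field by providing inverses.
  record CubicData : Set where
    field
      N A C       : ℤ
      N³          : N ℤ.* N ℤ.* N ≡ A ℤ.* A ℤ.+ + 3 ℤ.* (C ℤ.* C)
      C≢0         : C ≢ + 0
      anisotropic : ∀ {x y w} → Rf (+ 1) (+ 1) N A x y w ≡ + 0 → x ≡ + 0 × y ≡ + 0 × w ≡ + 0

  module CubicField (D : CubicData) where
    open CubicData D

    module Algebra = CyclicCubic ℚ-ring fromℤ fromℤ-isRingHomomorphism (fromℤ N) (fromℤ A)
    open Algebra using (norm; scalar; _≈ᴷ_; module K; X; Y; coordinates)

    private
      abstract
        norm-anisotropic : ∀ x → norm x ≡ 0ℚ → x ≈ᴷ scalar 0ℚ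
        norm-anisotropic (x₀ , x₁ , x₂) e = let (h₁ , h₂ , h₀) = RationalForm.form-anisotropic N A (+ 1) (+ 1) anisotropic x₁ x₂ x₀ e in h₀ , h₁ , h₂

        N³′ : fromℤ N * fromℤ N * fromℤ N ≡ fromℤ A * fromℤ A + fromℤ (+ 3) * (fromℤ C * fromℤ C)
        N³′ = trans (⟦⟧-ι (var 0F :* var 0F :* var 0F) (N ∷ A ∷ C ∷ [])) (trans (cong fromℤ N³) (sym (⟦⟧-ι (var 1F :* var 1F :+ # 3 :* (var 2F :* var 2F)) (N ∷ A ∷ C ∷ []))))
          where open Evaluation ℚ-ring fromℤ fromℤ-isRingHomomorphism

        1≢0 : 1ℚ ≢ 0ℚ
        1≢0 ()

        inverse-2C : ∃ λ κ → fromℤ (+ 2) * fromℤ C * κ ≡ 1ℚ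
        inverse-2C = invert (fromℤ (+ 2) * fromℤ C) (λ e → [ (λ ()) , C≢0 ]′ (ℤ.i*j≡0⇒i≡0∨j≡0 (+ 2) (fromℤ-injective (trans (fromℤ-* (+ 2) C) e))))

        third : ∃ λ θ → fromℤ (+ 3) * θ ≡ 1ℚ
        third = invert (fromℤ (+ 3)) (λ ())

      κ : ℚ
      κ = proj₁ inverse-2C

      κ2C : κ * (fromℤ (+ 2) * fromℤ C) ≡ 1ℚ
      κ2C = trans (ℚ.*-comm κ _) (proj₂ inverse-2C)

    module Automorphism = Algebra.Automorphism (fromℤ C) κ κ2C N³′
    open Algebra.Field ℚ._≟_ 1≢0 invert norm-anisotropic public using (heytingField)

    extension : Extensionℚ
    extension = record { K = heytingField ; ι = scalar ; isHomomorphism = Algebra.scalar-isRingHomomorphism }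

    open Extensionℚ extension using (HasDegree; IsGalois; Carrier)

    private
      basis : Vector Carrier 3
      basis 0F = K.1#
      basis 1F = X
      basis 2F = Y

    degree : HasDegree 3
    degree = basis
      , (λ q e → independent q (K.trans (K.sym (coordinates (q 0F) (q 1F) (q 2F))) e))
      , (λ { (x₀ , x₁ , x₂) → (λ { 0F → x₀ ; 1F → x₁ ; 2F → x₂ }) , coordinates x₀ x₁ x₂ })
      where
      independent : ∀ q → (q 0F , q 1F , q 2F) ≈ᴷ scalar 0ℚ → ∀ i → q i ≡ 0ℚ
      independent q (e , _ , _) 0F = e
      independent q (_ , e , _) 1F = e
      independent q (_ , _ , e) 2F = e

    isGalois : IsGalois
    isGalois x fixed = proj₁ x , Automorphism.fixed⇒scalar (proj₁ third) (trans (ℚ.*-comm (proj₁ third) _) (proj₂ third)) x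
      (fixed Automorphism.σ (Automorphism.σ-isRingIsomorphism , Automorphism.σ-scalar))

    field′ : CyclicCubicField
    field′ = record { extension = extension ; cubic = degree ; galois = isGalois }

-- Ramification at q, and the sequence of points that defines the fields

module Nodes where

  open PolynomialIdentities
  open PrimeDivisibility
  open RamifiedForm using (Rf; :R; module Ramified; ⟪_⟫)
  open ConcordantForms using (prime[2])
  open CubesOnG using (module G; cubic; :cubic; Point; *-≢0; Ramification; cube-or-ramified; module Cubic; module NotACube)
  open GroupLawOnG using (∣-*; *-∣; ∣--; ∣-+⁻ˡ; ∣-≡)
  open Chords using (point-near-O)
  open CubicFields using (CubicData)
  open import Data.Nat.Base as ℕ using (ℕ; zero; suc)
  import Data.Nat.Properties as ℕ
  import Data.Nat.Divisibility as ℕ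
  open import Data.Nat.Primality using (Prime; prime?; prime⇒nonZero)
  open import Data.Integer.Base hiding (suc)
  open import Data.Integer.Properties
  open import Data.Integer.Divisibility.Signed renaming (_∣_ to _∣ˢ_)
  open import Data.Product.Base using (∃; _×_; _,_; proj₁; proj₂)
  open import Data.Sum.Base using (_⊎_; inj₁; inj₂; [_,_]′)
  open import Data.Empty using (⊥; ⊥-elim)
  open import Data.Vec.Base using ([]; _∷_)
  open import Relation.Nullary
  open import Relation.Nullary.Decidable using (from-yes)
  open import Function.Base using (_∘_; id)
  open import Relation.Binary.PropositionalEquality hiding (J)

  record Node : Set where
    field
      S    : Point
      2∣e  : + 2 ∣ˢ Point.e S
      3∣e  : + 3 ∣ˢ Point.e S
      19∣e : + 19 ∣ˢ Point.e S

  abstract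
    signed : ∀ x {m} → ∣ x ∣ ≡ m → ∃ λ ε → x ≡ ε * + m × ε * ε ≡ 1ℤ
    signed (+ n)    refl = 1ℤ , sym (*-identityˡ (+ n)) , refl
    signed -[1+ n ] refl = -1ℤ , sym (-1*i≡-i (+ suc n)) , refl

    -- The substitution X = s X′. It removes the cube s³ from A and leaves only the one or two
    -- factors q that cause the ramification.
    rescale : ∀ M L N A s x y w → Rf M L (s * s * N) (s * s * s * A) x y w ≡ Rf M L N A (s * x) (s * s * y) w
    rescale M L N A s x y w = solve (M ∷ L ∷ N ∷ A ∷ s ∷ x ∷ y ∷ w ∷ []) (λ M L N A s x y w →
      :R M L (s :* s :* N) (s :* s :* s :* A) x y w := :R M L N A (s :* x) (s :* s :* y) w) refl

    discriminant : ∀ a e n → n * n ≡ cubic a e → let open Cubic a e n in N * N * N ≡ A * A + + 3 * (a * k * (a * k))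
    discriminant a e n = solve₁ (a ∷ e ∷ n ∷ []) (λ a e n → let t = a :+ # 12 :* (e :* e) ; P = a :* a :- # 36 :* (a :* (e :* e)) :+ # 108 :* (e :* e :* (e :* e)) in
      (a :* t :* (a :* t) :* (a :* t) := a :* P :* (a :* P) :+ # 3 :* (a :* (# 6 :* (e :* n)) :* (a :* (# 6 :* (e :* n))))) ,
      :- # 108 :* (a :* a :* (e :* e)) , (n :* n := :cubic a e)) refl

  module _ (node : Node) where
    open Node node
    open Point S
    open Cubic a e n public

    a≢0 : a ≢ 0ℤ
    a≢0 a≡0 = coprime prime[2] (divides 0ℤ a≡0) 2∣e

    abstract
      ramification : Ramification ∣ a ∣
      ramification = [ (λ (b , a≡b³) → ⊥-elim (cube b a≡b³)) , id ]′ (cube-or-ramified (∣ a ∣) (a≢0 ∘ ∣i∣≡0⇒i≡0))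
        where
        cube : ∀ b → ∣ a ∣ ≡ b ℕ.* b ℕ.* b → ⊥
        cube b e with signed a e
        ... | ε , a≡ , ε² = NotACube.not-a-cube S 2∣e 3∣e 19∣e (ε * + b) (trans a≡ (trans (cong (ε *_) (trans (pos-* (b ℕ.* b) b) (cong (_* + b) (pos-* b b))))
          (solve₁ (ε ∷ + b ∷ []) (λ ε b → (ε :* (b :* b :* b) := ε :* b :* (ε :* b) :* (ε :* b)) , :- (ε :* b :* b :* b) , (ε :* ε := # 1)) refl ε²)))

    open Ramification ramification public using (q; q-prime)
    open Ramification ramification using (s; a′; q∤a′; shape)

    private
      t : ℤ
      t = a + + 12 * (e * e)

      Shape : ℤ → Set
      Shape b = a ≡ + s * + s * + s * (+ q * b) ⊎ a ≡ + s * + s * + s * (+ q * (+ q * b))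

      abstract
        integral : ∃ λ b → (¬ + q ∣ˢ b) × Shape b
        integral = [ (λ e → one (signed a e)) , (λ e → two (signed a e)) ]′ shape
          where
          unit : ∀ ε → ε * ε ≡ 1ℤ → ¬ + q ∣ˢ ε * + a′
          unit ε ε² d = q∤a′ (∣⇒∣ᵤ (∣-≡ (trans (sym (*-assoc ε ε (+ a′))) (trans (cong (_* + a′) ε²) (*-identityˡ (+ a′)))) (*-∣ ε (ε * + a′) d)))
          s³ : + (s ℕ.* s ℕ.* s) ≡ + s * + s * + s
          s³ = trans (pos-* (s ℕ.* s) s) (cong (_* + s) (pos-* s s))
          one : (∃ λ ε → a ≡ ε * + (s ℕ.* s ℕ.* s ℕ.* (q ℕ.* a′)) × ε * ε ≡ 1ℤ) → ∃ λ b → (¬ + q ∣ˢ b) × Shape b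
          one (ε , a≡ , ε²) = ε * + a′ , unit ε ε² , inj₁ (trans a≡ (trans (cong (ε *_) (trans (pos-* (s ℕ.* s ℕ.* s) (q ℕ.* a′)) (cong₂ _*_ s³ (pos-* q a′))))
            (solve (ε ∷ + s ∷ + q ∷ + a′ ∷ []) (λ ε s q a → ε :* (s :* s :* s :* (q :* a)) := s :* s :* s :* (q :* (ε :* a))) refl)))
          two : (∃ λ ε → a ≡ ε * + (s ℕ.* s ℕ.* s ℕ.* (q ℕ.* (q ℕ.* a′))) × ε * ε ≡ 1ℤ) → ∃ λ b → (¬ + q ∣ˢ b) × Shape b
          two (ε , a≡ , ε²) = ε * + a′ , unit ε ε² , inj₂ (trans a≡ (trans (cong (ε *_) (trans (pos-* (s ℕ.* s ℕ.* s) (q ℕ.* (q ℕ.* a′))) (cong₂ _*_ s³ (trans (pos-* q (q ℕ.* a′)) (cong (+ q *_) (pos-* q a′))))))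
            (solve (ε ∷ + s ∷ + q ∷ + a′ ∷ []) (λ ε s q a → ε :* (s :* s :* s :* (q :* (q :* a))) := s :* s :* s :* (q :* (q :* (ε :* a)))) refl)))

      b : ℤ
      b = proj₁ integral

      abstract
        s≢0 : + s ≢ 0ℤ
        s≢0 s≡0 = a≢0 ([ vanish , vanish ]′ (proj₂ (proj₂ integral)))
          where
          vanish : ∀ {x} → a ≡ + s * + s * + s * x → a ≡ 0ℤ
          vanish {x} e = trans e (cong (λ s → s * s * s * x) s≡0)

        q∣a : + q ∣ˢ a
        q∣a = [ (λ e → ∣-≡ (sym e) (*-∣ (+ s * + s * + s) (+ q * b) (∣-* (+ q) b ∣-refl)))
              , (λ e → ∣-≡ (sym e) (*-∣ (+ s * + s * + s) (+ q * (+ q * b)) (∣-* (+ q) (+ q * b) ∣-refl))) ]′ (proj₂ (proj₂ integral))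

        q∤e : ¬ + q ∣ˢ e
        q∤e = coprime q-prime q∣a

        -- P ≡ 108 e⁴ modulo a, where 108 = 2² · 3³; q is prime to e and hence to 6.
        q∤P : ¬ + q ∣ˢ P
        q∤P d = [ (λ d → [ (λ d → q∤e (∣-trans (prime-∣² q-prime {+ 2} d) 2∣e)) , (λ d → q∤e (∣-trans (prime-∣³ q-prime {+ 3} d) 3∣e)) ]′ (prime-∣* q-prime {+ 4} {+ 27} d))
                , (λ d → q∤e (prime-∣² q-prime {e} (prime-∣² q-prime {e * e} d))) ]′ (prime-∣* q-prime {+ 108} {e * e * (e * e)}
          (∣-≡ (solve (a ∷ e ∷ []) (λ a e → a :* a :- # 36 :* (a :* (e :* e)) :+ # 108 :* (e :* e :* (e :* e)) :- a :* (a :- # 36 :* (e :* e)) := # 108 :* (e :* e :* (e :* e))) refl)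
            (∣-- P (a * (a - + 36 * (e * e))) d (∣-* a (a - + 36 * (e * e)) q∣a))))

    abstract
      q∤2 : ¬ + q ∣ˢ + 2
      q∤2 d = q∤e (∣-trans d 2∣e)

      -- The norm form is anisotropic at q because q is totally ramified.
      ramified : ∀ M L → ¬ + q ∣ˢ M → ∀ {x y w} → Rf M L N A x y w ≡ 0ℤ → x ≡ 0ℤ × y ≡ 0ℤ × w ≡ 0ℤ
      ramified M L q∤M {x} {y} {w} e = [ one , two ]′ (proj₂ (proj₂ integral))
        where
        q∤bP : ¬ + q ∣ˢ b * P
        q∤bP d = [ proj₁ (proj₂ integral) , q∤P ]′ (prime-∣* q-prime d)
        cancel : + s * x ≡ 0ℤ × + s * + s * y ≡ 0ℤ × w ≡ 0ℤ → x ≡ 0ℤ × y ≡ 0ℤ × w ≡ 0ℤ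
        cancel (h , h′ , h″) = [ ⊥-elim ∘ s≢0 , id ]′ (i*j≡0⇒i≡0∨j≡0 (+ s) h)
          , [ ⊥-elim ∘ *-≢0 {+ s} s≢0 s≢0 , id ]′ (i*j≡0⇒i≡0∨j≡0 (+ s * + s) h′) , h″
        rescaled : ∀ N′ A′ → N ≡ + s * + s * N′ → A ≡ + s * + s * + s * A′ → Rf M L N′ A′ (+ s * x) (+ s * + s * y) w ≡ 0ℤ
        rescaled N′ A′ N≡ A≡ = trans (sym (rescale M L N′ A′ (+ s) x y w)) (trans (cong₂ (λ N A → Rf M L N A x y w) (sym N≡) (sym A≡)) e)
        one : a ≡ + s * + s * + s * (+ q * b) → x ≡ 0ℤ × y ≡ 0ℤ × w ≡ 0ℤ
        -- N = a t contains s³ as well, but rescaling takes only s² from it; the remaining factor s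
        -- stays in the new N.
        one a≡ = cancel (Ramified.anisotropic₁ q-prime q∤2 M L (+ s * (b * t)) (b * P) q∤M q∤bP
          ⟪ rescaled (+ q * (+ s * (b * t))) (+ q * (b * P))
            (trans (cong (_* t) a≡) (solve (+ s ∷ + q ∷ b ∷ t ∷ []) (λ s q b t → s :* s :* s :* (q :* b) :* t := s :* s :* (q :* (s :* (b :* t)))) refl))
            (trans (cong (_* P) a≡) (solve (+ s ∷ + q ∷ b ∷ P ∷ []) (λ s q b P → s :* s :* s :* (q :* b) :* P := s :* s :* s :* (q :* (b :* P))) refl)) ⟫)
        two : a ≡ + s * + s * + s * (+ q * (+ q * b)) → x ≡ 0ℤ × y ≡ 0ℤ × w ≡ 0ℤ
        two a≡ = cancel (Ramified.anisotropic₂ q-prime q∤2 M L (+ s * (b * t)) (b * P) q∤M q∤bP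
          ⟪ rescaled (+ q * (+ q * (+ s * (b * t)))) (+ q * (+ q * (b * P)))
            (trans (cong (_* t) a≡) (solve (+ s ∷ + q ∷ b ∷ t ∷ []) (λ s q b t → s :* s :* s :* (q :* (q :* b)) :* t := s :* s :* (q :* (q :* (s :* (b :* t))))) refl))
            (trans (cong (_* P) a≡) (solve (+ s ∷ + q ∷ b ∷ P ∷ []) (λ s q b P → s :* s :* s :* (q :* (q :* b)) :* P := s :* s :* s :* (q :* (q :* (b :* P)))) refl)) ⟫)

      C≢0 : a * k ≢ 0ℤ
      C≢0 = *-≢0 {a} a≢0 (*-≢0 {+ 6} (λ ()) (*-≢0 {e} e≢0 n≢0))
        where
        n≢0 : n ≢ 0ℤ
        n≢0 n≡0 = coprime prime[2] (prime-∣³ prime[2] {a} (∣-+⁻ˡ (a * a * a) (e * e * G.cubic-a³ a (e * e))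
          (∣-≡ (G.cubic≈a³ a (e * e)) (∣-≡ curve (∣-* n n (divides 0ℤ n≡0)))) (∣-* (e * e) (G.cubic-a³ a (e * e)) (∣-* e e 2∣e)))) 2∣e

      -- Modulo p one has P ≡ a² and A ≡ a³, a unit. The number - 2 A is the coefficient M with
      -- which the form of another field is tested.
      unramified : ∀ {p} → Prime p → + p ∣ˢ e → ¬ + p ∣ˢ + 2 → ¬ + p ∣ˢ - (+ 2 * A)
      unramified {p} pp p∣e p∤2 d = [ p∤2 , (λ d → [ p∤a , p∤P ]′ (prime-∣* pp {a} {P} d)) ]′
        (prime-∣* pp {+ 2} {A} (∣-≡ (neg-involutive (+ 2 * A)) (∣m⇒∣-m {m = - (+ 2 * A)} d)))
        where
        p∤a : ¬ + p ∣ˢ a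
        p∤a p∣a = coprime pp p∣a p∣e
        p∤P : ¬ + p ∣ˢ P
        p∤P d = p∤a (prime-∣² pp {a} (∣-≡ (solve (a ∷ e ∷ []) (λ a e → a :* a :- # 36 :* (a :* (e :* e)) :+ # 108 :* (e :* e :* (e :* e)) :- e :* (# 108 :* (e :* (e :* e)) :- # 36 :* (a :* e)) := a :* a) refl)
          (∣-- P (e * (+ 108 * (e * (e * e)) - + 36 * (a * e))) d (∣-* e (+ 108 * (e * (e * e)) - + 36 * (a * e)) p∣e))))

    cubicData : CubicData
    cubicData = record
      { N = N ; A = A ; C = a * k
      ; N³ = discriminant a e n curve
      ; C≢0 = C≢0
      ; anisotropic = ramified 1ℤ 1ℤ (λ d → q∤2 (∣-* 1ℤ (+ 2) d))
      }

  -- 114 = 2 · 3 · 19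
  Modulus : Set
  Modulus = ∃ λ M → ℕ.NonZero M × 114 ℕ.∣ M

  abstract
    nodeOver : Modulus → Node
    nodeOver (M , M≢0 , 114∣M) = record
      { S = proj₁ point
      ; 2∣e = proj₂ point (from-yes (prime? 2)) (ℕ.∣-trans (ℕ.divides 57 refl) 114∣M)
      ; 3∣e = proj₂ point (from-yes (prime? 3)) (ℕ.∣-trans (ℕ.divides 38 refl) 114∣M)
      ; 19∣e = proj₂ point (from-yes (prime? 19)) (ℕ.∣-trans (ℕ.divides 6 refl) 114∣M) }
      where
      point : ∃ λ (S : Point) → ∀ {p} → Prime p → p ℕ.∣ M → + p ∣ˢ Point.e S
      point = point-near-O M M≢0

    prime-∣e : ∀ m {p} → Prime p → p ℕ.∣ proj₁ m → + p ∣ˢ Point.e (Node.S (nodeOver m))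
    prime-∣e (M , M≢0 , _) = proj₂ (point-near-O M M≢0)

    first : Modulus
    first = 114 , _ , ℕ.∣-refl

    next : Modulus → Modulus
    next m@(M , M≢0 , 114∣M) = M ℕ.* q (nodeOver m) , ℕ.m*n≢0 M (q (nodeOver m)) {{M≢0}} {{prime⇒nonZero (q-prime (nodeOver m))}} , ℕ.∣m⇒∣m*n (q (nodeOver m)) 114∣M

    q∣next : ∀ m → q (nodeOver m) ℕ.∣ proj₁ (next m)
    q∣next m = ℕ.n∣m*n (proj₁ m) {q (nodeOver m)}

    ∣next : ∀ m → proj₁ m ℕ.∣ proj₁ (next m)
    ∣next m = ℕ.m∣m*n {proj₁ m} (q (nodeOver m))

  modulus : ℕ → Modulus
  modulus zero    = first
  modulus (suc i) = next (modulus i)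

  nodes : ℕ → Node
  nodes i = nodeOver (modulus i)

  abstract
    ∣modulus : ∀ {i j} → i ℕ.<′ j → q (nodes i) ℕ.∣ proj₁ (modulus j)
    ∣modulus {i} ℕ.<′-base         = q∣next (modulus i)
    ∣modulus {i} (ℕ.≤′-step {j} h) = ℕ.∣-trans (∣modulus {i} {j} h) (∣next (modulus j))

    ∣e : ∀ {i j} → i ℕ.<′ j → + q (nodes i) ∣ˢ Point.e (Node.S (nodes j))
    ∣e {i} {j} h = prime-∣e (modulus j) (q-prime (nodes i)) (∣modulus {i} {j} h)

-- Progressions of four squares from repeated doubling

module Progressions where

  open PolynomialIdentities hiding (solve; solve₁; solve₂; prove; ⟦_⟧)
  open Quartics using (module Quartic)
  open import Algebra.Bundles using (CommutativeRing)
  open import Algebra.Apartness.Bundles using (HeytingField; HeytingCommutativeRing)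
  import Algebra.Morphism.Construct.Composition as Composition
  open import Algebra.Morphism.Structures using (module RingMorphisms)
  open import Data.Integer.Base as ℤ using (ℤ; +_)
  import Data.Integer.Properties as ℤ
  open import Data.Fin.Patterns using (0F; 1F; 2F; 3F)
  open import Data.Nat.Base using (ℕ; zero; suc)
  open import Data.Product.Base using (_,_)
  open import Data.Sum.Base using ([_,_]′)
  open import Data.Vec.Base using ([]; _∷_)
  open import Relation.Binary.PropositionalEquality.Core as ≡ using (_≡_)
  open import Data.Vec.Functional using (Vector)
  open import Relation.Nullary.Negation.Core using (¬_)
  open import Relation.Binary.PropositionalEquality.Core using (_≢_)
  open import Function.Definitions using (Injective)
  open import Level using (0ℓ)

  -- Recursion by left multiplication by 2, so that the type of `double` matches the index of the
  -- next state definitionally.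
  2^_∙_ : ℕ → ℤ → ℤ
  2^ zero  ∙ m = m
  2^ suc k ∙ m = + 2 ℤ.* (2^ k ∙ m)

  module Progression (R : CommutativeRing 0ℓ 0ℓ)
           (ι : ℤ → CommutativeRing.Carrier R)
           (homomorphism : RingMorphisms.IsRingHomomorphism
             (CommutativeRing.rawRing ℤ.+-*-commutativeRing) (CommutativeRing.rawRing R) ι)
    where

    open CommutativeRing R
    open Solver R ι homomorphism
    open Quartic R ι homomorphism public

    -- A map from the curve r² + w² = s², r² + 4 w² = u² to the curve of progressions, both
    -- intersections of two quadrics; w = 0 goes to constant progressions. The terms of the
    -- progression are the squares of a, b, c, d.
    module Terms (r s u w : Carrier) where
      a b c d : Carrier
      a = u * w + r * s
      b = r * r + ι (+ 2) * (w * w)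
      c = r * w - s * u
      d = ι (+ 2) * (s * w) - r * u

      module _ (r²+w² : r * r + w * w ≈ s * s) (r²+4w² : r * r + ι (+ 4) * (w * w) ≈ u * u) where
        abstract
          first-differences : b * b - a * a ≈ c * c - b * b
          first-differences = solve₂ (r ∷ s ∷ u ∷ w ∷ []) (λ r s u w →
            let a = u :* w :+ r :* s ; b = r :* r :+ # 2 :* (w :* w) ; c = r :* w :- s :* u in
            (b :* b :- a :* a := c :* c :- b :* b) ,
            (r :* r :+ u :* u , (r :* r :+ w :* w := s :* s)) , r :* r :+ # 2 :* (w :* w) , (r :* r :+ # 4 :* (w :* w) := u :* u))
            ≡.refl r²+w² r²+4w²

          last-differences : c * c - b * b ≈ d * d - c * c
          last-differences = solve₂ (r ∷ s ∷ u ∷ w ∷ []) (λ r s u w →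
            let b = r :* r :+ # 2 :* (w :* w) ; c = r :* w :- s :* u ; d = # 2 :* (s :* w) :- r :* u in
            (c :* c :- b :* b := d :* d :- c :* c) ,
            (# 4 :* (w :* w) :- # 2 :* (u :* u) , (r :* r :+ w :* w := s :* s)) , r :* r :- # 2 :* (r :* r :+ w :* w) , (r :* r :+ # 4 :* (w :* w) := u :* u))
            ≡.refl r²+w² r²+4w²

          difference : b * b - a * a ≈ ι (+ 2) * (r * w * c)
          difference = solve₂ (r ∷ s ∷ u ∷ w ∷ []) (λ r s u w →
            let a = u :* w :+ r :* s ; b = r :* r :+ # 2 :* (w :* w) ; c = r :* w :- s :* u in
            (b :* b :- a :* a := # 2 :* (r :* w :* c)) ,
            (r :* r , (r :* r :+ w :* w := s :* s)) , w :* w , (r :* r :+ # 4 :* (w :* w) := u :* u))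
            ≡.refl r²+w² r²+4w²

    abstract
      -- The ratio (b² - a²) / b² is an invariant of the projective point, written here without
      -- division.
      proportional : ∀ {k a b a′ b′} → k * a ≈ a′ → k * b ≈ b′ → (b′ * b′ - a′ * a′) * (b * b) ≈ (b * b - a * a) * (b′ * b′)
      proportional {k} {a} {b} {a′} {b′} h h′ = solve₂ (k ∷ a ∷ b ∷ a′ ∷ b′ ∷ []) (λ k a b a′ b′ →
        ((b′ :* b′ :- a′ :* a′) :* (b :* b) := (b :* b :- a :* a) :* (b′ :* b′)) ,
        (b :* b :* (k :* a :+ a′) , (k :* a := a′)) , :- (a :* a :* (k :* b :+ b′)) , (k :* b := b′)) ≡.refl h h′

      OnCurve-cong : ∀ {ξ η η′ ζ} → η ≈ η′ → OnCurve ξ η ζ → OnCurve ξ η′ ζ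
      OnCurve-cong e c = trans c (*-cong (*-congˡ (+-congˡ (*-congˡ (*-cong e e)))) (+-congˡ (*-congˡ (*-cong e e))))

      OnCurve-double : ∀ ξ η ζ → OnCurve ξ η ζ →
        OnCurve (rᶜ ξ η ζ * rᶜ ξ η ζ) (ι (+ 2) * (η * ζ)) (rᶜ ξ η ζ * sᶜ ξ η ζ * uᶜ ξ η ζ)
      OnCurve-double ξ η ζ c = go (rᶜ ξ η ζ) (sᶜ ξ η ζ) (uᶜ ξ η ζ) (r²+w²≈s² ξ η ζ c) (r²+4w²≈u² ξ η ζ c)
        where
        go : ∀ r s u → r * r + wᶜ ξ η ζ * wᶜ ξ η ζ ≈ s * s → r * r + ι (+ 4) * (wᶜ ξ η ζ * wᶜ ξ η ζ) ≈ u * u →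
             OnCurve (r * r) (ι (+ 2) * (η * ζ)) (r * s * u)
        go r s u h h′ = solve₂ (r ∷ s ∷ u ∷ η ∷ ζ ∷ []) (λ r s u η ζ → let w = # 4 :* (η :* ζ) ; η′ = # 2 :* (η :* ζ) in
          (r :* s :* u :* (r :* s :* u) := r :* r :* (r :* r :+ # 4 :* (η′ :* η′)) :* (r :* r :+ # 16 :* (η′ :* η′))) ,
          (:- (r :* r :* (u :* u)) , (r :* r :+ w :* w := s :* s)) , :- (r :* r :* (r :* r :+ w :* w)) , (r :* r :+ # 4 :* (w :* w) := u :* u))
          ≡.refl h h′

  module Doubling (R : CommutativeRing 0ℓ 0ℓ)
           (ι : ℤ → CommutativeRing.Carrier R)
           (homomorphism : RingMorphisms.IsRingHomomorphism
             (CommutativeRing.rawRing ℤ.+-*-commutativeRing) (CommutativeRing.rawRing R) ι)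
    where

    open CommutativeRing R
    open Solver R ι homomorphism
    open Progression R ι homomorphism

    module Parity
             (Odd : Carrier → Set)
             (odd-cong : ∀ {x y} → x ≈ y → Odd x → Odd y)
             (odd-* : ∀ {x y} → Odd x → Odd y → Odd (x * y))
             (odd-+ : ∀ {x} y → Odd x → Odd (x + ι (+ 2) * y))
      where

      private module ι = RingMorphisms.IsRingHomomorphism homomorphism

      -- A point of the curve whose 2-adic behaviour is concentrated in the integer `m`, all other
      -- factors being odd. Doubling multiplies η by 2 ζ, so it doubles `m`.
      record State (m : ℤ) : Set where
        field
          ξ h ζ   : Carrier
          ξ-odd   : Odd ξ
          h-odd   : Odd h
          ζ-odd   : Odd ζ
        η : Carrier
        η = ι m * h
        field
          onCurve′ : OnCurve ξ η ζ

        r s u w : Carrier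
        r = rᶜ ξ η ζ
        s = sᶜ ξ η ζ
        u = uᶜ ξ η ζ
        w = wᶜ ξ η ζ

        open Terms r s u w public

        abstract
          r-odd : Odd r
          r-odd = odd-cong (solve (ξ ∷ η ∷ []) (λ ξ η → ξ :* ξ :+ # 2 :* (:- (# 32 :* (η :* η :* (η :* η)))) := ξ :* ξ :- # 64 :* (η :* η :* (η :* η))) ≡.refl) (odd-+ _ (odd-* ξ-odd ξ-odd))

          s-odd : Odd s
          s-odd = odd-cong (solve (ξ ∷ η ∷ []) (λ ξ η → ξ :* ξ :+ # 2 :* (# 4 :* (ξ :* (η :* η)) :+ # 32 :* (η :* η :* (η :* η))) := ξ :* ξ :+ # 8 :* (ξ :* (η :* η)) :+ # 64 :* (η :* η :* (η :* η))) ≡.refl) (odd-+ _ (odd-* ξ-odd ξ-odd))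

          u-odd : Odd u
          u-odd = odd-cong (solve (ξ ∷ η ∷ []) (λ ξ η → ξ :* ξ :+ # 2 :* (# 16 :* (ξ :* (η :* η)) :+ # 32 :* (η :* η :* (η :* η))) := ξ :* ξ :+ # 32 :* (ξ :* (η :* η)) :+ # 64 :* (η :* η :* (η :* η))) ≡.refl) (odd-+ _ (odd-* ξ-odd ξ-odd))

          b-odd : Odd b
          b-odd = odd-+ (w * w) (odd-* r-odd r-odd)

          c-odd : Odd c
          c-odd = odd-cong (solve (r ∷ s ∷ u ∷ η ∷ ζ ∷ []) (λ r s u η ζ → s :* u :+ # 2 :* (# 2 :* (r :* (η :* ζ)) :- s :* u) := r :* (# 4 :* (η :* ζ)) :- s :* u) ≡.refl) (odd-+ _ (odd-* s-odd u-odd))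

          b²-a²≈c²-b² : b * b - a * a ≈ c * c - b * b
          b²-a²≈c²-b² = first-differences (r²+w²≈s² ξ η ζ onCurve′) (r²+4w²≈u² ξ η ζ onCurve′)

          c²-b²≈d²-c² : c * c - b * b ≈ d * d - c * c
          c²-b²≈d²-c² = last-differences (r²+w²≈s² ξ η ζ onCurve′) (r²+4w²≈u² ξ η ζ onCurve′)

        oddPart : Carrier
        oddPart = h * ζ * r * c

        abstract
          oddPart-odd : Odd oddPart
          oddPart-odd = odd-* (odd-* (odd-* h-odd ζ-odd) r-odd) c-odd

          -- The common difference is 2 r w c with w = 4 η ζ, so its valuation exceeds that of `m`
          -- by exactly 3.
          b²-a² : b * b - a * a ≈ ι (+ 8 ℤ.* m) * oddPart
          b²-a² = trans (difference (r²+w²≈s² ξ η ζ onCurve′) (r²+4w²≈u² ξ η ζ onCurve′))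
            (trans (solve (ι m ∷ h ∷ ζ ∷ r ∷ c ∷ []) (λ m h ζ r c → # 2 :* (r :* (# 4 :* (m :* h :* ζ)) :* c) := # 8 :* m :* (h :* ζ :* r :* c)) ≡.refl)
              (*-congʳ (sym (ι.*-homo (+ 8) m))))

      double : ∀ {m} → State m → State (+ 2 ℤ.* m)
      double {m} P = record
        { ξ = r * r ; h = h * ζ ; ζ = r * s * u
        ; ξ-odd = odd-* r-odd r-odd
        ; h-odd = odd-* h-odd ζ-odd
        ; ζ-odd = odd-* (odd-* r-odd s-odd) u-odd
        ; onCurve′ = OnCurve-cong η′ (OnCurve-double ξ η ζ onCurve′) }
        where
        open State P
        abstract
          η′ : ι (+ 2) * (ι m * h * ζ) ≈ ι (+ 2 ℤ.* m) * (h * ζ)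
          η′ = trans (solve (ι m ∷ h ∷ ζ ∷ []) (λ m h ζ → # 2 :* (m :* h :* ζ) := # 2 :* m :* (h :* ζ)) ≡.refl) (*-congʳ (sym (ι.*-homo (+ 2) m)))

      states : ∀ {m} → State m → ∀ k → State (2^ k ∙ m)
      states P zero    = P
      states P (suc k) = double (states P k)

      -- The point attached to the root X has η = 9 a e²; its ξ is odd because ξ₀ = (X + a)² - 36 a
      -- e² inherits the oddness of X + a.
      start : ∀ {N A} X a e → N ≡ a ℤ.* (a ℤ.+ + 12 ℤ.* (e ℤ.* e)) →
              A ≡ a ℤ.* (a ℤ.* a ℤ.- + 36 ℤ.* (a ℤ.* (e ℤ.* e)) ℤ.+ + 108 ℤ.* (e ℤ.* e ℤ.* (e ℤ.* e))) →
              X * X * X ≈ ι (+ 3 ℤ.* N) * X + ι (+ 2 ℤ.* A) →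
              Odd (ι (+ 1)) → Odd (ι (+ 9)) → Odd (ι a) → Odd (X + ι a) →
              State (+ 9 ℤ.* (a ℤ.* (e ℤ.* e)))
      start X a e ≡.refl ≡.refl X³ 1-odd 9-odd a-odd X+a-odd = record
        { ξ = ξᶜ X (ι a) (ι e) ; h = ι (+ 1) ; ζ = ζᶜ X (ι a) (ι e)
        ; ξ-odd = odd-* 9-odd (odd-* (odd-* a-odd a-odd) ξ₀-odd)
        ; h-odd = 1-odd
        ; ζ-odd = odd-cong (solve (_ ∷ []) (λ z → z :+ # 2 :* (:- z) := :- z) ≡.refl)
            (odd-+ _ (odd-* 9-odd (odd-* (odd-* a-odd a-odd) (odd-* ξ₀-odd ξ₀′-odd))))
        ; onCurve′ = OnCurve-cong η′ (onCurve X (ι a) (ι e) root) }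
        where
        open Evaluation R ι homomorphism
        abstract
          root : X * X * X ≈ ι (+ 3) * (ι a * (ι a + ι (+ 12) * (ι e * ι e)) * X) + ι (+ 2) * (ι a * (ι a * ι a - ι (+ 36) * (ι a * (ι e * ι e)) + ι (+ 108) * (ι e * ι e * (ι e * ι e))))
          root = trans X³ (+-cong
            (trans (*-congʳ (sym (⟦⟧-ι (# 3 :* (α :* (α :+ # 12 :* (ε :* ε)))) (a ∷ e ∷ []))))
              (*-assoc (ι (+ 3)) (ι a * (ι a + ι (+ 12) * (ι e * ι e))) X))
            (sym (⟦⟧-ι (# 2 :* (α :* (α :* α :- # 36 :* (α :* (ε :* ε)) :+ # 108 :* (ε :* ε :* (ε :* ε))))) (a ∷ e ∷ []))))
            where
            α ε : Expr 2
            α = var 0F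
            ε = var 1F

          η′ : ηᶜ X (ι a) (ι e) ≈ ι (+ 9 ℤ.* (a ℤ.* (e ℤ.* e))) * ι (+ 1)
          η′ = trans (sym (trans (ι.*-homo (+ 9) (a ℤ.* (e ℤ.* e))) (*-congˡ (trans (ι.*-homo a (e ℤ.* e)) (*-congˡ (ι.*-homo e e))))))
            (sym (trans (*-congˡ ι.1#-homo) (*-identityʳ _)))

          ξ₀-odd : Odd (ξ₀ X (ι a) (ι e))
          ξ₀-odd = odd-cong (solve (X + ι a ∷ ι a ∷ ι e ∷ []) (λ y a e → y :* y :+ # 2 :* (:- (# 18 :* (a :* (e :* e)))) := y :* y :- # 36 :* (a :* (e :* e))) ≡.refl)
            (odd-+ _ (odd-* X+a-odd X+a-odd))

          ξ₀′-odd : Odd (ξ₀ X (ι a) (ι e) + ι (+ 18) * (ι a * (ι e * ι e)))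
          ξ₀′-odd = odd-cong (solve (ξ₀ X (ι a) (ι e) ∷ ι a ∷ ι e ∷ []) (λ x a e → x :+ # 2 :* (# 9 :* (a :* (e :* e))) := x :+ # 18 :* (a :* (e :* e))) ≡.refl)
            (odd-+ _ ξ₀-odd)

      module Embedding
             (odd≉0 : ∀ {m x} → m ≢ ℤ.0ℤ → Odd x → ¬ ι m * x ≈ 0#)
             (valuation : ∀ {m x y} → m ≢ ℤ.0ℤ → Odd x → Odd y →
                          ∀ k l → ι (+ 8 ℤ.* (2^ k ∙ m)) * x ≈ ι (+ 8 ℤ.* (2^ l ∙ m)) * y → k ≡ l)
             (K : Field)
             (j : Carrier → HeytingField.Carrier K)
             (j-hom : RingMorphisms.IsRingHomomorphism (CommutativeRing.rawRing R) (Defs.rawRing K) j)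
             (j-injective : Injective _≈_ (HeytingField._≈_ K) j)
        where

        private
          module K = HeytingField K
          module j = RingMorphisms.IsRingHomomorphism j-hom
          open FourSquares K
          module Kᴾ = Progression (HeytingCommutativeRing.commutativeRing K.heytingCommutativeRing) (λ n → j (ι n))
            (Composition.isRingHomomorphism K.trans homomorphism j-hom)

          abstract
            j-square-difference : ∀ x y → j (x * x - y * y) K.≈ j x K.* j x K.- j y K.* j y
            j-square-difference x y = K.trans (j.+-homo (x * x) (- (y * y)))
              (K.+-cong (j.*-homo x x) (K.trans (j.-‿homo (y * y)) (K.-‿cong (j.*-homo y y))))

            j≉0 : ∀ {x} → Odd x → ¬ j x K.≈ K.0#
            j≉0 {x} odd e = odd≉0 {+ 1} (λ ()) odd (trans (*-congˡ (j-injective (K.trans e (K.sym j.0#-homo)))) (zeroʳ (ι (+ 1))))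

        point : ∀ {m} → State m → ℙ³
        point P = v , 1F , j≉0 b-odd
          where
          open State P
          v : Vector K.Carrier 4
          v 0F = j a
          v 1F = j b
          v 2F = j c
          v 3F = j d

        abstract
          point-isAP : ∀ {m} (P : State m) → m ≢ ℤ.0ℤ → IsNonConstantAP (point P)
          point-isAP {m} P m≢0 =
              K.trans (K.sym (j-square-difference b a)) (K.trans (j.⟦⟧-cong b²-a²≈c²-b²) (j-square-difference c b))
            , K.trans (K.sym (j-square-difference c b)) (K.trans (j.⟦⟧-cong c²-b²≈d²-c²) (j-square-difference d c))
            , λ e → odd≉0 8m≢0 oddPart-odd (trans (sym b²-a²) (j-injective (K.trans (j-square-difference b a) (K.trans e (K.sym j.0#-homo)))))
            where
            open State P
            8m≢0 : + 8 ℤ.* m ≢ ℤ.0ℤ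
            8m≢0 e = [ (λ ()) , m≢0 ]′ (ℤ.i*j≡0⇒i≡0∨j≡0 (+ 8) e)

          -- Equal projective points have equal invariants (b² - a²) / b². As b is odd, the
          -- valuations of the common differences agree.
          point-injective : ∀ {m} → m ≢ ℤ.0ℤ → ∀ k l (P : State (2^ k ∙ m)) (Q : State (2^ l ∙ m)) → point P ∼ point Q → k ≡ l
          point-injective {m} m≢0 k l P Q (_ , _ , P∼Q) = ≡.sym (valuation m≢0
            (odd-* Q.oddPart-odd (odd-* P.b-odd P.b-odd)) (odd-* P.oddPart-odd (odd-* Q.b-odd Q.b-odd)) l k
            (trans (sym (*-assoc _ _ _)) (trans (*-congʳ (sym Q.b²-a²)) (trans (j-injective equal) (trans (*-congʳ P.b²-a²) (*-assoc _ _ _))))))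
            where
            module P = State P
            module Q = State Q
            split : ∀ x y z → j ((x * x - y * y) * (z * z)) K.≈ (j x K.* j x K.- j y K.* j y) K.* (j z K.* j z)
            split x y z = K.trans (j.*-homo (x * x - y * y) (z * z)) (K.*-cong (j-square-difference x y) (j.*-homo z z))
            equal : j ((Q.b * Q.b - Q.a * Q.a) * (P.b * P.b)) K.≈ j ((P.b * P.b - P.a * P.a) * (Q.b * Q.b))
            equal = K.trans (split Q.b Q.a P.b) (K.trans (Kᴾ.proportional (P∼Q 0F) (P∼Q 1F)) (K.sym (split P.b P.a Q.b)))

          2^≢0 : ∀ k {m} → m ≢ ℤ.0ℤ → 2^ k ∙ m ≢ ℤ.0ℤ
          2^≢0 zero    m≢0 = m≢0
          2^≢0 (suc k) m≢0 e = [ (λ ()) , 2^≢0 k m≢0 ]′ (ℤ.i*j≡0⇒i≡0∨j≡0 (+ 2) e)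

        infinitelyManyAPs : ∀ {m} → m ≢ ℤ.0ℤ → State m → InfinitelyMany _∼_ IsNonConstantAP
        infinitelyManyAPs m≢0 P = (λ k → point (states P k))
          , (λ {k} {l} → point-injective m≢0 k l (states P k) (states P l))
          , (λ k → point-isAP (states P k) (2^≢0 k m≢0))

-- Parity in the order generated by X and Y

module ProgressionsOverCubicFields where

  open PolynomialIdentities hiding (solve; solve₁; solve₂; prove; ⟦_⟧)
  open PrimeDivisibility
  open ConcordantForms using (prime[2])
  open GroupLawOnG using (∣-*; ∣-+⁻ˡ; ∣-≡)
  open CubesOnG using (Point; *-≢0; module Cubic)
  open CubicAlgebras using (module CubicAlgebra; module BaseChange)
  open IntegersInRationals using (ℚ-ring; fromℤ-isRingHomomorphism; fromℤ-injective)
  open CubicFields using (module CubicField)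
  open Nodes using (Node; module Node; cubicData; a≢0)
  open Progressions
  open import Algebra.Bundles using (CommutativeRing)
  open import Data.Integer.Base hiding (suc)
  open import Data.Integer.Properties
  open import Data.Integer.Divisibility.Signed renaming (_∣_ to _∣ˢ_; _∣?_ to _∣ˢ?_)
  open import Data.Nat.Base as ℕ using (ℕ; zero; suc)
  open import Data.Product.Base using (∃; _,_; proj₁; proj₂)
  open import Data.Rational.Literals using (fromℤ)
  open import Data.Sum.Base using ([_,_]′)
  open import Data.Empty using (⊥-elim)
  open import Data.Vec.Base using ([]; _∷_)
  open import Function.Base using (id)
  open import Relation.Nullary
  open import Relation.Nullary.Decidable using (from-no)
  open import Relation.Binary.PropositionalEquality

  private
    abstract
      2∤1 : ¬ + 2 ∣ˢ 1ℤ
      2∤1 = from-no (+ 2 ∣ˢ? 1ℤ)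

      2∤9 : ¬ + 2 ∣ˢ + 9
      2∤9 = from-no (+ 2 ∣ˢ? + 9)

      multiple : ∀ k m → ∃ λ c → 2^ k ∙ m ≡ m * c
      multiple zero    m = 1ℤ , sym (*-identityʳ m)
      multiple (suc k) m with multiple k m
      ... | c , e = + 2 * c , trans (cong (+ 2 *_) e) (trans (sym (*-assoc (+ 2) m c)) (trans (cong (_* c) (*-comm (+ 2) m)) (*-assoc m (+ 2) c)))

      2-valuation : ∀ {m x y} → m ≢ 0ℤ → ¬ + 2 ∣ˢ x → ¬ + 2 ∣ˢ y → ∀ k l → (2^ k ∙ m) * x ≡ (2^ l ∙ m) * y → k ≡ l
      2-valuation {m} {x} {y} m≢0 2∤x 2∤y = go
        where
        even : ∀ {x y} l → m * x ≡ (2^ suc l ∙ m) * y → + 2 ∣ˢ x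
        even {x} {y} l e = ∣-≡ (sym (*-cancelˡ-≡ m x (+ 2 * (c * y)) {{≢-nonZero m≢0}} (trans e (trans (cong (λ z → + 2 * z * y) (proj₂ (multiple l m)))
          (ℤSolver.solve (m ∷ c ∷ y ∷ []) (λ m c y → # 2 :* (m :* c) :* y := m :* (# 2 :* (c :* y))) refl))))) (∣-* (+ 2) (c * y) ∣-refl)
          where
          c : ℤ
          c = proj₁ (multiple l m)
        go : ∀ k l → (2^ k ∙ m) * x ≡ (2^ l ∙ m) * y → k ≡ l
        go zero    zero    e = refl
        go zero    (suc l) e = ⊥-elim (2∤x (even {x} {y} l e))
        go (suc k) zero    e = ⊥-elim (2∤y (even {y} {x} k (sym e)))
        go (suc k) (suc l) e = cong suc (go k l (*-cancelˡ-≡ (+ 2) ((2^ k ∙ m) * x) ((2^ l ∙ m) * y)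
          (trans (sym (*-assoc (+ 2) (2^ k ∙ m) x)) (trans e (*-assoc (+ 2) (2^ l ∙ m) y)))))

  module Order (N A : ℤ) where
    open CubicAlgebra +-*-commutativeRing id id-isRingHomomorphism N A public

    -- In a product every term of the first coordinate but x₀ y₀ is even. Hence x₀ modulo 2 is a
    -- ring homomorphism onto the field of two elements, and being odd means lying outside its
    -- kernel, a prime ideal above 2.
    Odd : Element → Set
    Odd x = ¬ + 2 ∣ˢ proj₁ x

    abstract
      odd-cong : ∀ {x y} → x ≈ᴷ y → Odd x → Odd y
      odd-cong (e , _) odd d = odd (∣-≡ (sym e) d)

      odd-* : ∀ {x y} → Odd x → Odd y → Odd (x *ᴷ y)
      odd-* {x₀ , x₁ , x₂} {y₀ , y₁ , y₂} odd odd′ d = [ odd , odd′ ]′ (prime-∣* prime[2] {x₀} {y₀}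
        (∣-+⁻ˡ (x₀ * y₀) (+ 2 * rest) d (∣-* (+ 2) rest ∣-refl)))
        where
        rest : ℤ
        rest = N * (x₁ * y₁) + A * (x₁ * y₂ + x₂ * y₁) + N * N * (x₂ * y₂)

      odd-+ : ∀ {x} y → Odd x → Odd (x +ᴷ ιᴷ (+ 2) *ᴷ y)
      odd-+ {x} y odd d = odd (∣-+⁻ˡ (proj₁ x) (proj₁ (ιᴷ (+ 2) *ᴷ y)) d
        (∣-≡ (sym (proj₁ (scalar-*ᴷ (+ 2) y))) (∣-* (+ 2) (proj₁ y) ∣-refl)))

      odd≉0 : ∀ {m x} → m ≢ 0ℤ → Odd x → ¬ ιᴷ m *ᴷ x ≈ᴷ scalar 0ℤ
      odd≉0 {m} {x} m≢0 odd (e , _) = [ m≢0 , (λ x₀≡0 → odd (divides 0ℤ x₀≡0)) ]′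
        (i*j≡0⇒i≡0∨j≡0 m (trans (sym (proj₁ (scalar-*ᴷ m x))) e))

      -- Integers act on each coordinate separately, so comparing first coordinates reduces the
      -- claim to 2-adic valuations in ℤ.
      valuation : ∀ {m x y} → m ≢ 0ℤ → Odd x → Odd y →
                  ∀ k l → ιᴷ (+ 8 * (2^ k ∙ m)) *ᴷ x ≈ᴷ ιᴷ (+ 8 * (2^ l ∙ m)) *ᴷ y → k ≡ l
      valuation {m} {x} {y} m≢0 odd odd′ k l (e , _) = 2-valuation m≢0 odd odd′ k l (*-cancelˡ-≡ (+ 8) ((2^ k ∙ m) * proj₁ x) ((2^ l ∙ m) * proj₁ y)
        (trans (sym (*-assoc (+ 8) (2^ k ∙ m) (proj₁ x))) (trans (trans (sym (proj₁ (scalar-*ᴷ (+ 8 * (2^ k ∙ m)) x)))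
          (trans e (proj₁ (scalar-*ᴷ (+ 8 * (2^ l ∙ m)) y)))) (*-assoc (+ 8) (2^ l ∙ m) (proj₁ y)))))

    module Parityᴷ = Doubling.Parity commutativeRing ιᴷ ιᴷ-isRingHomomorphism Odd (λ {x} {y} → odd-cong {x} {y}) (λ {x} {y} → odd-* {x} {y}) (λ {x} → odd-+ {x})

  module _ (node : Node) where
    open Node node
    open Point S
    open Cubic a e n using (N; A)

    private
      module Λ = Order N A

      abstract
        2∤a : ¬ + 2 ∣ˢ a
        2∤a d = coprime prime[2] d 2∣e

        9ae²≢0 : + 9 * (a * (e * e)) ≢ 0ℤ
        9ae²≢0 = *-≢0 {+ 9} (λ ()) (*-≢0 {a} (a≢0 node) (*-≢0 {e} e≢0 e≢0))

      state : Λ.Parityᴷ.State (+ 9 * (a * (e * e)))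
      state = Λ.Parityᴷ.start {N} {A} Λ.X a e refl refl Λ.X³ 2∤1 2∤9 2∤a (λ d → 2∤a (∣-≡ (+-identityˡ a) d))

    -- The points are doubled inside the order, where parity makes sense, and only the resulting
    -- progressions are embedded in the field. X has first coordinate 0, so X + a is odd with a.
    hasInfinitelyManyAPs : HasInfinitelyManyAPs (CubicField.field′ (cubicData node))
    hasInfinitelyManyAPs = Λ.Parityᴷ.Embedding.infinitelyManyAPs Λ.odd≉0 Λ.valuation (CubicField.heytingField (cubicData node))
      extend extend-isRingHomomorphism (λ (e₀ , e₁ , e₂) → fromℤ-injective e₀ , fromℤ-injective e₁ , fromℤ-injective e₂) 9ae²≢0 state
      where open BaseChange ℚ-ring fromℤ fromℤ-isRingHomomorphism N A

-- Fields with different totally ramified primes are not isomorphic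

module NonIsomorphism where

  open CubicAlgebras using (module CubicAlgebra)
  open IntegersInRationals
  open CubicFields using (CubicData; module RationalForm; module CubicField)
  open Nodes using (Node; module Node; cubicData; q; q-prime; q∤2; ramified; unramified)
  open CubesOnG using (module Point)
  open import Algebra.Bundles using (CommutativeRing)
  open import Algebra.Morphism.Structures using (module RingMorphisms)
  import Algebra.Morphism.Construct.Composition as Composition
  open import Data.Empty using (⊥)
  open import Data.Integer.Base as ℤ using (ℤ; +_; -[1+_]; 0ℤ)
  import Data.Integer.Properties as ℤ
  open import Data.Integer.Divisibility.Signed using (_∣_)
  open import Data.Nat.Base as ℕ using (ℕ; zero; suc)
  open import Data.Product.Base using (∃; _×_; _,_; proj₁; proj₂)
  open import Data.Rational.Base as ℚ using (ℚ; 0ℚ; 1ℚ; ↥_; ↧_)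
  open import Data.Rational.Literals using (fromℤ)
  import Data.Rational.Properties as ℚ
  open import Function.Definitions using (Injective)
  open import Level using (0ℓ)
  open import Relation.Binary.PropositionalEquality.Core as ≡ using (_≡_; _≢_)
  open import Relation.Nullary.Negation.Core using (¬_)

  module UniqueFromℚ (S : CommutativeRing 0ℓ 0ℓ) {f g : ℚ → CommutativeRing.Carrier S}
           (f-hom : RingMorphisms.IsRingHomomorphism (CommutativeRing.rawRing ℚ-ring) (CommutativeRing.rawRing S) f)
           (g-hom : RingMorphisms.IsRingHomomorphism (CommutativeRing.rawRing ℚ-ring) (CommutativeRing.rawRing S) g)
    where
    open CommutativeRing S
    private
      module f = RingMorphisms.IsRingHomomorphism f-hom
      module g = RingMorphisms.IsRingHomomorphism g-hom

    abstract
      agree-ℕ : ∀ n → f (fromℤ (+ n)) ≈ g (fromℤ (+ n))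
      agree-ℕ zero    = trans f.0#-homo (sym g.0#-homo)
      agree-ℕ (suc n) = trans (f.⟦⟧-cong (fromℤ-+ (+ 1) (+ n))) (trans (f.+-homo 1ℚ (fromℤ (+ n)))
        (trans (+-cong (trans f.1#-homo (sym g.1#-homo)) (agree-ℕ n)) (trans (sym (g.+-homo 1ℚ (fromℤ (+ n)))) (sym (g.⟦⟧-cong (fromℤ-+ (+ 1) (+ n)))))))

      agree-ℤ : ∀ n → f (fromℤ n) ≈ g (fromℤ n)
      agree-ℤ (+ n)      = agree-ℕ n
      agree-ℤ (-[1+ n ]) = trans (f.⟦⟧-cong (fromℤ-neg (+ suc n))) (trans (f.-‿homo (fromℤ (+ suc n)))
        (trans (-‿cong (agree-ℕ (suc n))) (trans (sym (g.-‿homo (fromℤ (+ suc n)))) (sym (g.⟦⟧-cong (fromℤ-neg (+ suc n)))))))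

      -- `_≅_` speaks of ring isomorphisms; this makes them ℚ-linear, so that they carry the
      -- equation of a generator from one field to the other.
      agree : ∀ q → f q ≈ g q
      agree q = cancel (invert (fromℤ (↧ q)) (λ e → ↧≢0 (fromℤ-injective e)))
        where
        ↧≢0 : ↧ q ≢ 0ℤ
        ↧≢0 ()
        d : ℚ
        d = fromℤ (↧ q)
        equal : f d * f q ≈ f d * g q
        equal = trans (sym (f.*-homo d q)) (trans (f.⟦⟧-cong (clear-denominator q)) (trans (agree-ℤ (↥ q))
          (trans (sym (g.⟦⟧-cong (clear-denominator q))) (trans (g.*-homo d q) (*-congʳ (sym (agree-ℤ (↧ q))))))))
        cancel : (∃ λ y → d ℚ.* y ≡ 1ℚ) → f q ≈ g q
        cancel (y , dy≡1) = trans (sym (unit (f q))) (trans (*-congˡ equal) (unit (g q)))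
          where
          unit : ∀ x → f y * (f d * x) ≈ x
          unit x = trans (sym (*-assoc (f y) (f d) x)) (trans (*-congʳ (trans (sym (f.*-homo y d)) (trans (f.⟦⟧-cong (≡.trans (ℚ.*-comm y d) dy≡1)) f.1#-homo))) (*-identityˡ x))

  module Roots (R : CommutativeRing 0ℓ 0ℓ) (ι : ℚ → CommutativeRing.Carrier R) (M B : ℚ) where
    open CommutativeRing R

    Root : Carrier → Set
    Root x = x * x * x ≈ ι M * x + ι B

    -- The coefficients c₂ and c₀ are the ones that compare trace and norm in `trace-zero-root`.
    Independent : Carrier → Set
    Independent x = ∀ c₂ c₁ c₀ → ι c₂ * (x * x) + (ι c₁ * x + ι c₀) ≈ 0# → c₂ ≡ 0ℚ × c₀ ≡ 0ℚ

  module Transfer (R S : CommutativeRing 0ℓ 0ℓ) (M B : ℚ)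
           {ι : ℚ → CommutativeRing.Carrier R} {κ : ℚ → CommutativeRing.Carrier S}
           (ι-hom : RingMorphisms.IsRingHomomorphism (CommutativeRing.rawRing ℚ-ring) (CommutativeRing.rawRing R) ι)
           (κ-hom : RingMorphisms.IsRingHomomorphism (CommutativeRing.rawRing ℚ-ring) (CommutativeRing.rawRing S) κ)
           {ψ : CommutativeRing.Carrier R → CommutativeRing.Carrier S}
           (ψ-mono : RingMorphisms.IsRingMonomorphism (CommutativeRing.rawRing R) (CommutativeRing.rawRing S) ψ)
    where
    private
      module R = CommutativeRing R
      module ψ = RingMorphisms.IsRingMonomorphism ψ-mono
      module R′ = Roots R ι M B
      module S′ = Roots S κ M B
    open CommutativeRing S

    abstract
      ψ-ι : ∀ q → ψ (ι q) ≈ κ q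
      ψ-ι = UniqueFromℚ.agree S (Composition.isRingHomomorphism trans ι-hom ψ.isRingHomomorphism) κ-hom

      ψ-³ : ∀ {x y} → ψ x ≈ y → ψ (x R.* x R.* x) ≈ y * y * y
      ψ-³ {x} e = trans (ψ.*-homo (x R.* x) x) (*-cong (trans (ψ.*-homo x x) (*-cong e e)) e)

      ψ-linear : ∀ c₁ c₀ {x y} → ψ x ≈ y → ψ (ι c₁ R.* x R.+ ι c₀) ≈ κ c₁ * y + κ c₀
      ψ-linear c₁ c₀ {x} e = trans (ψ.+-homo (ι c₁ R.* x) (ι c₀)) (+-cong (trans (ψ.*-homo (ι c₁) x) (*-cong (ψ-ι c₁) e)) (ψ-ι c₀))

      ψ-quadratic : ∀ c₂ c₁ c₀ {x y} → ψ x ≈ y →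
        ψ (ι c₂ R.* (x R.* x) R.+ (ι c₁ R.* x R.+ ι c₀)) ≈ κ c₂ * (y * y) + (κ c₁ * y + κ c₀)
      ψ-quadratic c₂ c₁ c₀ {x} e = trans (ψ.+-homo (ι c₂ R.* (x R.* x)) (ι c₁ R.* x R.+ ι c₀))
        (+-cong (trans (ψ.*-homo (ι c₂) (x R.* x)) (*-cong (ψ-ι c₂) (trans (ψ.*-homo x x) (*-cong e e)))) (ψ-linear c₁ c₀ e))

      root-image : ∀ {x y} → ψ x ≈ y → R′.Root x → S′.Root y
      root-image e h = trans (sym (ψ-³ e)) (trans (ψ.⟦⟧-cong h) (ψ-linear M B e))

      root-preimage : ∀ {x y} → ψ x ≈ y → S′.Root y → R′.Root x
      root-preimage e h = ψ.injective (trans (ψ-³ e) (trans h (sym (ψ-linear M B e))))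

      independent-image : ∀ {x y} → ψ x ≈ y → R′.Independent x → S′.Independent y
      independent-image e h c₂ c₁ c₀ h′ = h c₂ c₁ c₀ (ψ.injective (trans (ψ-quadratic c₂ c₁ c₀ e) (trans h′ (sym ψ.0#-homo))))

      independent-preimage : ∀ {x y} → ψ x ≈ y → S′.Independent y → R′.Independent x
      independent-preimage e h c₂ c₁ c₀ h′ = h c₂ c₁ c₀ (trans (sym (ψ-quadratic c₂ c₁ c₀ e)) (trans (ψ.⟦⟧-cong h′) ψ.0#-homo))

  module _ (D : CubicData) where
    open CubicData D using (N; A)
    open CubicAlgebra ℚ-ring fromℤ fromℤ-isRingHomomorphism (fromℤ N) (fromℤ A)

    Generator : (R : CommutativeRing 0ℓ 0ℓ) → (ℚ → CommutativeRing.Carrier R) → CommutativeRing.Carrier R → Set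
    Generator R ι x = Root x × Independent x
      where open Roots R ι (fromℤ (+ 3) ℚ.* fromℤ N) (fromℤ (+ 2) ℚ.* fromℤ A)

    abstract
      X-generator : Generator commutativeRing scalar X
      X-generator = X³ , independent
        where
        independent : ∀ c₂ c₁ c₀ → scalar c₂ *ᴷ (X *ᴷ X) +ᴷ (scalar c₁ *ᴷ X +ᴷ scalar c₀) ≈ᴷ scalar 0ℚ → c₂ ≡ 0ℚ × c₀ ≡ 0ℚ
        independent c₂ c₁ c₀ h = conclude (K.trans (K.sym (X-powers c₂ c₁ c₀)) h)
          where
          conclude : (c₂ ℚ.* (fromℤ (+ 2) ℚ.* fromℤ N) ℚ.+ c₀ , c₁ , c₂) ≈ᴷ scalar 0ℚ → c₂ ≡ 0ℚ × c₀ ≡ 0ℚ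
          conclude (e₀ , _ , e₂) = e₂ , ≡.trans (≡.sym (ℚ.+-identityˡ c₀))
            (≡.trans (≡.cong (ℚ._+ c₀) (≡.sym (≡.trans (≡.cong (ℚ._* (fromℤ (+ 2) ℚ.* fromℤ N)) e₂) (ℚ.*-zeroˡ (fromℤ (+ 2) ℚ.* fromℤ N))))) e₀)

  -- As q i is totally ramified in the first field, 2 A′ is the norm of an element of trace 0 only if q i ∣ 2 A′.
  module _ (i j : Node) (q∣e : + q i ∣ Point.e (Node.S j)) where
    private
      D E : CubicData
      D = cubicData i
      E = cubicData j
      open module D = CubicData D using (N; A)
      module E = CubicData E
      module Eᴬ = CubicField.Algebra E
      open CubicAlgebra ℚ-ring fromℤ fromℤ-isRingHomomorphism (fromℤ N) (fromℤ A)

    abstract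
      no-generator : ∀ x → ¬ Generator E commutativeRing scalar x
      -- The generator would have trace 0 and norm 2 A′, that is, give a zero of the form with M = -
      -- 2 A′ and L = 0 whose last coordinate is 1; anisotropy makes this coordinate 0.
      no-generator (x₀ , x₁ , x₂) (root , independent) = 1≢0 (proj₂ (proj₂ (RationalForm.form-anisotropic N A M 0ℤ
          (ramified i M 0ℤ (unramified j (q-prime i) q∣e (q∤2 i))) x₁ x₂ 1ℚ
          (≡.trans (≡.cong (λ m → form m 0ℚ x₁ x₂ 1ℚ) M≡) (norm⇒form (fromℤ E.A) x₀ x₁ x₂ (*≡0⇒≡0 (+ 3) x₀ (λ ()) (proj₁ trace)) (proj₂ trace))))))
        where
        M : ℤ
        M = ℤ.- (+ 2 ℤ.* E.A)
        1≢0 : 1ℚ ≢ 0ℚ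
        1≢0 ()
        M≡ : fromℤ M ≡ ℚ.- (fromℤ (+ 2) ℚ.* fromℤ E.A)
        M≡ = ≡.trans (fromℤ-neg (+ 2 ℤ.* E.A)) (≡.cong ℚ.-_ (fromℤ-* (+ 2) E.A))
        trace : fromℤ (+ 3) ℚ.* x₀ ≡ 0ℚ × norm (x₀ , x₁ , x₂) ≡ fromℤ (+ 2) ℚ.* fromℤ E.A
        trace = trace-zero-root (fromℤ (+ 3) ℚ.* fromℤ E.N) (fromℤ E.A) x₀ x₁ x₂ root independent

      ≇ : ¬ CubicField.field′ D ≅ CubicField.field′ E
      ≇ (ψ , iso) = conclude (proj₁ (ψ.surjective Eᴬ.X)) (proj₂ (ψ.surjective Eᴬ.X) K.refl)
        where
        module ψ = RingMorphisms.IsRingIsomorphism iso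
        open Transfer commutativeRing (Eᴬ.commutativeRing) (fromℤ (+ 3) ℚ.* fromℤ E.N) (fromℤ (+ 2) ℚ.* fromℤ E.A)
          scalar-isRingHomomorphism (Eᴬ.scalar-isRingHomomorphism) ψ.isRingMonomorphism
        conclude : ∀ x → ψ x Eᴬ.≈ᴷ Eᴬ.X → ⊥
        conclude x e = no-generator x (root-preimage e (proj₁ (X-generator E)) , independent-preimage e (proj₂ (X-generator E)))

      -- Here the generator is pushed forward along the isomorphism, whereas `≇` pulls it back by
      -- surjectivity; either way it lands in the field where q is totally ramified.
      ≇′ : ¬ CubicField.field′ E ≅ CubicField.field′ D
      ≇′ (ψ , iso) = no-generator (ψ (Eᴬ.X)) (root-image K.refl (proj₁ (X-generator E)) , independent-image K.refl (proj₂ (X-generator E)))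
        where
        module ψ = RingMorphisms.IsRingIsomorphism iso
        open Transfer (Eᴬ.commutativeRing) commutativeRing (fromℤ (+ 3) ℚ.* fromℤ E.N) (fromℤ (+ 2) ℚ.* fromℤ E.A)
          (Eᴬ.scalar-isRingHomomorphism) scalar-isRingHomomorphism ψ.isRingMonomorphism

-- The sequence of pairwise non-isomorphic fields

open CubicFields using (module CubicField)
open Nodes using (cubicData; nodes; ∣e)
open ProgressionsOverCubicFields using (hasInfinitelyManyAPs)
open NonIsomorphism using (≇; ≇′)
open import Data.Nat.Base as ℕ using (ℕ)
import Data.Nat.Properties as ℕ
open import Data.Product.Base using (_,_)
open import Data.Empty using (⊥-elim)
open import Function.Definitions using (Injective)
open import Relation.Binary.Definitions using (Tri; tri<; tri≈; tri>)
open import Relation.Binary.PropositionalEquality.Core using (_≡_)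

abstract
  fields : ℕ → CyclicCubicField
  fields i = CubicField.field′ (cubicData (nodes i))

  fields-injective : Injective _≡_ _≅_ fields
  fields-injective {i} {j} iso = compare (ℕ.<-cmp i j)
    where

    compare : Tri (i ℕ.< j) (i ≡ j) (j ℕ.< i) → i ≡ j
    compare (tri< i<j _ _) = ⊥-elim (≇ (nodes i) (nodes j) (∣e (ℕ.<⇒<′ i<j)) iso)
    compare (tri≈ _ i≡j _) = i≡j
    compare (tri> _ _ j<i) = ⊥-elim (≇′ (nodes j) (nodes i) (∣e (ℕ.<⇒<′ j<i)) iso)

  fields-haveAPs : ∀ i → HasInfinitelyManyAPs (fields i)
  fields-haveAPs i = hasInfinitelyManyAPs (nodes i)

theorem2p5 : InfinitelyMany _≅_ HasInfinitelyManyAPs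
theorem2p5 = fields , fields-injective , fields-haveAPs
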